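{- Let $m$ and $n$ be positive integers. Then, modulo $\Phi_n(q)^2$, \[ T_1(mn,(m-1)n,q)\equiv 2m-nm(2m-1)(1-q^n)+(-1)^n\bigl((1+(-1)^n)(m-1)+1\bigr)\bigl(mq^n-nm(m-1)(1-q^n)+2m(\mathcal{B}_n(q)-1)\bigr). \]
   Context: For integers $n,k$ the $q$-binomial coefficient is ${n\brack k}={n\brack k}_q=\frac{(1-q^n)(1-q^{n-1})\cdots(1-q^{n-k+1})}{(1-q)(1-q^2)\cdots(1-q^k)}$ if $0\le k\le n$, and $0$ otherwise; ${n\brack k}_{q^2}$ denotes the same with $q$ replaced by $q^2$. The $q$-trinomial coefficient of Andrews and Baxter is \[ T_1(N,M,q)=\sum_{k=0}^{N}(-q)^k{N\brack k}_{q^2}{2N-2k\brack N-M-k}. \] $\Phi_n(q)$ is the $n$th cyclotomic polynomial. For rational functions $A(q),B(q)$ and a polynomial $P(q)\in\mathbb{Z}[q]$, $A(q)\equiv B(q)\pmod{P(q)}$ means that $A(q)-B(q)$, written as a quotient $A_1(q)/A_2(q)$, has numerator divisible by $P(q)$ and denominator coprime to $P(q)$. Define, for a positive integer $n$, \[ \mathcal{B}_n(q)=\begin{cases}(-1)^r(1+q^{2r})q^{r(3r-5)/2}, & n=3r,\\ (-1)^rq^{r(3r+1)/2}, & n=3r+1,\\ (-1)^{r+1}q^{(r-1)(3r+2)/2}, & n=3r+2.\end{cases} \] -}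

module Defs where

open import Data.Nat as ℕ using (ℕ; zero; suc; _∸_)
open import Data.Nat.Divisibility using (_∣?_)
open import Data.Nat.DivMod using (_/_; _mod_)
open import Data.Integer as ℤ using (ℤ; +_; -[1+_]; 0ℤ; 1ℤ; -1ℤ; _≤?_)
import Data.Integer.DivMod as ℤD
open import Data.Fin using (Fin; zero; suc)
open import Data.List using (List; []; _∷_; map; replicate; _++_; length; reverse; foldr)
open import Data.List.Relation.Unary.All using (All)
open import Data.Product using (Σ; _×_; _,_; ∃)
open import Data.Bool using (Bool; true; false; if_then_else_)
open import Relation.Nullary using (¬_; does)
open import Relation.Binary.PropositionalEquality using (_≡_)

-- Polynomials in ℤ[q]: coefficient lists, lowest degree first.

Poly : Set
Poly = List ℤ

infixl 6 _+ᴾ_ _-ᴾ_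
infixl 7 _*ᴾ_

_+ᴾ_ : Poly → Poly → Poly
[]       +ᴾ q        = q
(a ∷ p)  +ᴾ []       = a ∷ p
(a ∷ p)  +ᴾ (b ∷ q)  = (a ℤ.+ b) ∷ (p +ᴾ q)

negᴾ : Poly → Poly
negᴾ = map (λ x → ℤ.- x)

_-ᴾ_ : Poly → Poly → Poly
p -ᴾ q = p +ᴾ negᴾ q

scaleᴾ : ℤ → Poly → Poly
scaleᴾ c = map (c ℤ.*_)

_*ᴾ_ : Poly → Poly → Poly
[]      *ᴾ q = []
(a ∷ p) *ᴾ q = scaleᴾ a q +ᴾ (0ℤ ∷ (p *ᴾ q))

constᴾ : ℤ → Poly
constᴾ c = c ∷ []

oneᴾ : Poly
oneᴾ = constᴾ 1ℤ

qpow : ℕ → Poly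
qpow k = replicate k 0ℤ ++ (1ℤ ∷ [])

IsZeroᴾ : Poly → Set
IsZeroᴾ p = All (_≡ 0ℤ) p

_≈ᴾ_ : Poly → Poly → Set
p ≈ᴾ q = IsZeroᴾ (p -ᴾ q)

_∣ᴾ_ : Poly → Poly → Set
D ∣ᴾ P = ∃ λ Q → (D *ᴾ Q) ≈ᴾ P

Coprimeᴾ : Poly → Poly → Set
Coprimeᴾ A B = ∀ D → D ∣ᴾ A → D ∣ᴾ B → D ∣ᴾ oneᴾ

stripZeros : List ℤ → List ℤ
stripZeros []      = []
stripZeros (x ∷ xs) with does (x ℤ.≟ 0ℤ)
... | true  = stripZeros xs
... | false = x ∷ xs

normᴾ : Poly → Poly
normᴾ p = reverse (stripZeros (reverse p))

lead : Poly → ℤ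
lead []           = 0ℤ
lead (x ∷ [])     = x
lead (x ∷ y ∷ xs) = lead (y ∷ xs)

-- quotient of a by a monic b (b normalised), with fuel
divMonicF : ℕ → Poly → Poly → Poly
divMonicF zero    a b = []
divMonicF (suc f) a b with normᴾ a
... | a' with does (length a' ℕ.<? length b)
...   | true  = []
...   | false =
  let t = scaleᴾ (lead a') (qpow (length a' ∸ length b))
  in t +ᴾ divMonicF f (a' -ᴾ (t *ᴾ b)) b

divMonic : Poly → Poly → Poly
divMonic a b = divMonicF (suc (length a)) a (normᴾ b)

-- Cyclotomic polynomials: q^n - 1 = ∏_{d ∣ n} Φ_d(q).
-- Φ n is defined for n ≥ 1 (Φ 0 is a junk value, never used).

prodDividing : ℕ → List (ℕ × Poly) → Poly
prodDividing N []            = oneᴾ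
prodDividing N ((d , P) ∷ r) with does (d ∣? N)
... | true  = P *ᴾ prodDividing N r
... | false = prodDividing N r

mutual
  cycs : ℕ → List (ℕ × Poly)
  cycs zero    = []
  cycs (suc n) = cycs n ++ ((suc n , Φ (suc n)) ∷ [])

  Φ : ℕ → Poly
  Φ zero    = oneᴾ
  Φ (suc n) = divMonic (qpow (suc n) -ᴾ oneᴾ) (prodDividing (suc n) (cycs n))

record Frac : Set where
  constructor _/ᶠ_
  field
    num : Poly
    den : Poly
open Frac public

infixl 6 _+ᶠ_ _-ᶠ_
infixl 7 _*ᶠ_

_+ᶠ_ : Frac → Frac → Frac
(a /ᶠ b) +ᶠ (c /ᶠ d) = ((a *ᴾ d) +ᴾ (c *ᴾ b)) /ᶠ (b *ᴾ d)

_-ᶠ_ : Frac → Frac → Frac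
(a /ᶠ b) -ᶠ (c /ᶠ d) = ((a *ᴾ d) -ᴾ (c *ᴾ b)) /ᶠ (b *ᴾ d)

_*ᶠ_ : Frac → Frac → Frac
(a /ᶠ b) *ᶠ (c /ᶠ d) = (a *ᴾ c) /ᶠ (b *ᴾ d)

polyᶠ : Poly → Frac
polyᶠ p = p /ᶠ oneᴾ

constᶠ : ℤ → Frac
constᶠ c = polyᶠ (constᴾ c)

qpowᶠ : ℤ → Frac
qpowᶠ (+ k)    = polyᶠ (qpow k)
qpowᶠ -[1+ k ] = oneᴾ /ᶠ qpow (suc k)

-- Congruence of rational functions modulo a polynomial P, as in the paper:
-- A - B = A₁/A₂ with P ∣ A₁ and A₂ coprime to P.
_≡_[modᴾ_] : Frac → Frac → Poly → Set
A ≡ B [modᴾ P ] =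
  Σ Poly λ A₁ → Σ Poly λ A₂ →
    ¬ IsZeroᴾ A₂ × Coprimeᴾ A₂ P × P ∣ᴾ A₁ ×
    ((A₁ *ᴾ den (A -ᶠ B)) ≈ᴾ (A₂ *ᴾ num (A -ᶠ B)))

sgn : ℕ → ℤ
sgn zero    = 1ℤ
sgn (suc k) = ℤ.- sgn k

-- q-binomial coefficients [n k]_{q^d} (d = 1: [n k]_q, d = 2: [n k]_{q^2}).

numProd : ℕ → ℕ → ℕ → Poly
numProd d a zero    = oneᴾ
numProd d a (suc b) = numProd d a b *ᴾ (oneᴾ -ᴾ qpow (d ℕ.* (a ∸ b)))

denProd : ℕ → ℕ → Poly
denProd d zero    = oneᴾ
denProd d (suc b) = denProd d b *ᴾ (oneᴾ -ᴾ qpow (d ℕ.* suc b))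

qbin : ℕ → ℤ → ℤ → Frac
qbin d (+ a) (+ b) with does (b ℕ.≤? a)
... | true  = numProd d a b /ᶠ denProd d b
... | false = constᶠ 0ℤ
qbin d _ _ = constᶠ 0ℤ

sumᶠ : List Frac → Frac
sumᶠ = foldr _+ᶠ_ (constᶠ 0ℤ)

upTo : ℕ → List ℕ
upTo zero    = zero ∷ []
upTo (suc n) = upTo n ++ (suc n ∷ [])

T₁ : ℕ → ℤ → Frac
T₁ N M = sumᶠ (map term (upTo N))
  where
  term : ℕ → Frac
  term k = (constᶠ (sgn k) *ᶠ qpowᶠ (+ k))
           *ᶠ qbin 2 (+ N) (+ k)
           *ᶠ qbin 1 ((+ (2 ℕ.* N)) ℤ.- (+ (2 ℕ.* k))) ((+ N) ℤ.- M ℤ.- (+ k))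

half : ℤ → ℤ
half z = z ℤD./ (+ 2)

𝓑′ : ℕ → Fin 3 → Frac
𝓑′ r zero = constᶠ (sgn r) *ᶠ polyᶠ (oneᴾ +ᴾ qpow (2 ℕ.* r))
            *ᶠ qpowᶠ (half ((+ r) ℤ.* ((+ (3 ℕ.* r)) ℤ.- (+ 5))))
𝓑′ r (suc zero) = constᶠ (sgn r)
            *ᶠ qpowᶠ (half ((+ r) ℤ.* (+ (3 ℕ.* r ℕ.+ 1))))
𝓑′ r (suc (suc zero)) = constᶠ (sgn (suc r))
            *ᶠ qpowᶠ (half (((+ r) ℤ.- (+ 1)) ℤ.* (+ (3 ℕ.* r ℕ.+ 2))))

𝓑 : ℕ → Frac
𝓑 n = 𝓑′ (n / 3) (n mod 3)

RHS : ℕ → ℕ → Frac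
RHS m n =
  constᶠ (2ℤ′ ℤ.* m′)
  -ᶠ (constᶠ (n′ ℤ.* m′ ℤ.* (2ℤ′ ℤ.* m′ ℤ.- 1ℤ)) *ᶠ oneMinusqn)
  +ᶠ (constᶠ (sgn n ℤ.* ((1ℤ ℤ.+ sgn n) ℤ.* (m′ ℤ.- 1ℤ) ℤ.+ 1ℤ))
      *ᶠ ( (constᶠ m′ *ᶠ qpowᶠ (+ n))
           -ᶠ (constᶠ (n′ ℤ.* m′ ℤ.* (m′ ℤ.- 1ℤ)) *ᶠ oneMinusqn)
           +ᶠ (constᶠ (2ℤ′ ℤ.* m′) *ᶠ (𝓑 n -ᶠ constᶠ 1ℤ))))
  where
  m′ n′ 2ℤ′ : ℤ
  m′ = + m
  n′ = + n
  2ℤ′ = + 2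
  oneMinusqn : Frac
  oneMinusqn = polyᶠ (oneᴾ -ᴾ qpow n)

{-# OPTIONS --safe #-}
module Submission where

-- Write p = q², ε = 1 - qⁿ, and work in ℤ[q]/Φₙ², where ε² = 0 and where the nonzero integers and
-- the 1 - qʲ with n ∤ j are not zero divisors.  Only the terms k ≤ n of T₁ are nonzero.
--
-- * For k = 0 and k = n one needs [an, n] to second order.  After dividing out the zero divisors this
--   is a value E(1 - t) of E(y) = ∏_{0<j<s} (1 - xʲy) with t² = 0, and pairing j with s - j gives
--   E(1 - t)² = (1 - t)^{s-1} E(1)².
-- * For k = n - l with 0 < l < n the term has a factor ε (two of them, so it vanishes, when 2l > n),
--   and it equals, up to a constant, (-1)ˡ q^{l(l-3)/2} (1 - qⁿ)/(1 - q^{n-l}) [n-l, l].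
-- * The sum of these expressions over 0 ≤ l ≤ n/2 is exactly 𝓑ₙ: it equals αₙ - q⁻¹ αₙ₋₂ for
--   αₙ = ∑ (-1)ᵏ q^{k(k-1)/2} [n-k, k], and αₙ₊₃ = -qⁿ⁺¹ αₙ.
--
-- That Φₙ, defined by a division with remainder, satisfies Φₙ ∏_{d∣n, d<n} Φ_d = qⁿ - 1 follows by
-- induction: if g properly divides n then 1 + q^g + … + q^{n-g} is a multiple of Φₙ, so that
-- n/g ∈ (Φₙ, q^g - 1), which makes the Φ_d pairwise coprime over ℚ.  As q 𝓑ₙ ∈ ℤ[q], all
-- congruences are multiplied by q.

-- The factor (1 + (-1)ⁿ)(m - 1) + 1 is 1 for odd n and 2m - 1 for even n, and its source is the
-- base p: for odd n the 1 - pʲ are not zero divisors until j = n, while for even n already 1 -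
-- p^(n/2) is ε. The factor is the constant C with ε [mn - 1, n - 1] = C ε in base p; it multiplies
-- every middle term, and also the term k = n because [mn, n] is a multiple of [mn - 1, n - 1].
--
-- The obstacle is that in ℤ[q]/Φₙ² neither the integers nor the 1 - qʲ are units in general. So no
-- quotient is formed: equations are multiplied by non-zero-divisors, which are cancelled at the
-- end, and halves such as a(a - 1)/2 are avoided by doubling. Nonzero integers may be cancelled
-- because Φₙ² is monic. Identities that would need division by ε itself are proved in ℤ[q] and then
-- carried to the quotient.

open import Defs
open import Algebra.Bundles using (CommutativeRing)
import Algebra.Solver.Ring as RingSolver
open import Algebra.Solver.Ring.AlmostCommutativeRing using (fromCommutativeRing; _-Raw-AlmostCommutative⟶_)
open import Algebra.Structures using (IsCommutativeRing)
open import Data.Bool using (true; false; T)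
open import Data.Fin using (Fin; zero; suc; toℕ)
open import Data.Integer as ℤ using (ℤ; +_; 0ℤ; 1ℤ)
import Data.Integer.Properties as ℤ
import Data.Integer.Tactic.RingSolver as ℤ-Solver
open import Data.List using (List; []; _∷_; _∷ʳ_; _++_; foldr; length; map; reverse)
import Data.List.Properties as List
open import Data.List.Relation.Unary.All as All using (All; []; _∷_)
import Data.List.Relation.Unary.All.Properties as All
open import Data.List.Relation.Unary.AllPairs using (AllPairs; []; _∷_)
import Data.List.Relation.Unary.AllPairs.Properties as AllPairs
open import Data.List.Reverse using (Reverse; reverseView; []; _∶_∶ʳ_)
open import Data.Maybe using (Maybe; just; nothing)
open import Data.Nat as ℕ using (ℕ; zero; suc; _∸_; _≤_; _<_; z≤n; s≤s)
import Data.Nat.DivMod as ℕ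
import Data.Nat.Divisibility as ℕ
import Data.Nat.GCD as ℕ
import Data.Nat.Properties as ℕ
import Data.Nat.Tactic.RingSolver as ℕ-Solver
open import Data.Product using (_,_; _×_; ∃; proj₁; proj₂)
open import Data.Sum using (_⊎_; inj₁; inj₂)
open import Data.Unit using (tt)
open import Relation.Binary using (IsEquivalence; tri<; tri≈; tri>)
open import Relation.Binary.PropositionalEquality as ≡ using (_≡_; _≢_; cong; cong₂; subst)
open import Relation.Nullary using (yes; no; contradiction)

-- The operations are kept apart from the equality: ℤ[q] and its quotients share the operations, so that
-- gauss, ∑, … denote the same polynomials over each of them.
record Ops : Set₁ where
  infixl 6 _+_
  infixl 7 _*_
  infix 8 -_
  field
    A   : Set
    _+_ : A → A → A
    _*_ : A → A → A
    -_  : A → A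
    ι   : ℤ → A

record Laws (O : Ops) (_≈_ : Ops.A O → Ops.A O → Set) : Set where
  open Ops O
  field
    isCommutativeRing : IsCommutativeRing _≈_ _+_ _*_ -_ (ι 0ℤ) (ι 1ℤ)
    ι-+ : ∀ a b → ι (a ℤ.+ b) ≈ (ι a + ι b)
    ι-* : ∀ a b → ι (a ℤ.* b) ≈ (ι a * ι b)
    ι-neg : ∀ a → ι (ℤ.- a) ≈ (- ι a)

-- Gaussian binomials, finite sums and products in commutative rings.

module Raw (O : Ops) where
  open Ops O

  infixl 6 _-_
  infixr 8 _^_

  0# 1# : A
  0# = ι 0ℤ
  1# = ι 1ℤ

  _-_ : A → A → A
  x - y = x + (- y)

  _^_ : A → ℕ → A
  x ^ zero  = 1#
  x ^ suc n = x * x ^ n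

  gauss : A → ℕ → ℕ → A
  gauss x n       zero    = 1#
  gauss x zero    (suc k) = 0#
  gauss x (suc n) (suc k) = gauss x n k + x ^ suc k * gauss x n (suc k)

  ∑ : ℕ → (ℕ → A) → A
  ∑ zero    f = 0#
  ∑ (suc N) f = f 0 + ∑ N (λ i → f (suc i))

  ∏ : ℕ → (ℕ → A) → A
  ∏ zero    f = 1#
  ∏ (suc N) f = f 0 * ∏ N (λ i → f (suc i))

  [_]⟨_⟩ : ℕ → A → A
  [ a ]⟨ y ⟩ = ∑ a (λ i → y ^ i)

module Ring (O : Ops) (Eq : Ops.A O → Ops.A O → Set) (L : Laws O Eq) where
  open Ops O public
  open Raw O public
  open Laws L public

  infix 4 _≈_
  _≈_ : A → A → Set
  _≈_ = Eq

  commutativeRing : CommutativeRing _ _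
  commutativeRing = record { isCommutativeRing = isCommutativeRing }

  open CommutativeRing commutativeRing public
    using (refl; sym; trans; reflexive; +-cong; +-congˡ; +-congʳ; *-cong; *-congˡ
      ; *-congʳ; -‿cong; *-comm; *-assoc; +-assoc; +-comm; +-identityˡ; +-identityʳ; *-identityˡ; *-identityʳ; zeroʳ;
        -‿inverseʳ)

  private
    ι-≟ : (a b : ℤ) → Maybe (ι a ≈ ι b)
    ι-≟ a b with a ℤ.≟ b
    ... | yes e = just (reflexive (cong ι e))
    ... | no  _ = nothing

    ι-morphism : ℤ.+-*-rawRing -Raw-AlmostCommutative⟶ fromCommutativeRing commutativeRing
    ι-morphism = record { ⟦_⟧ = ι ; +-homo = ι-+ ; *-homo = ι-* ; -‿homo = ι-neg ; 0-homo = refl ; 1-homo = refl }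

  module Solver = RingSolver ℤ.+-*-rawRing (fromCommutativeRing commutativeRing) ι-morphism ι-≟
  open Solver public using (solve; con; _:+_; _:*_; :-_; _:-_; _:=_; Polynomial)

  :1 : ∀ {n} → Polynomial n
  :1 = con 1ℤ
  :0 : ∀ {n} → Polynomial n
  :0 = con 0ℤ

  -- An equation follows from hypotheses l ≈ r once it holds up to a combination of the differences l - r.
  by₁ : ∀ {x y l r} c → l ≈ r → x ≈ y + c * (l - r) → x ≈ y
  by₁ {x} {y} {l} {r} c h e = trans e (trans (+-congˡ (*-congˡ (+-congʳ h)))
    (solve 3 (λ y c r → y :+ c :* (r :- r) := y) refl y c r))

  by₂ : ∀ {x y l r l′ r′} c d → l ≈ r → l′ ≈ r′ → x ≈ y + c * (l - r) + d * (l′ - r′) → x ≈ y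
  by₂ c d h h′ e = by₁ c h (by₁ d h′ e)

  by₃ : ∀ {x y l r l′ r′ l″ r″} c d f → l ≈ r → l′ ≈ r′ → l″ ≈ r″ →
        x ≈ y + c * (l - r) + d * (l′ - r′) + f * (l″ - r″) → x ≈ y
  by₃ c d f h h′ h″ e = by₂ c d h h′ (by₁ f h″ e)

  ^-+ : ∀ x m n → x ^ (m ℕ.+ n) ≈ x ^ m * x ^ n
  ^-+ x zero    n = sym (*-identityˡ _)
  ^-+ x (suc m) n = trans (*-congˡ (^-+ x m n)) (sym (*-assoc _ _ _))

  ^-^ : ∀ x m n → (x ^ m) ^ n ≈ x ^ (n ℕ.* m)
  ^-^ x m zero    = refl
  ^-^ x m (suc n) = trans (*-congˡ (^-^ x m n)) (sym (^-+ x m (n ℕ.* m)))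

  ^-cong : ∀ {x y} n → x ≈ y → x ^ n ≈ y ^ n
  ^-cong zero    e = refl
  ^-cong (suc n) e = *-cong e (^-cong n e)

  ^≡ : ∀ x {m n} → m ≡ n → x ^ m ≈ x ^ n
  ^≡ x e = reflexive (cong (x ^_) e)

  ι-sgn : ∀ k → ι (sgn (suc k)) ≈ - ι (sgn k)
  ι-sgn k = ι-neg (sgn k)

  gauss-zero : ∀ x {n k} → n < k → gauss x n k ≈ 0#
  gauss-zero x {zero}  {suc k} _       = refl
  gauss-zero x {suc n} {suc k} (s≤s h) = trans
    (+-cong (gauss-zero x h) (*-congˡ (gauss-zero x (ℕ.m<n⇒m<1+n h))))
    (solve 1 (λ y → :0 :+ y :* :0 := :0) refl (x ^ suc k))

  private
    module Absorb (x : A) where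
      -- Absorption cannot be obtained by dividing, as 1 - x^(k+1) may be a zero divisor, so it is
      -- proved by induction on n. Pascal's rule turns `Down n k` into `Up n k`; then
      -- `Down (suc n) (suc k)` follows from `Up n (suc k)` and a second use of `Down n k`. The case
      -- k > n is separate because `n ∸ k` is truncated; there both coefficients vanish.
      Down : ℕ → ℕ → Set
      Down n k = (1# - x ^ suc k) * gauss x n (suc k) ≈ (1# - x ^ (n ∸ k)) * gauss x n k
      Up : ℕ → ℕ → Set
      Up n k = (1# - x ^ suc k) * gauss x (suc n) (suc k) ≈ (1# - x ^ suc n) * gauss x n k

      down⇒up : ∀ n k → Down n k → Up n k
      down⇒up n k h with k ℕ.≤? n
      ... | yes k≤n = by₂ (x ^ suc k) (gauss x n k) h e
              (solve 5 (λ g g′ u v w → (:1 :- u) :* (g :+ u :* g′) :=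
                 (:1 :- w) :* g :+ u :* ((:1 :- u) :* g′ :- (:1 :- v) :* g) :+ g :* (w :- u :* v)) refl
                 (gauss x n k) (gauss x n (suc k)) (x ^ suc k) (x ^ (n ∸ k)) (x ^ suc n))
        where
        e : x ^ suc n ≈ x ^ suc k * x ^ (n ∸ k)
        e = trans (^≡ x (≡.sym (cong suc (ℕ.m+[n∸m]≡n k≤n)))) (^-+ x (suc k) (n ∸ k))
      ... | no k≰n = by₂ ((1# - x ^ suc k) - (1# - x ^ suc n)) ((1# - x ^ suc k) * x ^ suc k)
              (gauss-zero x (ℕ.≰⇒> k≰n)) (gauss-zero x (ℕ.m<n⇒m<1+n (ℕ.≰⇒> k≰n)))
              (solve 4 (λ g g′ u w → (:1 :- u) :* (g :+ u :* g′) :=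
                 (:1 :- w) :* g :+ ((:1 :- u) :- (:1 :- w)) :* (g :- :0) :+ ((:1 :- u) :* u) :* (g′ :- :0)) refl
                 (gauss x n k) (gauss x n (suc k)) (x ^ suc k) (x ^ suc n))

      down : ∀ n k → Down n k
      down zero    zero    = solve 1 (λ x → (:1 :- x :* :1) :* :0 := (:1 :- :1) :* :1) refl x
      down zero    (suc k) = solve 1 (λ x → (:1 :- x) :* :0 := (:1 :- :1) :* :0) refl _
      down (suc n) zero    = trans (down⇒up n zero (down n zero)) refl
      down (suc n) (suc k) = trans (down⇒up n (suc k) (down n (suc k))) (sym step)
        where
        step : (1# - x ^ (n ∸ k)) * gauss x (suc n) (suc k) ≈ (1# - x ^ suc n) * gauss x n (suc k)
        step with k ℕ.≤? n
        ... | yes k≤n = by₂ (- 1#) (gauss x n (suc k)) (down n k) e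
                (solve 5 (λ g g′ u v w → (:1 :- v) :* (g :+ u :* g′) :=
                   (:1 :- w) :* g′ :+ (:- :1) :* ((:1 :- u) :* g′ :- (:1 :- v) :* g) :+ g′ :* (w :- u :* v)) refl
                   (gauss x n k) (gauss x n (suc k)) (x ^ suc k) (x ^ (n ∸ k)) (x ^ suc n))
          where
          e : x ^ suc n ≈ x ^ suc k * x ^ (n ∸ k)
          e = trans (^≡ x (≡.sym (cong suc (ℕ.m+[n∸m]≡n k≤n)))) (^-+ x (suc k) (n ∸ k))
        ... | no k≰n = by₂ (1# - x ^ (n ∸ k)) ((1# - x ^ (n ∸ k)) * x ^ suc k - (1# - x ^ suc n))
                (gauss-zero x (ℕ.≰⇒> k≰n)) (gauss-zero x (ℕ.m<n⇒m<1+n (ℕ.≰⇒> k≰n)))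
                (solve 5 (λ g g′ u v w → (:1 :- v) :* (g :+ u :* g′) :=
                   (:1 :- w) :* g′ :+ (:1 :- v) :* (g :- :0) :+ ((:1 :- v) :* u :- (:1 :- w)) :* (g′ :- :0)) refl
                   (gauss x n k) (gauss x n (suc k)) (x ^ suc k) (x ^ (n ∸ k)) (x ^ suc n))

  gauss-sucʳ : ∀ x n k → (1# - x ^ suc k) * gauss x n (suc k) ≈ (1# - x ^ (n ∸ k)) * gauss x n k
  gauss-sucʳ x = Absorb.down x

  gauss-suc-suc : ∀ x n k → (1# - x ^ suc k) * gauss x (suc n) (suc k) ≈ (1# - x ^ suc n) * gauss x n k
  gauss-suc-suc x n k = Absorb.down⇒up x n k (gauss-sucʳ x n k)

  -- Subtracting absorption from the defining recurrence moves the power of x from the second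
  -- summand to the first.
  gauss-pascal′ : ∀ x n k → gauss x (suc n) (suc k) ≈ x ^ (n ∸ k) * gauss x n k + gauss x n (suc k)
  gauss-pascal′ x n k = by₁ (- 1#) (gauss-sucʳ x n k)
    (solve 4 (λ g g′ u v → g :+ u :* g′ := v :* g :+ g′ :+ (:- :1) :* ((:1 :- u) :* g′ :- (:1 :- v) :* g)) refl
      (gauss x n k) (gauss x n (suc k)) (x ^ suc k) (x ^ (n ∸ k)))

  gauss-diag : ∀ x n → gauss x n n ≈ 1#
  gauss-diag x zero    = refl
  gauss-diag x (suc n) = by₂ 1# (x ^ suc n) (gauss-diag x n) (gauss-zero x {n} {suc n} (ℕ.n<1+n n))
    (solve 3 (λ g g′ u → g :+ u :* g′ := :1 :+ :1 :* (g :- :1) :+ u :* (g′ :- :0)) refl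
      (gauss x n n) (gauss x n (suc n)) (x ^ suc n))

  ∑-cong : ∀ N {f g : ℕ → A} → (∀ i → i < N → f i ≈ g i) → ∑ N f ≈ ∑ N g
  ∑-cong zero    h = refl
  ∑-cong (suc N) h = +-cong (h 0 (s≤s z≤n)) (∑-cong N (λ i i<N → h (suc i) (s≤s i<N)))

  ∑-zero : ∀ N → ∑ N (λ _ → 0#) ≈ 0#
  ∑-zero zero    = refl
  ∑-zero (suc N) = trans (+-identityˡ _) (∑-zero N)

  ∑-last : ∀ N (f : ℕ → A) → ∑ (suc N) f ≈ ∑ N f + f N
  ∑-last zero    f = +-comm _ _
  ∑-last (suc N) f = trans (+-congˡ (∑-last N (λ i → f (suc i)))) (sym (+-assoc _ _ _))

  ∑-+ : ∀ N (f g : ℕ → A) → ∑ N (λ i → f i + g i) ≈ ∑ N f + ∑ N g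
  ∑-+ zero    f g = sym (+-identityˡ _)
  ∑-+ (suc N) f g = trans (+-congˡ (∑-+ N _ _))
    (solve 4 (λ a b c d → (a :+ b) :+ (c :+ d) := (a :+ c) :+ (b :+ d)) refl (f 0) (g 0) _ _)

  ∑-*ˡ : ∀ N c (f : ℕ → A) → ∑ N (λ i → c * f i) ≈ c * ∑ N f
  ∑-*ˡ zero    c f = sym (zeroʳ c)
  ∑-*ˡ (suc N) c f = trans (+-congˡ (∑-*ˡ N c _)) (solve 3 (λ c a b → c :* a :+ c :* b := c :* (a :+ b)) refl c (f 0)
    _)

  ∑-reverse : ∀ N (f : ℕ → A) → ∑ N f ≈ ∑ N (λ i → f (N ∸ suc i))
  ∑-reverse zero    f = refl
  ∑-reverse (suc N) f = trans (∑-last N f) (trans (+-comm _ _) (+-congˡ (∑-reverse N f)))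

  ∑-split : ∀ M N (f : ℕ → A) → ∑ (M ℕ.+ N) f ≈ ∑ M f + ∑ N (λ i → f (M ℕ.+ i))
  ∑-split zero    N f = sym (+-identityˡ _)
  ∑-split (suc M) N f = trans (+-congˡ (∑-split M N _)) (sym (+-assoc _ _ _))

  ∏-cong : ∀ N {f g : ℕ → A} → (∀ i → i < N → f i ≈ g i) → ∏ N f ≈ ∏ N g
  ∏-cong zero    h = refl
  ∏-cong (suc N) h = *-cong (h 0 (s≤s z≤n)) (∏-cong N (λ i i<N → h (suc i) (s≤s i<N)))

  ∏-last : ∀ N (f : ℕ → A) → ∏ (suc N) f ≈ ∏ N f * f N
  ∏-last zero    f = *-comm _ _
  ∏-last (suc N) f = trans (*-congˡ (∏-last N (λ i → f (suc i)))) (sym (*-assoc _ _ _))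

  ∏-* : ∀ N (f g : ℕ → A) → ∏ N (λ i → f i * g i) ≈ ∏ N f * ∏ N g
  ∏-* zero    f g = sym (*-identityˡ _)
  ∏-* (suc N) f g = trans (*-congˡ (∏-* N _ _))
    (solve 4 (λ a b c d → (a :* b) :* (c :* d) := (a :* c) :* (b :* d)) refl (f 0) (g 0) _ _)

  ∏-reverse : ∀ N (f : ℕ → A) → ∏ N f ≈ ∏ N (λ i → f (N ∸ suc i))
  ∏-reverse zero    f = refl
  ∏-reverse (suc N) f = trans (∏-last N f) (trans (*-comm _ _) (*-congˡ (∏-reverse N f)))

  ∏-const : ∀ N c → ∏ N (λ _ → c) ≈ c ^ N
  ∏-const zero    c = refl
  ∏-const (suc N) c = *-congˡ (∏-const N c)

  -- The usual quotient of products with its denominator cleared. For k > n it still holds: the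
  -- right side then contains the factor i = n, which is 1 - x^0.
  gauss-∏ : ∀ x n k → ∏ k (λ i → 1# - x ^ suc i) * gauss x n k ≈ ∏ k (λ i → 1# - x ^ (n ∸ i))
  gauss-∏ x n zero    = *-identityˡ _
  gauss-∏ x n (suc k) = trans (*-congʳ (∏-last k _)) (trans
    (by₂ (∏ k (λ i → 1# - x ^ suc i)) (1# - x ^ (n ∸ k)) (gauss-sucʳ x n k) (gauss-∏ x n k)
      (solve 6 (λ d u g′ v g e → (d :* u) :* g′ := e :* v :+ d :* (u :* g′ :- v :* g) :+ v :* (d :* g :- e)) refl
        (∏ k (λ i → 1# - x ^ suc i)) (1# - x ^ suc k) (gauss x n (suc k)) (1# - x ^ (n ∸ k)) (gauss x n k)
          (∏ k (λ i → 1# - x ^ (n ∸ i)))))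
    (sym (∏-last k _)))

  geometric : ∀ a y → (1# - y) * [ a ]⟨ y ⟩ ≈ 1# - y ^ a
  geometric zero  y = solve 1 (λ y → (:1 :- y) :* :0 := :1 :- :1) refl y
  geometric (suc a) y = trans (*-congˡ (+-congˡ (∑-*ˡ a y (y ^_))))
    (by₁ y (geometric a y)
      (solve 3 (λ y s w → (:1 :- y) :* (:1 :+ y :* s) := :1 :- y :* w :+ y :* ((:1 :- y) :* s :- (:1 :- w))) refl
        y (∑ a (y ^_)) (y ^ a)))

  Regular : A → Set
  Regular x = ∀ y → x * y ≈ 0# → y ≈ 0#

  Regular-* : ∀ {x y} → Regular x → Regular y → Regular (x * y)
  Regular-* r s z e = s z (r _ (trans (sym (*-assoc _ _ _)) e))

  Regular-cong : ∀ {x y} → x ≈ y → Regular x → Regular y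
  Regular-cong e r z h = r z (trans (*-congʳ e) h)

  Regular-∏ : ∀ N {f : ℕ → A} → (∀ i → i < N → Regular (f i)) → Regular (∏ N f)
  Regular-∏ zero    h y e = trans (sym (*-identityˡ _)) e
  Regular-∏ (suc N) h = Regular-* (h 0 (s≤s z≤n)) (Regular-∏ N (λ i i<N → h (suc i) (s≤s i<N)))

  cancel : ∀ {x y z} → Regular x → x * y ≈ x * z → y ≈ z
  cancel {x} {y} {z} r e = by₁ 1# (r (y - z) (by₁ 1# e
      (solve 3 (λ x y z → x :* (y :- z) := :0 :+ :1 :* (x :* y :- x :* z)) refl x y z)))
    (solve 2 (λ y z → y := z :+ :1 :* (y :- z :- :0)) refl y z)

  ^-unit : ∀ {x y} n → y * x ≈ 1# → y ^ n * x ^ n ≈ 1#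
  ^-unit zero    e = *-identityˡ _
  ^-unit {x} {y} (suc n) e = by₂ (y ^ n * x ^ n) 1# e (^-unit n e)
    (solve 4 (λ x y a b → (y :* a) :* (x :* b) := :1 :+ (a :* b) :* (y :* x :- :1) :+ :1 :* (a :* b :- :1)) refl x y
      (y ^ n) (x ^ n))

  Regular-unit : ∀ {x y} → y * x ≈ 1# → Regular x
  Regular-unit {x} {y} e z h = by₂ (- z) y e h
    (solve 3 (λ x y z → z := :0 :+ (:- z) :* (y :* x :- :1) :+ y :* (x :* z :- :0)) refl x y z)

-- A finite pentagonal number identity.

tri : ℕ → ℕ
tri zero    = 0
tri (suc k) = k ℕ.+ tri k

2*tri : ∀ j → 2 ℕ.* tri j ℕ.+ j ≡ j ℕ.* j
2*tri zero    = ≡.refl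
2*tri (suc j) = ≡.trans (step j (tri j)) (≡.trans (cong (ℕ._+ (2 ℕ.* j ℕ.+ 1)) (2*tri j)) (square j))
  where
  step : ∀ j T → 2 ℕ.* (j ℕ.+ T) ℕ.+ suc j ≡ (2 ℕ.* T ℕ.+ j) ℕ.+ (2 ℕ.* j ℕ.+ 1)
  step = ℕ-Solver.solve-∀
  square : ∀ j → j ℕ.* j ℕ.+ (2 ℕ.* j ℕ.+ 1) ≡ suc j ℕ.* suc j
  square = ℕ-Solver.solve-∀

-- The generalised pentagonal numbers r(3r - 1)/2 and r(3r + 1)/2. The recursive form matches
-- `α-period`, which adds n + 1 to the exponent when it steps from n = 3r, respectively n = 3r + 1.
pent₀ pent₁ : ℕ → ℕ
pent₀ zero    = 0
pent₀ (suc r) = (1 ℕ.+ r ℕ.* 3) ℕ.+ pent₀ r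
pent₁ zero    = 0
pent₁ (suc r) = (2 ℕ.+ r ℕ.* 3) ℕ.+ pent₁ r

module Pentagonal (O : Ops) (Eq : Ops.A O → Ops.A O → Set) (L : Laws O Eq) (q : Ops.A O) where
  open Ring O Eq L

  private
    g : ℕ → ℕ → A
    g = gauss q

  -- The alternating sum of the `aTerm`s has no recurrence by Pascal's rule alone: the rule leaves
  -- the extra weight q^(n-k). Adjoining the sum with that weight gives a closed system of two
  -- recurrences. The number of summands is kept apart from n because shifting k by one changes the
  -- two differently.
  aTerm dTerm : ℕ → ℕ → A
  aTerm n k = ι (sgn k) * (q ^ tri k * g (n ∸ k) k)
  dTerm n k = ι (sgn k) * (q ^ tri k * (q ^ (n ∸ k) * g (n ∸ k) k))

  a d : ℕ → ℕ → A
  a N n = ∑ N (aTerm n)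
  d N n = ∑ N (dTerm n)

  private
    g-vanish : ∀ {n j} → n < j → g (n ∸ j) j ≈ 0#
    g-vanish {n} {suc j} n<j = gauss-zero q (≡.subst (_< suc j) (≡.sym (ℕ.m≤n⇒m∸n≡0 (ℕ.<⇒≤ n<j))) (s≤s z≤n))

    g-vanish′ : ∀ n j → n < suc j → g (n ∸ suc j) (suc j) ≈ 0#
    g-vanish′ n j = g-vanish {n} {suc j}

    g-vanish″ : ∀ {n j} → n < j → g (n ∸ j) (suc j) ≈ 0#
    g-vanish″ {n} {j} n<j = gauss-zero q (≡.subst (_< suc j) (≡.sym (ℕ.m≤n⇒m∸n≡0 (ℕ.<⇒≤ n<j))) (s≤s z≤n))

    g-low : ∀ n j → n < j → g (suc n ∸ j) (suc j) ≈ 0#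
    g-low n j n<j = gauss-zero q (≡.subst (_< suc j) (≡.sym (ℕ.m≤n⇒m∸n≡0 n<j)) (s≤s z≤n))

    pascal : ∀ n j → g (suc n ∸ j) (suc j) ≈ g (n ∸ j) j + q ^ suc j * g (n ∸ j) (suc j)
    pascal n j with j ℕ.≤? n
    ... | yes j≤n = reflexive (cong (λ t → g t (suc j)) (ℕ.+-∸-assoc 1 j≤n))
    ... | no j≰n = trans (g-low n j n<j) (sym (trans (+-cong (g-vanish n<j) (*-congˡ (g-vanish″ n<j)))
                     (solve 1 (λ y → :0 :+ y :* :0 := :0) refl _)))
      where n<j = ℕ.≰⇒> j≰n

    pascal′ : ∀ n j → g (suc n ∸ j) (suc j) ≈ q ^ (n ∸ j ∸ j) * g (n ∸ j) j + g (n ∸ j) (suc j)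
    pascal′ n j with j ℕ.≤? n
    ... | yes j≤n = trans (reflexive (cong (λ t → g t (suc j)) (ℕ.+-∸-assoc 1 j≤n))) (gauss-pascal′ q (n ∸ j) j)
    ... | no j≰n = trans (g-low n j n<j) (sym (trans (+-cong (*-congˡ (g-vanish n<j)) (g-vanish″ n<j))
                     (solve 1 (λ y → y :* :0 :+ :0 := :0) refl _)))
      where n<j = ℕ.≰⇒> j≰n

    pow-∸ : ∀ {m n} → m ≤ n → q ^ m * q ^ (n ∸ m) ≈ q ^ n
    pow-∸ {m} {n} m≤n = trans (sym (^-+ q m (n ∸ m))) (^≡ q (ℕ.m+[n∸m]≡n m≤n))

    pow-∸-g : ∀ m n x → (n < m → x ≈ 0#) → q ^ m * q ^ (n ∸ m) * x ≈ q ^ n * x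
    pow-∸-g m n x h with m ℕ.≤? n
    ... | yes m≤n = *-congʳ (pow-∸ m≤n)
    ... | no m≰n  = trans (*-congˡ e) (trans (zeroʳ _) (sym (trans (*-congˡ e) (zeroʳ _))))
      where e = h (ℕ.≰⇒> m≰n)

  -- `pascal′` is the right form of Pascal's rule here: its power q^(n-2j) meets the q^j split off
  -- from q^tri(j+1), and together they are the weight q^(n-j) of `dTerm`.
  a-suc-suc : ∀ N n → a (suc N) (2 ℕ.+ n) ≈ a (suc N) (1 ℕ.+ n) - d N n
  a-suc-suc N n = trans (+-congˡ (trans (∑-cong N (λ j _ → term j)) (trans (∑-+ N _ _)
    (+-congˡ (∑-*ˡ N (- 1#) (dTerm n))))))
    (solve 3 (λ x y z → x :+ (y :+ (:- :1) :* z) := x :+ y :- z) refl (aTerm (suc n) 0) (∑ N (λ j → aTerm (suc n)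
      (suc j))) (d N n))
    where
    term : ∀ j → aTerm (2 ℕ.+ n) (suc j) ≈ aTerm (1 ℕ.+ n) (suc j) + (- 1#) * dTerm n j
    term j = trans (*-cong (ι-sgn j) (*-cong (^-+ q j (tri j)) (pascal′ n j)))
      (trans (by₁ (- (ι (sgn j) * q ^ tri j)) (pow-∸-g j (n ∸ j) (g (n ∸ j) j) (gauss-zero q))
      (solve 7 (λ s u t v w x y → (:- s) :* ((u :* t) :* (v :* x :+ y)) :=
          (:- s) :* ((u :* t) :* y) :+ (:- :1) :* (s :* (t :* (w :* x))) :+ (:- (s :* t)) :* (u :* v :* x :- w :* x))
            refl
        (ι (sgn j)) (q ^ j) (q ^ tri j) (q ^ (n ∸ j ∸ j)) (q ^ (n ∸ j)) (g (n ∸ j) j) (g (n ∸ j) (suc j))))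
      (+-congʳ (sym (*-cong (ι-sgn j) (*-congʳ (^-+ q j (tri j)))))))

  -- Here the other form of Pascal's rule is needed: the weight q^(n+1-j) times q^j is the constant
  -- q^(n+1), so no weight is left over and only `aTerm`s remain.
  d-suc-suc : ∀ N n → d (suc N) (2 ℕ.+ n) ≈ q ^ (2 ℕ.+ n) * a (suc N) (1 ℕ.+ n) - q ^ (1 ℕ.+ n) * a N n
  d-suc-suc N n = trans (+-congˡ (trans (∑-cong N (λ j _ → term j)) (trans (∑-+ N _ _)
      (+-cong (∑-*ˡ N (q ^ (2 ℕ.+ n)) _) (∑-*ˡ N (- (q ^ (1 ℕ.+ n))) (aTerm n))))))
    (solve 4 (λ w y v z → :1 :* (:1 :* (w :* :1)) :+ (w :* y :+ (:- v) :* z) := w :* (:1 :* (:1 :* :1) :+ y) :- v :*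
      z) refl
      (q ^ (2 ℕ.+ n)) (∑ N (λ j → aTerm (suc n) (suc j))) (q ^ (1 ℕ.+ n)) (a N n))
    where
    term : ∀ j → dTerm (2 ℕ.+ n) (suc j) ≈ q ^ (2 ℕ.+ n) * aTerm (1 ℕ.+ n) (suc j) + (- (q ^ (1 ℕ.+ n))) * aTerm n j
    term j = trans (*-cong (ι-sgn j) (*-cong (^-+ q j (tri j)) (*-congˡ (pascal n j))))
      (trans (by₂ (- (ι (sgn j) * q ^ tri j)) (- (q * ι (sgn j) * q ^ j * q ^ tri j))
         (pow-∸-g j (suc n) (g (n ∸ j) j) (λ h → g-vanish (ℕ.<-trans (ℕ.n<1+n n) h)))
         (pow-∸-g j (suc n) (g (n ∸ j) (suc j)) (λ h → g-vanish″ (ℕ.<-trans (ℕ.n<1+n n) h)))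
      (solve 8 (λ s u t v w x y q → (:- s) :* ((u :* t) :* (v :* (x :+ q :* u :* y))) :=
          q :* w :* ((:- s) :* ((u :* t) :* y)) :+ (:- w) :* (s :* (t :* x)) :+ (:- (s :* t)) :* (u :* v :* x :- w :*
            x)
            :+ (:- (q :* s :* u :* t)) :* (u :* v :* y :- w :* y)) refl
        (ι (sgn j)) (q ^ j) (q ^ tri j) (q ^ (suc n ∸ j)) (q ^ suc n) (g (n ∸ j) j) (g (n ∸ j) (suc j)) q))
      (+-congʳ (*-congˡ (sym (*-cong (ι-sgn j) (*-congʳ (^-+ q j (tri j))))))))

  α δ : ℕ → A
  α n = a (suc n) n
  δ n = d (suc n) n

  private
    stable : ∀ (f : ℕ → ℕ → A) → (∀ n k → n ≤ k → f n (suc k) ≈ 0#) → ∀ n e → ∑ (suc (n ℕ.+ e)) (f n) ≈ ∑ (suc n)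
      (f n)
    stable f h n e = trans (+-congˡ (trans (∑-split n e _) (trans (+-congˡ (trans (∑-cong e (λ i _ → h n (n ℕ.+ i)
      (ℕ.m≤m+n n i))) (∑-zero e))) (+-identityʳ _)))) refl

    aTerm-zero : ∀ n k → n ≤ k → aTerm n (suc k) ≈ 0#
    aTerm-zero n k h = trans (*-congˡ (*-congˡ (g-vanish′ n k (s≤s h)))) (solve 2 (λ x y → x :* (y :* :0) := :0) refl
      _ _)

    dTerm-zero : ∀ n k → n ≤ k → dTerm n (suc k) ≈ 0#
    dTerm-zero n k h = trans (*-congˡ (*-congˡ (*-congˡ (g-vanish′ n k (s≤s h))))) (solve 3 (λ x y z → x :*
      (y :* (z :* :0)) := :0) refl _ _ _)

    a-stable : ∀ {N n} → n ≤ N → a (suc N) n ≈ α n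
    a-stable {N} {n} n≤N = ≡.subst (λ M → a (suc M) n ≈ α n) (ℕ.m+[n∸m]≡n n≤N) (stable aTerm aTerm-zero n (N ∸ n))

    d-stable : ∀ {N n} → n ≤ N → d (suc N) n ≈ δ n
    d-stable {N} {n} n≤N = ≡.subst (λ M → d (suc M) n ≈ δ n) (ℕ.m+[n∸m]≡n n≤N) (stable dTerm dTerm-zero n (N ∸ n))

  α-suc-suc : ∀ n → α (2 ℕ.+ n) ≈ α (1 ℕ.+ n) - δ n
  α-suc-suc n = trans (a-suc-suc (2 ℕ.+ n) n)
    (+-cong (a-stable (ℕ.n≤1+n (suc n))) (-‿cong (d-stable (ℕ.n≤1+n n))))

  δ-suc-suc : ∀ n → δ (2 ℕ.+ n) ≈ q ^ (2 ℕ.+ n) * α (1 ℕ.+ n) - q ^ (1 ℕ.+ n) * α n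
  δ-suc-suc n = trans (d-suc-suc (2 ℕ.+ n) n)
    (+-cong (*-congˡ (a-stable (ℕ.n≤1+n (suc n)))) (-‿cong (*-congˡ (a-stable (ℕ.n≤1+n n)))))

  -- Eliminating δ gives α(n+4) = α(n+3) - q^(n+2) α(n+1) + q^(n+1) α(n). By induction the first and
  -- the last summand cancel, which leaves the claim for n + 1.
  α-period : ∀ n → α (3 ℕ.+ n) ≈ - (q ^ (1 ℕ.+ n) * α n)
  α-period zero = trans (α-suc-suc 1) (trans (+-congʳ (α-suc-suc 0)) (solve 1 (λ q →
      (:1 :* (:1 :* :1) :+ ((con (ℤ.- 1ℤ)) :* (:1 :* :0) :+ :0)) :- (:1 :* (:1 :* (:1 :* :1)) :+ :0)
        :- (:1 :* (:1 :* ((q :* :1) :* :1)) :+ ((con (ℤ.- 1ℤ)) :* (:1 :* (:1 :* :0)) :+ :0))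
      := :- ((q :* :1) :* (:1 :* (:1 :* :1) :+ :0))) refl q))
  α-period (suc n) = by₃ 1# (- 1#) 1# (α-suc-suc (2 ℕ.+ n)) (δ-suc-suc n) (α-period n)
    (solve 7 (λ x₄ x₃ x₁ x₀ y v w → x₄ := :- (w :* x₁) :+ :1 :* (x₄ :- (x₃ :- y)) :+ (:- :1) :*
      (y :- (w :* x₁ :- v :* x₀))
        :+ :1 :* (x₃ :- (:- (v :* x₀)))) refl
      (α (4 ℕ.+ n)) (α (3 ℕ.+ n)) (α (1 ℕ.+ n)) (α n) (δ (2 ℕ.+ n)) (q ^ (1 ℕ.+ n)) (q ^ (2 ℕ.+ n)))

  private
    α-step : ∀ n r e → α n ≈ ι (sgn r) * q ^ e → α (3 ℕ.+ n) ≈ ι (sgn (suc r)) * q ^ ((1 ℕ.+ n) ℕ.+ e)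
    α-step n r e h = trans (α-period n) (trans (-‿cong (*-congˡ h)) (sym (trans (*-cong (ι-sgn r) (^-+ q (1 ℕ.+ n) e))
      (solve 3 (λ s u v → (:- s) :* (u :* v) := :- (u :* (s :* v))) refl (ι (sgn r)) (q ^ (1 ℕ.+ n)) (q ^ e)))))

  α-3r : ∀ r → α (r ℕ.* 3) ≈ ι (sgn r) * q ^ pent₀ r
  α-3r zero    = solve 0 (:1 :* (:1 :* :1) :+ :0 := :1 :* :1) refl
  α-3r (suc r) = α-step (r ℕ.* 3) r (pent₀ r) (α-3r r)

  α-3r+1 : ∀ r → α (1 ℕ.+ r ℕ.* 3) ≈ ι (sgn r) * q ^ pent₁ r
  α-3r+1 zero    = solve 0 (:1 :* (:1 :* :1) :+ (con (ℤ.- 1ℤ) :* (:1 :* :0) :+ :0) := :1 :* :1) refl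
  α-3r+1 (suc r) = α-step (1 ℕ.+ r ℕ.* 3) r (pent₁ r) (α-3r+1 r)

  α-3r+2 : ∀ r → α (2 ℕ.+ r ℕ.* 3) ≈ 0#
  α-3r+2 zero    = trans (α-suc-suc 0) (solve 0 ((:1 :* (:1 :* :1) :+ (con (ℤ.- 1ℤ) :* (:1 :* :0) :+ :0)) :-
    (:1 :* (:1 :* (:1 :* :1)) :+ :0) := :0) refl)
  α-3r+2 (suc r) = trans (α-period (2 ℕ.+ r ℕ.* 3)) (trans (-‿cong (*-congˡ (α-3r+2 r)))
    (solve 1 (λ x → :- (x :* :0) := :0) refl _))

  -- With l = j + 1 and n + 2 in place of n this is (1 - q^n)/(1 - q^(n-l)) [n-l, l] in a form
  -- without division, a q-analogue of the coefficients n/(n-l) C(n-l, l) of the Lucas polynomials.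
  lucas : ℕ → ℕ → A
  lucas n j = q ^ suc j * g (suc n ∸ j) (suc j) + g (n ∸ j) j

  -- `tri j` is l(l-3)/2 + 1 for l = j + 1: the summand of 𝓑ₙ has been multiplied by q, since
  -- l(l-3)/2 is -1 for l = 1 and l = 2.
  βTerm : ℕ → ℕ → A
  βTerm n j = ι (sgn (suc j)) * (q ^ tri j * lucas n j)

  -- The two parts of `lucas` are, up to sign and a factor q, summands of α(n+2) and of α(n). The
  -- separate q is the summand l = 0, which completes q α(n+2).
  ∑-βTerm : ∀ n → q + ∑ (suc n) (βTerm n) ≈ q * α (2 ℕ.+ n) - α n
  ∑-βTerm n = trans (+-congˡ (trans (∑-cong (suc n) (λ j _ → term j)) (trans (∑-+ (suc n) (λ j → q * aTerm (2 ℕ.+ n)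
    (suc j)) (λ j → (- 1#) * aTerm n j)) (+-cong (∑-*ˡ (suc n) q (λ j → aTerm (2 ℕ.+ n) (suc j))) (∑-*ˡ (suc n)
    (- 1#) (aTerm n))))))
    (trans (solve 3 (λ q x y → q :+ (q :* x :+ (:- :1) :* y) := q :* (:1 :* (:1 :* :1) :+ x) :- y) refl q
      (∑ (suc n) (λ j → aTerm (2 ℕ.+ n) (suc j))) (α n))
      (+-congʳ (*-congˡ (sym last))))
    where
    last : α (2 ℕ.+ n) ≈ a (2 ℕ.+ n) (2 ℕ.+ n)
    last = trans (∑-last (2 ℕ.+ n) (aTerm (2 ℕ.+ n))) (trans (+-congˡ
      (trans (*-congˡ (*-congˡ (gauss-zero q {n ∸ n} {2 ℕ.+ n} (≡.subst (_< 2 ℕ.+ n) (≡.sym (ℕ.n∸n≡0 n)) (s≤s z≤n)))))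
        (solve 2 (λ x y → x :* (y :* :0) := :0) refl _ _))) (+-identityʳ _))
    term : ∀ j → βTerm n j ≈ q * aTerm (2 ℕ.+ n) (suc j) + (- 1#) * aTerm n j
    term j = trans (*-congʳ (ι-sgn j)) (trans (solve 6 (λ s t q u x y → (:- s) :* (t :* (q :* u :* x :+ y)) :=
        q :* ((:- s) :* ((u :* t) :* x)) :+ (:- :1) :* (s :* (t :* y))) refl
        (ι (sgn j)) (q ^ tri j) q (q ^ j) (g (suc n ∸ j) (suc j)) (g (n ∸ j) j))
      (+-congʳ (*-congˡ (sym (*-cong (ι-sgn j) (*-congʳ (^-+ q j (tri j))))))))

-- Gaussian binomials to first order in a nilpotent element.

module Nilpotent (O : Ops) (Eq : Ops.A O → Ops.A O → Set) (L : Laws O Eq) where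
  open Ring O Eq L

  nat : ℕ → A
  nat k = ι (+ k)

  nat-suc : ∀ k → nat (suc k) ≈ 1# + nat k
  nat-suc k = ι-+ 1ℤ (+ k)

  ^-nilpotent : ∀ {t} → t * t ≈ 0# → ∀ k → (1# - t) ^ k ≈ 1# - nat k * t
  ^-nilpotent {t} h zero    = solve 1 (λ t → :1 := :1 :- :0 :* t) refl t
  ^-nilpotent {t} h (suc k) = trans (*-congˡ (^-nilpotent h k)) (by₂ (nat k) (t) h (nat-suc k)
    (solve 3 (λ t k k′ → (:1 :- t) :* (:1 :- k :* t) := :1 :- k′ :* t :+ k :* (t :* t :- :0) :+ t :*
      (k′ :- (:1 :+ k))) refl t (nat k) (nat (suc k))))

  -- The sum of 1 - i t over i < a is a - a(a-1)/2 t; doubling avoids the half.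
  []-nilpotent : ∀ {t} → t * t ≈ 0# → ∀ a → nat 2 * [ a ]⟨ 1# - t ⟩ ≈ nat 2 * nat a - nat a * (nat a - 1#) * t
  []-nilpotent {t} h zero    = solve 1 (λ t → con (+ 2) :* :0 := con (+ 2) :* :0 :- :0 :* (:0 :- :1) :* t) refl t
  []-nilpotent {t} h (suc a) = trans (*-congˡ (∑-last a _)) (by₃ 1# (nat 2)
      (- nat 2 + (nat (suc a) + nat a) * t)
      ([]-nilpotent h a) (^-nilpotent h a) (nat-suc a)
    (solve 5 (λ t k k′ s y → con (+ 2) :* (s :+ y) := con (+ 2) :* k′ :- k′ :* (k′ :- :1) :* t
        :+ :1 :* (con (+ 2) :* s :- (con (+ 2) :* k :- k :* (k :- :1) :* t))
        :+ con (+ 2) :* (y :- (:1 :- k :* t))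
        :+ (:- con (+ 2) :+ (k′ :+ k) :* t) :* (k′ :- (:1 :+ k))) refl t (nat a) (nat (suc a)) [ a ]⟨ 1# - t ⟩
          ((1# - t) ^ a)))

  -- The mere existence of the cofactor F is enough: when the product is squared and t² = 0, the
  -- term F² disappears and the rest determines t F.
  ∏-tangent : ∀ N t (f h k : ℕ → A) → (∀ i → f i ≈ h i + t * k i) → ∃ λ F → ∏ N f ≈ ∏ N h + t * F
  ∏-tangent zero    t f h k e = 0# , solve 1 (λ t → :1 := :1 :+ t :* :0) refl t
  ∏-tangent (suc N) t f h k e with ∏-tangent N t (λ i → f (suc i)) (λ i → h (suc i)) (λ i → k (suc i))
    (λ i → e (suc i))
  ... | F , e′ = h 0 * F + k 0 * (∏ N (λ i → h (suc i)) + t * F) , trans (*-cong (e 0) e′)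
    (solve 5 (λ a b c F t → (a :+ t :* b) :* (c :+ t :* F) := a :* c :+ t :* (a :* F :+ b :* (c :+ t :* F))) refl
      (h 0) (k 0) (∏ N (λ i → h (suc i))) F t)

  ^-*-^ : ∀ x {a b c} → a ℕ.+ b ≡ c → x ^ a * x ^ b ≈ x ^ c
  ^-*-^ x {a} {b} e = trans (sym (^-+ x a b)) (^≡ x e)

  gauss-shift : ∀ x n k i → ∏ i (λ j → 1# - x ^ suc (k ℕ.+ j)) * gauss x n (k ℕ.+ i) ≈ ∏ i (λ j → 1# - x ^
    (n ∸ (k ℕ.+ j))) * gauss x n k
  gauss-shift x n k zero    = *-congˡ (reflexive (cong (gauss x n) (ℕ.+-identityʳ k)))
  gauss-shift x n k (suc i) = trans (*-cong (∏-last i _) (reflexive (cong (gauss x n) (ℕ.+-suc k i))))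
    (trans (by₂ (∏ i (λ j → 1# - x ^ suc (k ℕ.+ j))) (1# - x ^ (n ∸ (k ℕ.+ i))) (gauss-sucʳ x n (k ℕ.+ i))
      (gauss-shift x n k i)
      (solve 7 (λ d u g′ v g e w → (d :* u) :* g′ := (e :* v) :* w :+ d :* (u :* g′ :- v :* g) :+ v :* (d :* g :- e
        :* w)) refl
        (∏ i (λ j → 1# - x ^ suc (k ℕ.+ j))) (1# - x ^ suc (k ℕ.+ i)) (gauss x n (suc (k ℕ.+ i)))
          (1# - x ^ (n ∸ (k ℕ.+ i)))
        (gauss x n (k ℕ.+ i)) (∏ i (λ j → 1# - x ^ (n ∸ (k ℕ.+ j)))) (gauss x n k)))
    (*-congʳ (sym (∏-last i _))))

  -- x behaves like a primitive s-th root of unity up to the nilpotent δ. This is applied to x = q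
  -- with s = n, to x = p with s = n when n is odd, and to x = p with s = n/2 when n is even.
  module Periodic (two : Regular (nat 2)) (x : A) (s′ : ℕ)
                  (reg : ∀ i → i < s′ → Regular (1# - x ^ suc i))
                  (δ²≈0 : (1# - x ^ suc s′) * (1# - x ^ suc s′) ≈ 0#) where
    s : ℕ
    s = suc s′

    δ D : A
    δ = 1# - x ^ s
    D = ∏ s′ (λ i → 1# - x ^ suc i)

    E : A → A
    E y = ∏ s′ (λ i → 1# - x ^ suc i * y)

    D-regular : Regular D
    D-regular = Regular-∏ s′ reg

    xˢ≈1-δ : x ^ s ≈ 1# - δ
    xˢ≈1-δ = solve 1 (λ y → y := :1 :- (:1 :- y)) refl (x ^ s)

    [xˢ]^ : ∀ b → x ^ (b ℕ.* s) ≈ 1# - nat b * δ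
    [xˢ]^ b = trans (sym (^-^ x s b)) (trans (^-cong b xˢ≈1-δ) (^-nilpotent δ²≈0 b))

    -- Pairing the factors i and s - i of E(1 - t)² multiplies each pair of E(1)² by 1 - t;
    -- the square root is extracted to first order in t.
    E-nilpotent : ∀ {t} → t * t ≈ 0# → t * x ^ s ≈ t → nat 2 * E (1# - t) ≈ (nat 2 - nat s′ * t) * D
    E-nilpotent {t} t²≈0 tx≈t = by₂ (nat 2) 1# u≈ 2tF≈
        (solve 5 (λ u D t F k → con (+ 2) :* u := (con (+ 2) :- k :* t) :* D :+ con (+ 2) :* (u :- (D :+ t :* F))
            :+ :1 :* (con (+ 2) :* (t :* F) :+ k :* t :* D :- :0)) refl u D t F (nat s′))
      where
      u : A
      u = E (1# - t)
      tangent : ∃ λ F → u ≈ D + t * F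
      tangent = ∏-tangent s′ t _ _ (λ i → x ^ suc i) (λ i → solve 2 (λ a t → :1 :- a :* (:1 :- t) := (:1 :- a) :+ t
        :* a) refl (x ^ suc i) t)
      F : A
      F = proj₁ tangent
      u≈ : u ≈ D + t * F
      u≈ = proj₂ tangent
      -- For a = x^(i+1) and b = x^(s-i-1) the two sides differ by t(1 - ab) up to multiples of t²,
      -- and t ab = t x^s = t.
      pair : ∀ i → i < s′ → (1# - x ^ suc i * (1# - t)) * (1# - x ^ suc (s′ ∸ suc i) * (1# - t)) ≈
                            (1# - t) * ((1# - x ^ suc i) * (1# - x ^ suc (s′ ∸ suc i)))
      pair i i<s′ = by₃ (- t) (- 1#) (x ^ suc i * x ^ suc (s′ ∸ suc i))
        (^-*-^ x {suc i} {suc (s′ ∸ suc i)} {s} (≡.trans (ℕ.+-suc (suc i) _) (cong suc (ℕ.m+[n∸m]≡n i<s′)))) tx≈t t²≈0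
        (solve 4 (λ a b c t → (:1 :- a :* (:1 :- t)) :* (:1 :- b :* (:1 :- t)) := (:1 :- t) :* ((:1 :- a) :*
          (:1 :- b))
            :+ (:- t) :* (a :* b :- c) :+ (:- :1) :* (t :* c :- t) :+ (a :* b) :* (t :* t :- :0)) refl
          (x ^ suc i) (x ^ suc (s′ ∸ suc i)) (x ^ s) t)
      u² : u * u ≈ (1# - nat s′ * t) * (D * D)
      u² = trans (*-congˡ (∏-reverse s′ _)) (trans (sym (∏-* s′ _ _)) (trans (∏-cong s′ pair) (trans (∏-* s′ _ _)
        (*-cong (trans (∏-const s′ (1# - t)) (^-nilpotent t²≈0 s′)) (trans (∏-* s′ _ _)
          (*-congˡ (sym (∏-reverse s′ _))))))))
      2tF≈ : nat 2 * (t * F) + nat s′ * t * D ≈ 0#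
      2tF≈ = D-regular _ (by₃ 1# (- (F * F)) (- (u + (D + t * F))) u² t²≈0 u≈
        (solve 5 (λ u D t F k → D :* (con (+ 2) :* (t :* F) :+ k :* t :* D) := :0 :+ :1 :* (u :* u :- (:1 :- k :* t)
          :* (D :* D))
            :+ (:- (F :* F)) :* (t :* t :- :0) :+ (:- (u :+ (D :+ t :* F))) :* (u :- (D :+ t :* F))) refl u D t F
              (nat s′)))

    E-power : ∀ b → nat 2 * E (x ^ (b ℕ.* s)) ≈ (nat 2 - nat s′ * (nat b * δ)) * D
    E-power b = trans (*-congˡ (∏-cong s′ (λ i _ → +-congˡ (-‿cong (*-congˡ ([xˢ]^ b))))))
      (E-nilpotent (by₁ (nat b * nat b) δ²≈0 (solve 2 (λ b d → (b :* d) :* (b :* d) := :0 :+ (b :* b) :*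
        (d :* d :- :0)) refl (nat b) δ))
        (by₁ (- nat b) δ²≈0 (solve 2 (λ b y → b :* (:1 :- y) :* y := b :* (:1 :- y) :+ (:- b) :* ((:1 :- y) :*
          (:1 :- y) :- :0)) refl (nat b) (x ^ s))))

    private
      E-reverse : ∀ b (f : ℕ → ℕ) → (∀ i → i < s′ → f (s′ ∸ suc i) ≡ suc i ℕ.+ b ℕ.* s) →
                  ∏ s′ (λ i → 1# - x ^ f i) ≈ E (x ^ (b ℕ.* s))
      E-reverse b f h = trans (∏-reverse s′ _) (∏-cong s′ (λ i i<s′ → +-congˡ (-‿cong (trans (^≡ x (h i i<s′))
        (^-+ x (suc i) (b ℕ.* s))))))

      ∸-flip : ∀ b {i} → i < s′ → s′ ℕ.+ b ℕ.* s ∸ (s′ ∸ suc i) ≡ suc i ℕ.+ b ℕ.* s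
      ∸-flip b {i} i<s′ = ≡.trans (ℕ.+-∸-comm (b ℕ.* s) (ℕ.m∸n≤m s′ (suc i))) (cong (ℕ._+ b ℕ.* s) (ℕ.m∸[m∸n]≡n i<s′))

    -- Read from the last to the first, the numerators of this coefficient are 1 - x^(i + bs) for 0
    -- < i < s, the factors of E at x^(bs).
    gauss-E : ∀ b → D * gauss x (s′ ℕ.+ b ℕ.* s) s′ ≈ E (x ^ (b ℕ.* s))
    gauss-E b = trans (gauss-∏ x (s′ ℕ.+ b ℕ.* s) s′) (E-reverse b (λ i → s′ ℕ.+ b ℕ.* s ∸ i) (λ i → ∸-flip b))

    gauss-pred : ∀ b → nat 2 * gauss x (s′ ℕ.+ b ℕ.* s) s′ ≈ nat 2 - nat s′ * (nat b * δ)
    gauss-pred b = cancel D-regular (by₂ (nat 2) 1# (gauss-E b) (E-power b)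
      (solve 4 (λ D G E z → D :* (con (+ 2) :* G) := D :* z :+ con (+ 2) :* (D :* G :- E) :+ :1 :* (con (+ 2) :* E :-
        z :* D)) refl
        D (gauss x (s′ ℕ.+ b ℕ.* s) s′) (E (x ^ (b ℕ.* s))) (nat 2 - nat s′ * (nat b * δ))))

    []≈ : ∀ a → nat 2 * [ a ]⟨ x ^ s ⟩ ≈ nat 2 * nat a - nat a * (nat a - 1#) * δ
    []≈ a = trans (*-congˡ (∑-cong a (λ i _ → ^-cong i xˢ≈1-δ))) ([]-nilpotent δ²≈0 a)

    -- With a = b + 1, the factor [a] contributes a(a-1)/2 δ and the coefficient [as-1, s-1]
    -- contributes a(a-1)(s-1)/2 δ; together they give the s in s δ. The factorisation is a
    -- hypothesis because it comes from absorption after cancelling 1 - x^s = δ, a nilpotent.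
    gauss-full : ∀ b → gauss x (suc b ℕ.* s) s ≈ [ suc b ]⟨ x ^ s ⟩ * gauss x (s′ ℕ.+ b ℕ.* s) s′ →
                 nat 2 * gauss x (suc b ℕ.* s) s ≈ nat 2 * nat (suc b) - nat (suc b) * (nat (suc b) - 1#) *
                   (nat s * δ)
    gauss-full b exact = cancel two (trans (by₃ (nat 2 * nat 2) (nat 2 * gauss x (s′ ℕ.+ b ℕ.* s) s′) (nat 2 * nat
      (suc b) - nat (suc b) * (nat (suc b) - 1#) * δ) exact ([]≈ (suc b)) (gauss-pred b)
        (solve 7 (λ F S G a b s′ d → con (+ 2) :* (con (+ 2) :* F) := (con (+ 2) :* a :- a :* (a :- :1) :* d) :*
          (con (+ 2) :- s′ :* (b :* d))
           :+ (con (+ 2) :* con (+ 2)) :* (F :- S :* G) :+ (con (+ 2) :* G) :* (con (+ 2) :* S :- (con (+ 2) :* a :-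
             a :* (a :- :1) :* d))
           :+ (con (+ 2) :* a :- a :* (a :- :1) :* d) :* (con (+ 2) :* G :- (con (+ 2) :- s′ :* (b :* d)))) refl
         (gauss x (suc b ℕ.* s) s) [ suc b ]⟨ x ^ s ⟩ (gauss x (s′ ℕ.+ b ℕ.* s) s′) (nat (suc b)) (nat b) (nat s′) δ))
      (trans (*-cong (+-cong (*-congˡ (nat-suc b)) (-‿cong (*-congʳ (*-cong (nat-suc b) (+-congʳ (nat-suc b))))))
        refl)
      (sym (trans (*-congˡ (+-cong (*-congˡ (nat-suc b)) (-‿cong (*-cong (*-cong (nat-suc b) (+-congʳ (nat-suc b)))
        (*-congʳ (nat-suc s′))))))
        (by₁ (- ((1# + nat b) * nat b * nat b * nat s′)) δ²≈0
        (solve 3 (λ b s d → con (+ 2) :* (con (+ 2) :* (:1 :+ b) :- (:1 :+ b) :* (:1 :+ b :- :1) :* ((:1 :+ s) :* d))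
          :=
          (con (+ 2) :* (:1 :+ b) :- (:1 :+ b) :* (:1 :+ b :- :1) :* d) :* (con (+ 2) :- s :* (b :* d)) :+
          (:- ((:1 :+ b) :* b :* b :* s)) :* (d :* d :- :0)) refl (nat b) (nat s′) δ))))))

    -- Raising the lower index from s - 1 to 2s - 1 crosses one singular denominator, 1 - x^s, which
    -- `exact` takes care of. The other s - 1 steps multiply by E(x^(bs))/E(x^s), and both values of
    -- E are known from `E-power`.
    gauss-double : ∀ b → gauss x (s′ ℕ.+ suc b ℕ.* s) s ≈ [ suc b ]⟨ x ^ s ⟩ * gauss x (s′ ℕ.+ suc b ℕ.* s) s′ →
                   gauss x (s′ ℕ.+ suc b ℕ.* s) (s ℕ.+ s′) ≈ [ suc b ]⟨ x ^ s ⟩ * (1# - nat s′ * (nat b * δ))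
    gauss-double b exact = cancel two (cancel two (by₃ (nat 2 + nat s′ * δ) (k * k * (H - nat b * J - (1# - nat b *
      nat b) * S)) (nat 2 - k * nat b * δ + k * δ) step δ²≈0 2J
          (solve 6 (λ H S b d k J → con (+ 2) :* (con (+ 2) :* H) := con (+ 2) :* (con (+ 2) :*
            (S :* (:1 :- k :* (b :* d))))
            :+ (con (+ 2) :+ k :* d) :* ((con (+ 2) :- k :* d) :* H :- (con (+ 2) :- k :* (b :* d)) :* J)
            :+ (k :* k :* (H :- b :* J :- (:1 :- b :* b) :* S)) :* (d :* d :- :0)
            :+ (con (+ 2) :- k :* b :* d :+ k :* d) :* (con (+ 2) :* J :- S :* (con (+ 2) :- k :* ((:1 :+ b) :* d))))
              refl
           H S (nat b) δ k J)))
      where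
      N : ℕ
      N = s′ ℕ.+ suc b ℕ.* s
      H J S k : A
      H = gauss x N (s ℕ.+ s′)
      J = gauss x N s
      S = [ suc b ]⟨ x ^ s ⟩
      k = nat s′
      2J : nat 2 * J ≈ S * (nat 2 - nat s′ * ((1# + nat b) * δ))
      2J = by₃ (nat 2) S (- (S * k * δ)) exact (gauss-pred (suc b)) (nat-suc b)
        (solve 7 (λ J S G b b′ d k → con (+ 2) :* J := S :* (con (+ 2) :- k :* ((:1 :+ b) :* d)) :+ con (+ 2) :*
          (J :- S :* G)
          :+ S :* (con (+ 2) :* G :- (con (+ 2) :- k :* (b′ :* d))) :+ (:- (S :* k :* d)) :* (b′ :- (:1 :+ b))) refl
          J S (gauss x N s′) (nat b) (nat (suc b)) δ k)
      shift : E (x ^ (1 ℕ.* s)) * H ≈ E (x ^ (b ℕ.* s)) * J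
      shift = trans (*-congʳ (sym (∏-cong s′ (λ j _ → +-congˡ (-‿cong (trans (^≡ x (lhs j)) (^-+ x (suc j)
        (1 ℕ.* s))))))))
        (trans (gauss-shift x N s s′) (*-congʳ (E-reverse b (λ i → N ∸ (s ℕ.+ i)) rhs)))
        where
        lhs : ∀ j → suc (s ℕ.+ j) ≡ suc j ℕ.+ 1 ℕ.* s
        lhs j = comm-1 s j
          where
          comm-1 : ∀ s j → suc (s ℕ.+ j) ≡ suc j ℕ.+ 1 ℕ.* s
          comm-1 = ℕ-Solver.solve-∀
        rhs : ∀ i → i < s′ → N ∸ (s ℕ.+ (s′ ∸ suc i)) ≡ suc i ℕ.+ b ℕ.* s
        rhs i i<s′ = ≡.trans (≡.sym (ℕ.∸-+-assoc N s (s′ ∸ suc i)))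
          (≡.trans (cong (_∸ (s′ ∸ suc i)) (≡.trans (cong (_∸ s) (swap s′ s (b ℕ.* s))) (ℕ.m+n∸m≡n s (s′ ℕ.+ b ℕ.*
            s)))) (∸-flip b i<s′))
          where
          swap : ∀ a b c → a ℕ.+ (b ℕ.+ c) ≡ b ℕ.+ (a ℕ.+ c)
          swap = ℕ-Solver.solve-∀
      step : (nat 2 - nat s′ * δ) * H ≈ (nat 2 - nat s′ * (nat b * δ)) * J
      step = cancel D-regular (by₃ (nat 2) (- H) J shift (E-power 1) (E-power b)
        (solve 8 (λ D H J b d k E₁ E₂ → D :* ((con (+ 2) :- k :* d) :* H) := D :* ((con (+ 2) :- k :* (b :* d)) :* J)
          :+ con (+ 2) :* (E₁ :* H :- E₂ :* J) :+ (:- H) :* (con (+ 2) :* E₁ :- (con (+ 2) :- k :* (:1 :* d)) :* D)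
          :+ J :* (con (+ 2) :* E₂ :- (con (+ 2) :- k :* (b :* d)) :* D)) refl
        D H J (nat b) δ k (E (x ^ (1 ℕ.* s))) (E (x ^ (b ℕ.* s)))))

-- The terms of T₁ modulo the square of Φₙ.

module Middle (O : Ops) (Eq : Ops.A O → Ops.A O → Set) (L : Laws O Eq) (q : Ops.A O) (n′ m′ : ℕ) where
  open Ring O Eq L
  open Nilpotent O Eq L
  open Pentagonal O Eq L q using (lucas; βTerm)

  n m N : ℕ
  n = suc n′
  m = suc m′
  N = n′ ℕ.+ m′ ℕ.* n

  p ε : A
  p = q ^ 2
  ε = 1# - q ^ n

  tTerm : ℕ → A
  tTerm k = ι (sgn k) * q ^ k * gauss p (m ℕ.* n) k * gauss q (2 ℕ.* (m ℕ.* n) ∸ 2 ℕ.* k) (n ∸ k)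

  -- Both hold in ℤ[q], but 1 - xˢ is in general a zero divisor in the quotients of ℤ[q] considered below,
  -- so they cannot be derived there.
  Exact : A → Set
  Exact x = ∀ s′ b → gauss x (suc b ℕ.* suc s′) (suc s′) ≈ [ suc b ]⟨ x ^ suc s′ ⟩ * gauss x (s′ ℕ.+ b ℕ.* suc s′) s′

  ExactNext : A → Set
  ExactNext x = ∀ s′ b → gauss x (s′ ℕ.+ b ℕ.* suc s′) (suc s′) ≈ [ b ]⟨ x ^ suc s′ ⟩ * gauss x (s′ ℕ.+ b ℕ.* suc s′)
    s′

  sgn-* : ∀ i j → ι (sgn (i ℕ.+ j)) ≈ ι (sgn i) * ι (sgn j)
  sgn-* zero    j = sym (*-identityˡ _)
  sgn-* (suc i) j = trans (ι-sgn (i ℕ.+ j)) (by₂ (- 1#) (- ι (sgn j)) (sgn-* i j) (ι-sgn i)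
    (solve 4 (λ a b c c′ → :- a := c′ :* b :+ (:- :1) :* (a :- c :* b) :+ (:- b) :* (c′ :- (:- c))) refl
      (ι (sgn (i ℕ.+ j))) (ι (sgn j)) (ι (sgn i)) (ι (sgn (suc i)))))

  sgn² : ∀ i → ι (sgn i) * ι (sgn i) ≈ 1#
  sgn² zero    = *-identityˡ _
  sgn² (suc i) = trans (*-cong (ι-sgn i) (ι-sgn i)) (trans (solve 1 (λ s → (:- s) :* (:- s) := s :* s) refl
    (ι (sgn i))) (sgn² i))

  ∏-zero : ∀ c K (f : ℕ → A) t → t < K → c * f t ≈ 0# → c * ∏ K f ≈ 0#
  ∏-zero c (suc K) f zero    _         e = by₁ (∏ K (λ i → f (suc i))) e
    (solve 3 (λ c a b → c :* (a :* b) := :0 :+ b :* (c :* a :- :0)) refl c (f 0) (∏ K (λ i → f (suc i))))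
  ∏-zero c (suc K) f (suc t) (s≤s t<K) e = by₁ (f 0) (∏-zero c K (λ i → f (suc i)) t t<K e)
    (solve 3 (λ c a b → c :* (a :* b) := :0 :+ a :* (c :* b :- :0)) refl c (f 0) (∏ K (λ i → f (suc i))))

  -- A single factor c serves to replace all the factors one after another. It is used with c = ε,
  -- under which exponents of q count only modulo n.
  ∏-congᶜ : ∀ c K {f g : ℕ → A} → (∀ t → t < K → c * f t ≈ c * g t) → c * ∏ K f ≈ c * ∏ K g
  ∏-congᶜ c zero            h = refl
  ∏-congᶜ c (suc K) {f} {g} h = by₂ (∏ K (λ i → f (suc i))) (g 0) (h 0 (s≤s z≤n)) (∏-congᶜ c K (λ t t<K → h (suc t)
    (s≤s t<K)))
    (solve 5 (λ c a b a′ b′ → c :* (a :* b) := c :* (a′ :* b′) :+ b :* (c :* a :- c :* a′) :+ a′ :* (c :* b :- c :*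
      b′)) refl
      c (f 0) (∏ K (λ i → f (suc i))) (g 0) (∏ K (λ i → g (suc i))))

  module Hyp (ε²≈0 : ε * ε ≈ 0#) (reg : ∀ j → n ℕ.∤ j → Regular (1# - q ^ j)) where

    εqⁿ : ε * q ^ n ≈ ε
    εqⁿ = by₁ (- 1#) ε²≈0 (solve 1 (λ y → (:1 :- y) :* y := (:1 :- y) :+ (:- :1) :* ((:1 :- y) :* (:1 :- y) :- :0))
      refl (q ^ n))

    ε-+ : ∀ e c → ε * q ^ (e ℕ.+ c ℕ.* n) ≈ ε * q ^ e
    ε-+ e zero    = *-congˡ (^≡ q (ℕ.+-identityʳ e))
    ε-+ e (suc c) = trans (*-congˡ (trans (^≡ q (swap e n (c ℕ.* n))) (^-+ q n (e ℕ.+ c ℕ.* n))))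
      (trans (sym (*-assoc _ _ _)) (trans (*-congʳ εqⁿ) (ε-+ e c)))
      where
      swap : ∀ a b c → a ℕ.+ (b ℕ.+ c) ≡ b ℕ.+ (a ℕ.+ c)
      swap = ℕ-Solver.solve-∀

    ε-^ : ∀ e f c d → e ℕ.+ c ℕ.* n ≡ f ℕ.+ d ℕ.* n → ε * q ^ e ≈ ε * q ^ f
    ε-^ e f c d h = trans (sym (ε-+ e c)) (trans (*-congˡ (^≡ q h)) (ε-+ f d))

    q-regular : ∀ j → Regular (q ^ j)
    q-regular j = Regular-unit (^-unit j inv)
      where
      -- q times q^n′ is 1 - ε, whose inverse is 1 + ε = 2 - q^n.
      inv : (q ^ n′ * (1# + 1# - q ^ n)) * q ≈ 1#
      inv = by₁ (- 1#) ε²≈0 (solve 2 (λ q y → (y :* (:1 :+ :1 :- q :* y)) :* q := :1 :+ (:- :1) :* ((:1 :- q :* y) :*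
        (:1 :- q :* y) :- :0)) refl q (q ^ n′))

    p^ : ∀ k → p ^ k ≈ q ^ (2 ℕ.* k)
    p^ k = trans (^-^ q 2 k) (^≡ q (ℕ.*-comm k 2))

    p-regular : ∀ j → Regular (p ^ j)
    p-regular j = Regular-cong (sym (p^ j)) (q-regular (2 ℕ.* j))

    reg-p : ∀ k → n ℕ.∤ 2 ℕ.* k → Regular (1# - p ^ k)
    reg-p k h = Regular-cong (+-congˡ (-‿cong (sym (p^ k)))) (reg (2 ℕ.* k) h)

    q^[b*n] : ∀ b → q ^ (b ℕ.* n) ≈ 1# - nat b * ε
    q^[b*n] b = trans (sym (^-^ q n b)) (trans (^-cong b (solve 1 (λ y → y := :1 :- (:1 :- y)) refl (q ^ n)))
      (^-nilpotent ε²≈0 b))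

    nat-* : ∀ a b → nat (a ℕ.* b) ≈ nat a * nat b
    nat-* a b = trans (reflexive (cong ι (ℤ.pos-* a b))) (ι-* (+ a) (+ b))

    1-p^[b*n] : ∀ b → 1# - p ^ (b ℕ.* n) ≈ nat 2 * nat b * ε
    1-p^[b*n] b = trans (+-congˡ (-‿cong (trans (p^ (b ℕ.* n)) (trans (^≡ q (≡.sym (ℕ.*-assoc 2 b n)))
      (q^[b*n] (2 ℕ.* b))))))
      (by₁ ε (nat-* 2 b) (solve 3 (λ x c e → :1 :- (:1 :- x :* e) := c :* e :+ e :* (x :- c)) refl (nat (2 ℕ.* b))
        (nat 2 * nat b) ε))

    ε[1-q^]-flip : ∀ k l c → k ℕ.+ l ≡ c ℕ.* n → ε * ((1# - q ^ k) * q ^ l) ≈ - (ε * (1# - q ^ l))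
    ε[1-q^]-flip k l c h = by₂ (- 1#) ε (ε-^ (k ℕ.+ l) 0 0 c (≡.trans (ℕ.+-identityʳ _) h)) (^-+ q k l)
      (solve 4 (λ e a b z → e :* ((:1 :- a) :* b) := (:- (e :* (:1 :- b))) :+ (:- :1) :* (e :* z :- e :* :1) :+ e :*
        (z :- a :* b)) refl ε (q ^ k) (q ^ l) (q ^ (k ℕ.+ l)))

    ε[1-p^]-flip : ∀ k l c → k ℕ.+ l ≡ c ℕ.* n → ε * ((1# - p ^ k) * p ^ l) ≈ - (ε * (1# - p ^ l))
    ε[1-p^]-flip k l c h = trans (*-congˡ (*-cong (+-congˡ (-‿cong (p^ k))) (p^ l)))
      (trans (ε[1-q^]-flip (2 ℕ.* k) (2 ℕ.* l) (2 ℕ.* c) (≡.trans (≡.sym (ℕ.*-distribˡ-+ 2 k l))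
        (≡.trans (cong (2 ℕ.*_) h) (≡.sym (ℕ.*-assoc 2 c n)))))
      (-‿cong (*-congˡ (+-congˡ (-‿cong (sym (p^ l)))))))

    ε[1-p^]-+ : ∀ e c → ε * (1# - p ^ (e ℕ.+ c ℕ.* n)) ≈ ε * (1# - p ^ e)
    ε[1-p^]-+ e c = trans (*-congˡ (+-congˡ (-‿cong (trans (p^ (e ℕ.+ c ℕ.* n)) (^≡ q (dist e c n))))))
      (trans (by₁ (- 1#) (ε-+ (2 ℕ.* e) (2 ℕ.* c)) (solve 3 (λ e a b → e :* (:1 :- a) := e :* (:1 :- b) :+ (:- :1) :*
        (e :* a :- e :* b)) refl ε _ _))
      (*-congˡ (+-congˡ (-‿cong (sym (p^ e))))))
      where
      dist : ∀ e c n → 2 ℕ.* (e ℕ.+ c ℕ.* n) ≡ 2 ℕ.* e ℕ.+ 2 ℕ.* c ℕ.* n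
      dist = ℕ-Solver.solve-∀

    -- Under ε the upper index M acts like -1, and [-1, k] is (-1)^k x^(-k(k+1)/2).
    gauss-ascend : ∀ x M → ε * x ^ suc M ≈ ε → ∀ k → k ≤ M → (∀ t → t < k → Regular (1# - x ^ suc t)) →
                   ε * gauss x M k * x ^ tri (suc k) ≈ ι (sgn k) * ε
    gauss-ascend x M h zero    _   _ = solve 1 (λ e → e :* :1 :* :1 := :1 :* e) refl ε
    gauss-ascend x M h (suc k) k<M r = trans (*-congˡ (^-+ x (suc k) (tri (suc k)))) (trans
      (by₂ (x ^ tri (suc k)) (- 1#) step (gauss-ascend x M h k (ℕ.<⇒≤ k<M) (λ t t<k → r t (ℕ.m<n⇒m<1+n t<k)))
        (solve 6 (λ e g g′ u v s → e :* g′ :* (u :* v) := (:- s) :* e :+ v :* (e :* (g′ :* u) :- (:- (e :* g))) :+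
          (:- :1) :* (e :* g :* v :- s :* e)) refl
          ε (gauss x M k) (gauss x M (suc k)) (x ^ suc k) (x ^ tri (suc k)) (ι (sgn k))))
      (*-congʳ (sym (ι-sgn k))))
      where
      step : ε * (gauss x M (suc k) * x ^ suc k) ≈ - (ε * gauss x M k)
      step = cancel (r k (ℕ.n<1+n k)) (by₃ (ε * x ^ suc k) (- gauss x M k) (- (ε * gauss x M k)) (gauss-sucʳ x M k) h
          (^-*-^ x {suc k} {M ∸ k} {suc M} (cong suc (ℕ.m+[n∸m]≡n (ℕ.<⇒≤ k<M))))
        (solve 6 (λ e g g′ u v w → (:1 :- u) :* (e :* (g′ :* u)) := (:1 :- u) :* (:- (e :* g)) :+ (e :* u) :*
          ((:1 :- u) :* g′ :- (:1 :- v) :* g)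
            :+ (:- g) :* (e :* w :- e) :+ (:- (e :* g)) :* (u :* v :- w)) refl
          ε (gauss x M k) (gauss x M (suc k)) (x ^ suc k) (x ^ (M ∸ k)) (x ^ suc M)))

    small∤ : ∀ {k} → 0 < k → k < n → n ℕ.∤ k
    small∤ {suc k} _ k<n = ℕ.>⇒∤ k<n

    -- Climbing from lower index 0 would meet the zero divisor 1 - p^(n/2) when n is even. Going
    -- down from n - 1, where the value is C, each step exchanges some 1 - p^(n-l) for 1 - p^l up to
    -- sign and a power of p, and 2l < n keeps the latter regular.
    gauss-descend : ∀ C → ε * gauss p N n′ ≈ C * ε → ∀ l → 2 ℕ.* l < n →
                    ε * gauss p N (n′ ∸ l) * p ^ tri (suc l) ≈ ι (sgn l) * (C * ε)
    gauss-descend C h zero    _    = trans (*-identityʳ _) (trans h (sym (*-identityˡ _)))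
    gauss-descend C h (suc l) 2l<n = trans (*-congˡ (^-+ p (suc l) (tri (suc l))))
      (trans (by₂ (p ^ tri (suc l)) (- 1#) step (gauss-descend C h l 2l<n′)
        (solve 6 (λ e g g′ u v z → e :* g :* (u :* v) := (:- z) :+ v :* (e :* (g :* u) :- (:- (e :* g′))) :+ (:- :1)
          :* (e :* g′ :* v :- z)) refl
          ε (gauss p N (n′ ∸ suc l)) (gauss p N (n′ ∸ l)) (p ^ suc l) (p ^ tri (suc l)) (ι (sgn l) * (C * ε))))
      (trans (solve 2 (λ s c → :- (s :* c) := (:- s) :* c) refl (ι (sgn l)) (C * ε)) (*-congʳ (sym (ι-sgn l)))))
      where
      2l<n′ : 2 ℕ.* l < n
      2l<n′ = ℕ.<-trans (ℕ.*-monoʳ-< 2 (ℕ.n<1+n l)) 2l<n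
      l<n′ : l < n′
      l<n′ = ℕ.≤-pred (ℕ.≤-<-trans (ℕ.m≤m+n (suc l) _) 2l<n)
      k : ℕ
      k = n′ ∸ suc l
      suc-k : suc k ≡ n′ ∸ l
      suc-k = ≡.sym (ℕ.+-∸-assoc 1 l<n′)
      k+l : suc k ℕ.+ suc l ≡ 1 ℕ.* n
      k+l = ≡.trans (cong suc (≡.trans (ℕ.+-comm k (suc l)) (ℕ.m+[n∸m]≡n l<n′))) (≡.sym (ℕ.*-identityˡ n))
      N∸k : N ∸ k ≡ suc l ℕ.+ m′ ℕ.* n
      N∸k = ≡.trans (ℕ.+-∸-comm (m′ ℕ.* n) (ℕ.m∸n≤m n′ (suc l))) (cong (ℕ._+ m′ ℕ.* n) (ℕ.m∸[m∸n]≡n l<n′))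
      absorb : (1# - p ^ suc k) * gauss p N (n′ ∸ l) ≈ (1# - p ^ (suc l ℕ.+ m′ ℕ.* n)) * gauss p N k
      absorb = ≡.subst₂ (λ a b → (1# - p ^ suc k) * gauss p N a ≈ (1# - p ^ b) * gauss p N k) suc-k N∸k (gauss-sucʳ p
        N k)
      step : ε * (gauss p N k * p ^ suc l) ≈ - (ε * gauss p N (n′ ∸ l))
      step = cancel (reg-p (suc l) (small∤ (s≤s z≤n) 2l<n)) (by₃ (- (ε * p ^ suc l)) (gauss p N (n′ ∸ l))
        (- (p ^ suc l * gauss p N k))
          absorb (ε[1-p^]-flip (suc k) (suc l) 1 k+l) (ε[1-p^]-+ (suc l) m′)
        (solve 6 (λ e g g′ u v w → (:1 :- u) :* (e :* (g :* u)) := (:1 :- u) :* (:- (e :* g′))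
            :+ (:- (e :* u)) :* ((:1 :- v) :* g′ :- (:1 :- w) :* g)
            :+ g′ :* (e :* ((:1 :- v) :* u) :- (:- (e :* (:1 :- u)))) :+ (:- (u :* g)) :* (e :* (:1 :- w) :- e :*
              (:1 :- u))) refl
          ε (gauss p N k) (gauss p N (n′ ∸ l)) (p ^ suc l) (p ^ suc k) (p ^ (suc l ℕ.+ m′ ℕ.* n))))

    ε[1-q^]-+ : ∀ e c → ε * (1# - q ^ (e ℕ.+ c ℕ.* n)) ≈ ε * (1# - q ^ e)
    ε[1-q^]-+ e c = by₁ (- 1#) (ε-+ e c) (solve 3 (λ e a b → e :* (:1 :- a) := e :* (:1 :- b) :+ (:- :1) :*
      (e :* a :- e :* b)) refl ε _ _)

    ∏-q^ : ∀ K l → ∏ K (λ t → q ^ (l ℕ.+ t)) ≈ q ^ (K ℕ.* l ℕ.+ tri K)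
    ∏-q^ zero    l = refl
    ∏-q^ (suc K) l = trans (∏-last K _) (trans (*-congʳ (∏-q^ K l)) (^-*-^ q {K ℕ.* l ℕ.+ tri K} {l ℕ.+ K}
      (index K l (tri K))))
      where
      index : ∀ K l T → (K ℕ.* l ℕ.+ T) ℕ.+ (l ℕ.+ K) ≡ (l ℕ.+ K ℕ.* l) ℕ.+ (K ℕ.+ T)
      index = ℕ-Solver.solve-∀

    -- Both sides are the product of the 1 - q^(l+t) over 0 ≤ t ≤ l, with the first or the last
    -- factor split off; the last one is 1 - q^(2l) = 1 - p^l.
    ∏-telescope : ∀ l → (1# - q ^ l) * ∏ l (λ t → 1# - q ^ (l ℕ.+ suc t)) ≈ ∏ l (λ t → 1# - q ^ (l ℕ.+ t)) *
      (1# - p ^ l)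
    ∏-telescope l = trans (*-congʳ (+-congˡ (-‿cong (^≡ q (≡.sym (ℕ.+-identityʳ l))))))
      (trans (∏-last l (λ t → 1# - q ^ (l ℕ.+ t))) (*-congˡ (+-congˡ
        (-‿cong (trans (^≡ q (cong (l ℕ.+_) (≡.sym (ℕ.+-identityʳ l)))) (sym (p^ l)))))))

    D : ℕ → A
    D l = ∏ l (λ t → 1# - q ^ suc t)

    D-regular : ∀ l → l < n → Regular (D l)
    D-regular l l<n = Regular-∏ l (λ t t<l → reg (suc t) (small∤ (s≤s z≤n) (ℕ.≤-<-trans t<l l<n)))

    -- This is the origin of the factor ε in the middle terms: absorption yields 1 - p^(mn), which
    -- is 2m ε.
    gauss-p-absorb : ∀ i → (1# - p ^ suc i) * gauss p (m ℕ.* n) (suc i) ≈ nat 2 * nat m * ε * gauss p N i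
    gauss-p-absorb i = trans (gauss-suc-suc p N i) (*-congʳ (1-p^[b*n] m))

    ε-^-fixed : ∀ {y} c → ε * y ≈ ε → ε * y ^ c ≈ ε
    ε-^-fixed zero        h = *-identityʳ ε
    ε-^-fixed {y} (suc c) h = trans (sym (*-assoc ε y (y ^ c))) (trans (*-congʳ h) (ε-^-fixed c h))

    ε[] : ∀ {y} c → ε * y ≈ ε → ε * [ c ]⟨ y ⟩ ≈ nat c * ε
    ε[] zero        h = *-comm _ _
    ε[] {y} (suc c) h = trans (*-congˡ (∑-last c (y ^_))) (by₃ 1# 1# (- ε) (ε[] c h) (ε-^-fixed c h) (nat-suc c)
      (solve 5 (λ e s z a a′ → e :* (s :+ z) := a′ :* e :+ :1 :* (e :* s :- a :* e) :+ :1 :* (e :* z :- e) :+ (:- e)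
        :* (a′ :- (:1 :+ a))) refl
        ε [ c ]⟨ y ⟩ (y ^ c) (nat c) (nat (suc c))))

    -- The middle terms k = n - l with 0 < l < n.

    module Index (i j : ℕ) (n′≡ : n′ ≡ suc (i ℕ.+ j)) where
      k l M : ℕ
      k = suc i
      l = suc j
      M = 2 ℕ.* l ℕ.+ 2 ℕ.* m′ ℕ.* n

      V Λ : A
      V = gauss q M l
      Λ = q ^ l * gauss q k l + gauss q i j

      n≡k+l : n ≡ k ℕ.+ l
      n≡k+l = ≡.trans (cong suc n′≡) (cong suc (≡.sym (ℕ.+-suc i j)))

      k+l≡n : k ℕ.+ l ≡ 1 ℕ.* n
      k+l≡n = ≡.trans (≡.sym n≡k+l) (≡.sym (ℕ.*-identityˡ n))

      k<n : k < n
      k<n = ≡.subst (k <_) (≡.sym n≡k+l) (ℕ.m<m+n k (s≤s z≤n))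

      l<n : l < n
      l<n = ≡.subst (l <_) (≡.sym n≡k+l) (ℕ.m<n+m l (s≤s z≤n))

      tTerm≈ : tTerm k ≈ ι (sgn k) * q ^ k * gauss p (m ℕ.* n) k * V
      tTerm≈ = *-congˡ (reflexive (cong₂ (gauss q) index (≡.trans (cong (_∸ k) n≡k+l) (ℕ.m+n∸m≡n k l))))
        where
        expand : ∀ k l m c → 2 ℕ.* ((k ℕ.+ l) ℕ.+ m ℕ.* c) ≡ 2 ℕ.* k ℕ.+ (2 ℕ.* l ℕ.+ 2 ℕ.* m ℕ.* c)
        expand = ℕ-Solver.solve-∀
        index : 2 ℕ.* (m ℕ.* n) ∸ 2 ℕ.* k ≡ M
        index = ≡.trans (cong (λ z → 2 ℕ.* (z ℕ.+ m′ ℕ.* n) ∸ 2 ℕ.* k) n≡k+l)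
          (≡.trans (cong (_∸ 2 ℕ.* k) (expand k l m′ n)) (ℕ.m+n∸m≡n (2 ℕ.* k) M))

      lucas≈ : lucas (n′ ∸ 1) j ≈ Λ
      lucas≈ = +-cong (*-congˡ (reflexive (cong (λ z → gauss q z l)
        (≡.trans (cong (_∸ j) (cong suc (cong (_∸ 1) n′≡))) (ℕ.m+n∸n≡m (suc i) j)))))
        (reflexive (cong (λ z → gauss q z j) (≡.trans (cong (λ z → z ∸ 1 ∸ j) n′≡) (ℕ.m+n∸n≡m i j))))

      Λ-absorb : (1# - q ^ k) * Λ ≈ ε * gauss q k l
      Λ-absorb = by₂ (- 1#) (gauss q k l) (gauss-suc-suc q i j) (trans (^≡ q n≡k+l) (^-+ q k l))
        (solve 5 (λ a b g h z → (:1 :- a) :* (b :* g :+ h) := (:1 :- z) :* g :+ (:- :1) :* ((:1 :- b) :* g :-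
          (:1 :- a) :* h) :+ g :* (z :- a :* b)) refl
          (q ^ k) (q ^ l) (gauss q k l) (gauss q i j) (q ^ n))

      vanish : k < l → q * tTerm k ≈ 0#
      vanish k<l = trans (*-congˡ tTerm≈) (by₁ (q * ι (sgn k) * q ^ k) aV≈0
          (solve 5 (λ q s z a v → q :* (s :* z :* a :* v) := :0 :+ (q :* s :* z) :* (a :* v :- :0)) refl q
            (ι (sgn k)) (q ^ k) (gauss p (m ℕ.* n) k) V))
        where
        t : ℕ
        t = l ∸ k
        -- The numerator of `V` with index t = l - k is 1 - q^((2m-1)n), which supplies the second
        -- factor ε.
        M∸t : M ∸ t ≡ suc (2 ℕ.* m′) ℕ.* n
        M∸t = ≡.trans (cong (λ z → 2 ℕ.* z ℕ.+ 2 ℕ.* m′ ℕ.* n ∸ t) l≡)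
          (≡.trans (cong (_∸ t) (≡.trans (expand t k (2 ℕ.* m′ ℕ.* n)) (cong (λ z → t ℕ.+ (z ℕ.+ 2 ℕ.* m′ ℕ.* n))
            (≡.trans (cong (k ℕ.+_) (≡.sym l≡)) (≡.sym n≡k+l)))))
            (ℕ.m+n∸m≡n t _))
          where
          l≡ : l ≡ k ℕ.+ t
          l≡ = ≡.sym (ℕ.m+[n∸m]≡n (ℕ.<⇒≤ k<l))
          expand : ∀ t k c → 2 ℕ.* (k ℕ.+ t) ℕ.+ c ≡ t ℕ.+ ((k ℕ.+ (k ℕ.+ t)) ℕ.+ c)
          expand = ℕ-Solver.solve-∀
        factor : ε * (1# - q ^ (M ∸ t)) ≈ 0#
        factor = trans (*-congˡ (+-congˡ (-‿cong (^≡ q M∸t)))) (trans (ε[1-q^]-+ 0 (suc (2 ℕ.* m′)))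
          (solve 1 (λ e → e :* (:1 :- :1) := :0) refl ε))
        εV≈0 : ε * V ≈ 0#
        εV≈0 = D-regular l l<n _ (by₂ ε 1# (gauss-∏ q M l) (∏-zero ε l (λ t → 1# - q ^ (M ∸ t)) t (s≤s (ℕ.m∸n≤m j i))
          factor)
          (solve 4 (λ d e v z → d :* (e :* v) := :0 :+ e :* (d :* v :- z) :+ :1 :* (e :* z :- :0)) refl (D l) ε V
            (∏ l (λ t → 1# - q ^ (M ∸ t)))))
        2k<n : 2 ℕ.* k < n
        2k<n = ≡.subst₂ _<_ (cong (k ℕ.+_) (≡.sym (ℕ.+-identityʳ k))) (≡.sym n≡k+l) (ℕ.+-monoʳ-< k k<l)
        aV≈0 : gauss p (m ℕ.* n) k * V ≈ 0#
        aV≈0 = reg-p k (small∤ (s≤s z≤n) 2k<n) _ (by₂ V (nat 2 * nat m * gauss p N i) (gauss-p-absorb i) εV≈0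
          (solve 6 (λ r a v c e g → r :* (a :* v) := :0 :+ v :* (r :* a :- c :* e :* g) :+ (c :* g) :*
            (e :* v :- :0)) refl
            (1# - p ^ k) (gauss p (m ℕ.* n) k) V (nat 2 * nat m) ε (gauss p N i)))

      Λ-vanish : k < l → Λ ≈ 0#
      Λ-vanish (s≤s i<j) = trans (+-cong (*-congˡ (gauss-zero q (s≤s i<j))) (gauss-zero q i<j))
        (solve 1 (λ x → x :* :0 :+ :0 := :0) refl (q ^ l))

      -- Under ε the upper index M may be replaced by 2l, because M - 2l is a multiple of n. What
      -- remains is the numerator of [2l, l], read upwards.
      V-product : ε * (D l * V) ≈ ε * ∏ l (λ t → 1# - q ^ (l ℕ.+ suc t))
      V-product = trans (*-congˡ (trans (gauss-∏ q M l) (∏-reverse l (λ t → 1# - q ^ (M ∸ t)))))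
        (∏-congᶜ ε l (λ t t<l → trans (*-congˡ (+-congˡ (-‿cong (^≡ q (index t t<l))))) (ε[1-q^]-+ (l ℕ.+ suc t)
          (2 ℕ.* m′))))
        where
        index : ∀ t → t < l → M ∸ (l ∸ suc t) ≡ (l ℕ.+ suc t) ℕ.+ 2 ℕ.* m′ ℕ.* n
        index t t<l = ≡.trans (cong (_∸ (l ∸ suc t)) (rearrange l (2 ℕ.* m′ ℕ.* n)))
          (≡.trans (ℕ.+-∸-comm (l ℕ.+ 2 ℕ.* m′ ℕ.* n) (ℕ.m∸n≤m l (suc t)))
          (≡.trans (cong (ℕ._+ (l ℕ.+ 2 ℕ.* m′ ℕ.* n)) (ℕ.m∸[m∸n]≡n t<l)) (rearrange′ l (suc t) (2 ℕ.* m′ ℕ.* n))))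
          where
          rearrange : ∀ l c → 2 ℕ.* l ℕ.+ c ≡ l ℕ.+ (l ℕ.+ c)
          rearrange = ℕ-Solver.solve-∀
          rearrange′ : ∀ l t c → t ℕ.+ (l ℕ.+ c) ≡ (l ℕ.+ t) ℕ.+ c
          rearrange′ = ℕ-Solver.solve-∀

      [-1]^ : ∀ K → (- 1#) ^ K ≈ ι (sgn K)
      [-1]^ zero    = refl
      [-1]^ (suc K) = trans (*-congˡ ([-1]^ K)) (trans (solve 1 (λ x → (:- :1) :* x := :- x) refl (ι (sgn K)))
        (sym (ι-sgn K)))

      -- The numerators of [k, l] are 1 - q^(k-t), and (k - t) + (l + t) = n; so under ε each of
      -- them becomes -(1 - q^(l+t)) once q^(l+t) is multiplied on.
      flip-product : l ≤ k → ε * ((D l * gauss q k l) * ∏ l (λ t → q ^ (l ℕ.+ t))) ≈ ι (sgn l) *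
        (ε * ∏ l (λ t → 1# - q ^ (l ℕ.+ t)))
      flip-product l≤k = trans (*-congˡ (trans (*-congʳ (gauss-∏ q k l)) (sym (∏-* l (λ t → 1# - q ^ (k ∸ t))
        (λ t → q ^ (l ℕ.+ t))))))
        (trans (∏-congᶜ ε l (λ t t<l → trans (ε[1-q^]-flip (k ∸ t) (l ℕ.+ t) 1 (index t t<l))
            (solve 2 (λ e y → :- (e :* y) := e :* ((:- :1) :* y)) refl ε (1# - q ^ (l ℕ.+ t)))))
        (trans (*-congˡ (trans (∏-* l (λ _ → - 1#) (λ t → 1# - q ^ (l ℕ.+ t))) (*-congʳ (trans (∏-const l (- 1#))
          ([-1]^ l)))))
          (solve 3 (λ e s y → e :* (s :* y) := s :* (e :* y)) refl ε (ι (sgn l)) _)))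
        where
        index : ∀ t → t < l → (k ∸ t) ℕ.+ (l ℕ.+ t) ≡ 1 ℕ.* n
        index t t<l = ≡.trans (assoc (k ∸ t) l t) (≡.trans (cong (ℕ._+ l) (ℕ.m∸n+n≡m (ℕ.≤-trans (ℕ.<⇒≤ t<l) l≤k)))
          k+l≡n)
          where
          assoc : ∀ a l t → a ℕ.+ (l ℕ.+ t) ≡ (a ℕ.+ t) ℕ.+ l
          assoc = ℕ-Solver.solve-∀

      -- The powers of q collected from flipping numerators, against those from `gauss-descend`;
      -- their quotient, with the extra q, is the power in `βTerm`.
      exponents : q * ∏ l (λ t → q ^ (l ℕ.+ t)) ≈ q ^ tri j * p ^ tri (suc l)
      exponents = trans (*-congˡ (∏-q^ l l)) (trans (^≡ q index) (trans (^-+ q (tri j) (2 ℕ.* tri (suc l)))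
        (*-congˡ (sym (p^ (tri (suc l)))))))
        where
        index : suc (l ℕ.* l ℕ.+ tri l) ≡ tri j ℕ.+ 2 ℕ.* tri (suc l)
        index = ≡.trans (lhs j (tri j)) (≡.trans (cong (λ z → z ℕ.+ (3 ℕ.* j ℕ.+ 2 ℕ.+ tri j)) (≡.sym (2*tri j)))
          (rhs j (tri j)))
          where
          lhs : ∀ j T → suc (suc j ℕ.* suc j ℕ.+ (j ℕ.+ T)) ≡ j ℕ.* j ℕ.+ (3 ℕ.* j ℕ.+ 2 ℕ.+ T)
          lhs = ℕ-Solver.solve-∀
          rhs : ∀ j T → (2 ℕ.* T ℕ.+ j) ℕ.+ (3 ℕ.* j ℕ.+ 2 ℕ.+ T) ≡ T ℕ.+ 2 ℕ.* (suc j ℕ.+ (j ℕ.+ T))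
          rhs = ℕ-Solver.solve-∀

      sgn-k*l : ι (sgn k) * ι (sgn l) ≈ ι (sgn n)
      sgn-k*l = trans (sym (sgn-* k l)) (reflexive (cong (λ z → ι (sgn z)) (≡.sym n≡k+l)))

      εqᵏqˡ : ε * (q ^ k * q ^ l) ≈ ε
      εqᵏqˡ = trans (*-congˡ (^-*-^ q {k} {l} (≡.sym n≡k+l))) εqⁿ

      -- 1 - p^k is regular here, since 2k = n + (k - l) is not a multiple of n. Both sides are
      -- multiplied by `Z`, the product of all would-be denominators: 1 - p^k and a power of p for
      -- [mn, k] in base p, `D l` for `V` and for [k, l], 1 - q^k for `Λ`, and the powers of q
      -- released when an exponent n - j is replaced by j. Both then become ε times `P₀ * w` up to
      -- coefficients, and `coefficient` compares these.
      generic : ∀ C → ε * gauss p N n′ ≈ C * ε → l < k →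
                q * tTerm k ≈ ι (sgn n) * (C * (nat 2 * nat m)) * (ι (sgn l) * (q ^ tri j * Λ))
      generic C hC l<k = trans (*-congˡ tTerm≈) (cancel Z-regular (trans X-side (trans compare (sym Y-side))))
        where
        a X Y r₁ r₂ P₀ P₁ P₃ Q w tm κ K ql qk sk sl : A
        a = gauss p (m ℕ.* n) k
        X = q * (ι (sgn k) * q ^ k * a * V)
        tm = nat 2 * nat m
        K = ι (sgn n) * (C * tm)
        Y = K * (ι (sgn l) * (q ^ tri j * Λ))
        r₁ = 1# - p ^ k
        r₂ = 1# - q ^ k
        P₀ = ∏ l (λ t → 1# - q ^ (l ℕ.+ t))
        P₁ = ∏ l (λ t → 1# - q ^ (l ℕ.+ suc t))
        P₃ = p ^ tri (suc l)
        Q  = ∏ l (λ t → q ^ (l ℕ.+ t))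
        w  = 1# - p ^ l
        ql = q ^ l
        qk = q ^ k
        sk = ι (sgn k)
        sl = ι (sgn l)
        κ  = q * sk * qk * tm * sl * C

        2l<n : 2 ℕ.* l < n
        2l<n = ≡.subst₂ _<_ (cong (l ℕ.+_) (≡.sym (ℕ.+-identityʳ l))) (≡.sym n≡k+l) (ℕ.+-monoˡ-< l l<k)

        n∤2k : n ℕ.∤ 2 ℕ.* k
        n∤2k h = small∤ (ℕ.m<n⇒0<n∸m l<k) (ℕ.≤-<-trans (ℕ.m∸n≤m k l) k<n) (ℕ.∣m+n∣m⇒∣n (≡.subst (n ℕ.∣_) 2k≡ h)
          ℕ.∣-refl)
          where
          2k≡ : 2 ℕ.* k ≡ n ℕ.+ (k ∸ l)
          2k≡ = ≡.trans (cong (k ℕ.+_) (≡.trans (ℕ.+-identityʳ k) (≡.sym (ℕ.m+[n∸m]≡n (ℕ.<⇒≤ l<k)))))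
                  (≡.trans (≡.sym (ℕ.+-assoc k l (k ∸ l))) (cong (ℕ._+ (k ∸ l)) (≡.sym n≡k+l)))

        aP₃ : r₁ * (a * P₃) ≈ tm * (sl * (C * ε))
        aP₃ = by₂ P₃ tm (gauss-p-absorb i) (≡.subst (λ z → ε * gauss p N z * P₃ ≈ sl * (C * ε))
          (≡.trans (cong (_∸ l) n′≡) (ℕ.m+n∸n≡m i j)) (gauss-descend C hC l 2l<n))
          (solve 7 (λ r a P t e g z → r :* (a :* P) := t :* z :+ P :* (r :* a :- t :* e :* g) :+ t :* (e :* g :* P :-
            z)) refl
            r₁ a P₃ tm ε (gauss p N i) (sl * (C * ε)))

        X₁ : r₁ * (P₃ * X) ≈ ε * (κ * V)
        X₁ = by₁ (q * (sk * qk) * V) aP₃ (solve 11 (λ r a P t e s C q z qk v → r :* (P :* (q :* (z :* qk :* a :* v)))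
          :=
              e :* (q :* z :* qk :* t :* s :* C :* v) :+ (q :* (z :* qk) :* v) :* (r :* (a :* P) :- t :*
                (s :* (C :* e)))) refl
            r₁ a P₃ tm ε sl C q sk qk V)

        X₂ : D l * (r₁ * (P₃ * X)) ≈ ε * (κ * P₁)
        X₂ = by₂ (D l) κ X₁ V-product (solve 6 (λ d x e c v P → d :* x := e :* (c :* P) :+ d :* (x :- e :* (c :* v))
          :+ c :* (e :* (d :* v) :- e :* P)) refl
            (D l) (r₁ * (P₃ * X)) ε κ V P₁)

        X₃ : (r₂ * ql) * (D l * (r₁ * (P₃ * X))) ≈ - (ε * (κ * (P₀ * w)))
        X₃ = by₃ (r₂ * ql) (κ * P₁) (- (ε * κ)) X₂ (ε[1-q^]-flip k l 1 k+l≡n) (∏-telescope l)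
          (solve 8 (λ r b x e c P₁ P₀ w → (r :* b) :* x := (:- (e :* (c :* (P₀ :* w)))) :+ (r :* b) :*
            (x :- e :* (c :* P₁))
              :+ (c :* P₁) :* (e :* (r :* b) :- (:- (e :* (:1 :- b)))) :+ (:- (e :* c)) :* ((:1 :- b) :* P₁ :- P₀ :*
                w)) refl
            r₂ ql (D l * (r₁ * (P₃ * X))) ε κ P₁ P₀ w)

        Y₁ : D l * (Q * (r₂ * Λ)) ≈ sl * (ε * P₀)
        Y₁ = by₂ (D l * Q) 1# Λ-absorb (flip-product (ℕ.<⇒≤ l<k))
          (solve 6 (λ d Q x e g z → d :* (Q :* x) := z :+ (d :* Q) :* (x :- e :* g) :+ :1 :* (e :* (d :* g :* Q) :-
            z)) refl
            (D l) Q (r₂ * Λ) ε (gauss q k l) (sl * (ε * P₀)))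

        Y₂ : r₂ * (D l * (Q * Y)) ≈ K * q ^ tri j * (ε * P₀)
        Y₂ = by₂ (K * sl * q ^ tri j) (K * q ^ tri j * (ε * P₀)) Y₁ (sgn² l)
          (solve 8 (λ r d Q K s u v z → r :* (d :* (Q :* (K :* (s :* (u :* v))))) := K :* u :* z :+ (K :* s :* u) :*
            (d :* (Q :* (r :* v)) :- s :* z)
              :+ (K :* u :* z) :* (s :* s :- :1)) refl r₂ (D l) Q K sl (q ^ tri j) Λ (ε * P₀))

        Y₃ : (r₁ * p ^ l) * (r₂ * (D l * (Q * Y))) ≈ - (K * q ^ tri j * (ε * (P₀ * w)))
        Y₃ = by₂ (r₁ * p ^ l) (K * q ^ tri j * P₀) Y₂ (ε[1-p^]-flip k l 1 k+l≡n)
          (solve 6 (λ r b x K e P → (r :* b) :* x := (:- (K :* (e :* (P :* (:1 :- b))))) :+ (r :* b) :*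
            (x :- K :* (e :* P))
              :+ (K :* P) :* (e :* (r :* b) :- (:- (e :* (:1 :- b))))) refl
            r₁ (p ^ l) (r₂ * (D l * (Q * Y))) (K * q ^ tri j) ε P₀)

        Z : A
        Z = (r₁ * r₂) * (D l * (P₃ * (Q * (ql * ql))))

        Z-regular : Regular Z
        Z-regular = Regular-* (Regular-* (reg-p k n∤2k) (reg k (small∤ (s≤s z≤n) k<n)))
          (Regular-* (D-regular l l<n) (Regular-* (p-regular (tri (suc l)))
            (Regular-* (Regular-cong (sym (∏-q^ l l)) (q-regular (l ℕ.* l ℕ.+ tri l))) (Regular-* (q-regular l)
              (q-regular l)))))

        X-side : Z * X ≈ - (ε * (κ * (P₀ * w))) * (Q * ql)
        X-side = by₁ (Q * ql) X₃ (solve 8 (λ r s d P Q b x z → (r :* s) :* (d :* (P :* (Q :* (b :* b)))) :* x :=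
              z :* (Q :* b) :+ (Q :* b) :* ((s :* b) :* (d :* (r :* (P :* x))) :- z)) refl
            r₁ r₂ (D l) P₃ Q ql X (- (ε * (κ * (P₀ * w)))))

        pˡ : p ^ l ≈ ql * ql
        pˡ = trans (p^ l) (trans (^≡ q (cong (l ℕ.+_) (ℕ.+-identityʳ l))) (^-+ q l l))

        Y-side : Z * Y ≈ - (K * q ^ tri j * (ε * (P₀ * w))) * P₃
        Y-side = by₂ P₃ (- (r₁ * r₂ * (D l * (P₃ * Q)) * Y)) Y₃ pˡ (solve 9 (λ r s d P Q b c x z → (r :* s) :*
          (d :* (P :* (Q :* (b :* b)))) :* x :=
              z :* P :+ P :* ((r :* c) :* (s :* (d :* (Q :* x))) :- z) :+ (:- (r :* s :* (d :* (P :* Q)) :* x)) :*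
                (c :- b :* b)) refl
            r₁ r₂ (D l) P₃ Q ql (p ^ l) Y (- (K * q ^ tri j * (ε * (P₀ * w)))))

        coefficient : ε * κ * (Q * ql) ≈ ε * (K * (q ^ tri j * P₃))
        coefficient = by₃ (sk * sl * tm * C * q * Q) (ε * tm * C * q * Q) (ε * ι (sgn n) * tm * C) εqᵏqˡ sgn-k*l
          exponents
          (solve 11 (λ e q sk qk t sl C Q ql sn z → e :* (q :* sk :* qk :* t :* sl :* C) :* (Q :* ql) := e :*
            (sn :* (C :* t) :* z)
              :+ (sk :* sl :* t :* C :* q :* Q) :* (e :* (qk :* ql) :- e) :+ (e :* t :* C :* q :* Q) :* (sk :* sl :-
                sn)
              :+ (e :* sn :* t :* C) :* (q :* Q :- z)) refl
            ε q sk qk tm sl C Q ql (ι (sgn n)) (q ^ tri j * P₃))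

        compare : - (ε * (κ * (P₀ * w))) * (Q * ql) ≈ - (K * q ^ tri j * (ε * (P₀ * w))) * P₃
        compare = by₁ (- (P₀ * w)) coefficient
          (solve 7 (λ e c z y K u P → (:- (e :* (c :* z))) :* y := (:- (K :* u :* (e :* z))) :* P :+ (:- z) :*
            (e :* c :* y :- e :* (K :* (u :* P)))) refl
            ε κ (P₀ * w) (Q * ql) K (q ^ tri j) P₃)

      -- For k = l = n/2 the element 1 - p^k is ε itself and cannot be cancelled, so the roles are
      -- exchanged. `Exact` writes [mn, k] in base p as [2m] times another coefficient, and [2m]
      -- counts as 2m under ε; the factor ε comes instead from `V`, whose absorption yields 1 -
      -- q^((2m-1)n), that is (2m - 1) ε. Hence C has to be 2m - 1.
      diagonal : ∀ C → Exact p → C ≈ nat 2 * nat m - 1# → i ≡ j →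
                 q * tTerm k ≈ ι (sgn n) * (C * (nat 2 * nat m)) * (ι (sgn l) * (q ^ tri j * Λ))
      diagonal C exact hC ≡.refl = trans (*-congˡ tTerm≈) (cancel Z-regular (trans X-side (trans compare
        (sym Y-side))))
        where
        b M′ : ℕ
        b  = m′ ℕ.+ (m ℕ.+ 0)
        M′ = n′ ℕ.+ 2 ℕ.* m′ ℕ.* n
        a X Y r P R g g′ tm K sk : A
        a = gauss p (m ℕ.* n) k
        X = q * (ι (sgn k) * q ^ k * a * V)
        tm = nat 2 * nat m
        K = ι (sgn n) * (C * tm)
        Y = K * (ι (sgn k) * (q ^ tri i * Λ))
        r = 1# - q ^ k
        P = p ^ tri k
        R = q ^ tri k
        g = gauss p (i ℕ.+ b ℕ.* k) i
        g′ = gauss q M′ i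
        sk = ι (sgn k)

        double : ∀ k → k ℕ.+ k ≡ 2 ℕ.* k
        double = ℕ-Solver.solve-∀

        n≡2k : n ≡ 2 ℕ.* k
        n≡2k = ≡.trans n≡k+l (double k)

        εpᵏ : ε * p ^ k ≈ ε
        εpᵏ = trans (*-congˡ (trans (p^ k) (^≡ q (≡.sym n≡2k)))) εqⁿ

        m*n≡ : suc b ℕ.* k ≡ m ℕ.* n
        m*n≡ = ≡.trans (assoc m k) (cong (m ℕ.*_) (≡.sym n≡2k))
          where
          assoc : ∀ m k → 2 ℕ.* m ℕ.* k ≡ m ℕ.* (2 ℕ.* k)
          assoc = ℕ-Solver.solve-∀

        εa : ε * a ≈ tm * (ε * g)
        εa = by₃ ε g (ε * g) (≡.subst (λ z → gauss p z k ≈ [ suc b ]⟨ p ^ k ⟩ * g) m*n≡ (exact i b)) (ε[] (suc b)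
          εpᵏ) (nat-* 2 m)
          (solve 6 (λ e a S g t t′ → e :* a := t :* (e :* g) :+ e :* (a :- S :* g) :+ g :* (e :* S :- t′ :* e) :+
            (e :* g) :* (t′ :- t)) refl
            ε a [ suc b ]⟨ p ^ k ⟩ g tm (nat (2 ℕ.* m)))

        εgP : ε * g * P ≈ ι (sgn i) * ε
        εgP = gauss-ascend p (i ℕ.+ b ℕ.* k) (trans (*-congˡ (sym (^-^ p k (suc b)))) (ε-^-fixed (suc b) εpᵏ)) i
          (ℕ.m≤m+n i _)
          (λ t t<i → reg-p (suc t) (small∤ (s≤s z≤n) (≡.subst (2 ℕ.* suc t <_) (≡.sym n≡2k) (ℕ.*-monoʳ-< 2
            (s≤s t<i)))))

        M≡ : M ≡ suc M′
        M≡ = cong (ℕ._+ 2 ℕ.* m′ ℕ.* n) (≡.sym n≡2k)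

        εg′R : ε * g′ * R ≈ ι (sgn i) * ε
        εg′R = gauss-ascend q M′ (trans (ε-+ n (2 ℕ.* m′)) εqⁿ) i (ℕ.≤-trans (ℕ.≤-trans (ℕ.m≤m+n i (suc i))
          (ℕ.≤-reflexive (≡.trans (ℕ.+-suc i i) (≡.sym n′≡)))) (ℕ.m≤m+n n′ _))
          (λ t t<i → reg (suc t) (small∤ (s≤s z≤n) (ℕ.<-trans (s≤s t<i) k<n)))

        rV : r * V ≈ C * (ε * g′)
        rV = trans (*-congˡ (reflexive (cong (λ z → gauss q z k) M≡))) (trans (gauss-suc-suc q M′ i)
          (trans (*-congʳ (+-congˡ (-‿cong (q^[b*n] (suc (2 ℕ.* m′))))))
          (trans (*-congʳ (+-congˡ (-‿cong (+-congˡ (-‿cong (*-congʳ (trans (nat-suc (2 ℕ.* m′))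
            (+-congˡ (nat-* 2 m′)))))))))
          (by₂ (- (ε * g′)) (- (nat 2 * ε * g′)) hC (nat-suc m′)
            (solve 5 (λ e g c m′ m → (:1 :- (:1 :- (:1 :+ con (+ 2) :* m′) :* e)) :* g := c :* (e :* g)
              :+ (:- (e :* g)) :* (c :- (con (+ 2) :* m :- :1)) :+ (:- (con (+ 2) :* e :* g)) :* (m :- (:1 :+ m′)))
                refl
             ε g′ C (nat m′) (nat m))))))

        Z : A
        Z = r * (P * R)
        Z-regular : Regular Z
        Z-regular = Regular-* (reg k (small∤ (s≤s z≤n) k<n)) (Regular-* (p-regular (tri k)) (q-regular (tri k)))

        εaP : ε * (a * P) ≈ tm * (ι (sgn i) * ε)
        εaP = by₂ P tm εa εgP (solve 6 (λ e a P t g z → e :* (a :* P) := t :* z :+ P :* (e :* a :- t :* (e :* g)) :+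
          t :* (e :* g :* P :- z)) refl
          ε a P tm g (ι (sgn i) * ε))

        εaPg′R : ε * (a * P * (g′ * R)) ≈ tm * ε
        εaPg′R = by₃ (g′ * R) (tm * ι (sgn i)) (tm * ε) εaP εg′R (sgn² i)
          (solve 6 (λ e x g R t s → e :* (x :* (g :* R)) := t :* e :+ (g :* R) :* (e :* x :- t :* (s :* e)) :+
            (t :* s) :* (e :* g :* R :- s :* e)
              :+ (t :* e) :* (s :* s :- :1)) refl ε (a * P) g′ R tm (ι (sgn i)))

        X-side : Z * X ≈ sk * (C * tm) * (ε * (q * q ^ k))
        X-side = by₂ (q * sk * q ^ k * (a * P) * R) (q * sk * q ^ k * C) rV εaPg′R
          (solve 12 (λ r P R q s z a V C e g t → r :* (P :* R) :* (q :* (s :* z :* a :* V)) := s :* (C :* t) :*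
            (e :* (q :* z))
              :+ (q :* s :* z :* (a :* P) :* R) :* (r :* V :- C :* (e :* g)) :+ (q :* s :* z :* C) :*
                (e :* (a :* P :* (g :* R)) :- t :* e)) refl
            r P R q sk (q ^ k) a V C ε g′ tm)

        rΛ : r * Λ ≈ ε
        rΛ = trans Λ-absorb (trans (*-congˡ (gauss-diag q k)) (*-identityʳ ε))

        sgn-n : ι (sgn n) ≈ 1#
        sgn-n = trans (sym sgn-k*l) (sgn² k)

        Y-side : Z * Y ≈ sk * (C * tm) * (ε * (q ^ tri i * (P * R)))
        Y-side = by₂ (P * R * (ι (sgn n) * (C * tm) * (sk * q ^ tri i))) (ε * q ^ tri i * (P * R) * (C * tm) * sk) rΛ
          sgn-n
          (solve 8 (λ r x n c s u Λ e → r :* x :* (n :* c :* (s :* (u :* Λ))) := s :* c :* (e :* (u :* x))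
              :+ (x :* (n :* c :* (s :* u))) :* (r :* Λ :- e) :+ (e :* u :* x :* c :* s) :* (n :- :1)) refl
            r (P * R) (ι (sgn n)) (C * tm) sk (q ^ tri i) Λ ε)

        compare : sk * (C * tm) * (ε * (q * q ^ k)) ≈ sk * (C * tm) * (ε * (q ^ tri i * (P * R)))
        -- The two exponents of q agree only modulo n: with n = 2k and k = i + 1, k + 1 + i n equals
        -- tri i + 3 tri k + n.
        compare = *-congˡ (trans (ε-^ (suc k) (tri i ℕ.+ (2 ℕ.* tri k ℕ.+ tri k)) i 1 index)
          (*-congˡ (trans (^-+ q (tri i) _) (*-congˡ (trans (^-+ q (2 ℕ.* tri k) (tri k))
            (*-congʳ (sym (p^ (tri k)))))))))
          where
          index : suc k ℕ.+ i ℕ.* n ≡ (tri i ℕ.+ (2 ℕ.* tri k ℕ.+ tri k)) ℕ.+ 1 ℕ.* n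
          index = ≡.trans (cong (λ z → suc k ℕ.+ i ℕ.* z) n≡2k) (≡.trans (lhs i)
            (≡.trans (cong (λ z → 2 ℕ.* z ℕ.+ (3 ℕ.* i ℕ.+ 2)) (≡.sym (2*tri i)))
            (≡.trans (rhs i (tri i)) (cong (λ z → (tri i ℕ.+ (2 ℕ.* tri k ℕ.+ tri k)) ℕ.+ 1 ℕ.* z) (≡.sym n≡2k)))))
            where
            lhs : ∀ i → suc (suc i) ℕ.+ i ℕ.* (2 ℕ.* suc i) ≡ 2 ℕ.* (i ℕ.* i) ℕ.+ (3 ℕ.* i ℕ.+ 2)
            lhs = ℕ-Solver.solve-∀
            rhs : ∀ i T → 2 ℕ.* (2 ℕ.* T ℕ.+ i) ℕ.+ (3 ℕ.* i ℕ.+ 2) ≡ (T ℕ.+ (2 ℕ.* (i ℕ.+ T) ℕ.+ (i ℕ.+ T))) ℕ.+ 1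
              ℕ.* (2 ℕ.* suc i)
            rhs = ℕ-Solver.solve-∀

      middle : ∀ C → ε * gauss p N n′ ≈ C * ε → Exact p → (i ≡ j → C ≈ nat 2 * nat m - 1#) →
               q * tTerm k ≈ ι (sgn n) * (C * (nat 2 * nat m)) * βTerm (n′ ∸ 1) j
      middle C hC exact hC′ = trans cases (*-congˡ (*-congˡ (*-congˡ (sym lucas≈))))
        where
        cases : q * tTerm k ≈ ι (sgn n) * (C * (nat 2 * nat m)) * (ι (sgn l) * (q ^ tri j * Λ))
        cases with ℕ.<-cmp i j
        ... | tri< i<j _ _ = trans (vanish (s≤s i<j)) (sym (trans (*-congˡ (*-congˡ (*-congˡ (Λ-vanish (s≤s i<j)))))
                (solve 3 (λ x y z → x :* (y :* (z :* :0)) := :0) refl _ _ _)))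
        ... | tri≈ _ i≡j _ = diagonal C exact (hC′ i≡j) i≡j
        ... | tri> _ _ j<i = generic C hC (s≤s j<i)

    -- The end terms k = 0 and k = n, and the whole sum.

    module Total (two : Regular (nat 2)) (exact-q : Exact q) (exact-p : Exact p) (next-p : ExactNext p) where

      first : tTerm 0 ≈ nat 2 * nat m - nat n * nat m * (nat 2 * nat m - 1#) * ε
      first = cancel two (trans (*-congˡ (trans (solve 1 (λ g → :1 :* :1 :* :1 :* g := g) refl _)
        (reflexive (cong (λ z → gauss q z n) (≡.sym (ℕ.*-assoc 2 m n))))))
        (trans (gauss-full b (exact-q n′ b)) (trans (+-cong (*-congˡ (nat-* 2 m))
          (-‿cong (*-congʳ (*-cong (nat-* 2 m) (+-congʳ (nat-* 2 m))))))
          (solve 3 (λ m n e → con (+ 2) :* (con (+ 2) :* m) :- (con (+ 2) :* m) :* (con (+ 2) :* m :- :1) :* (n :* e)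
            :=
             con (+ 2) :* (con (+ 2) :* m :- n :* m :* (con (+ 2) :* m :- :1) :* e)) refl (nat m) (nat n) ε))))
        where
        open Periodic two q n′ (λ i i<n′ → reg (suc i) (small∤ (s≤s z≤n) (s≤s i<n′))) ε²≈0
        b : ℕ
        b = m′ ℕ.+ (m ℕ.+ 0)

      -- The coefficient in base q is [·, 0] = 1, so only the sign, q^n and [mn, n] remain; as ε q^n
      -- = ε, the power q^n survives only next to m.
      last : ∀ C → gauss p (m ℕ.* n) n ≈ C * (nat m - nat n * nat m * (nat m - 1#) * ε) →
             tTerm n ≈ ι (sgn n) * C * (nat m * q ^ n - nat n * nat m * (nat m - 1#) * ε)
      last C h = trans (*-congˡ (reflexive (cong (gauss q (2 ℕ.* (m ℕ.* n) ∸ 2 ℕ.* n)) (ℕ.n∸n≡0 n))))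
        (by₂ (ι (sgn n) * q ^ n) (- (ι (sgn n) * C * z)) h εqⁿ
          (solve 7 (λ s y g C m z e → s :* y :* g :* :1 := s :* C :* (m :* y :- z :* e) :+ (s :* y) :*
            (g :- C :* (m :- z :* e)) :+ (:- (s :* C :* z)) :* (e :* y :- e)) refl
            (ι (sgn n)) (q ^ n) (gauss p (m ℕ.* n) n) C (nat m) z ε))
        where
        z : A
        z = nat n * nat m * (nat m - 1#)

      p^n : p ^ n ≈ 1# - nat 2 * ε
      p^n = trans (p^ n) (q^[b*n] 2)

      p-nilpotent : (1# - p ^ n) * (1# - p ^ n) ≈ 0#
      p-nilpotent = trans (*-cong (+-congˡ (-‿cong p^n)) (+-congˡ (-‿cong p^n))) (by₁ (nat 2 * nat 2) ε²≈0
        (solve 1 (λ e → (:1 :- (:1 :- con (+ 2) :* e)) :* (:1 :- (:1 :- con (+ 2) :* e)) := :0 :+ (con (+ 2) :* con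
          (+ 2)) :* (e :* e :- :0)) refl ε))

      -- What `total` has to know about the base p. One constant C serves both, since [mn, n] is [m]
      -- at p^n times [mn - 1, n - 1], and [m] carries no parity.
      Leading Top : A → Set
      Leading C = ε * gauss p N n′ ≈ C * ε
      Top C = gauss p (m ℕ.* n) n ≈ C * (nat m - nat n * nat m * (nat m - 1#) * ε)

      -- Under this hypothesis p has period n just as q has, except that 1 - p^n is 2ε; this 2
      -- absorbs the doubling in `gauss-full`.
      odd : (∀ k → 0 < k → k < n → n ℕ.∤ 2 ℕ.* k) → Leading 1# × Top 1#
      odd h = leading , top
        where
        open Periodic two p n′ (λ i i<n′ → reg-p (suc i) (h (suc i) (s≤s z≤n) (s≤s i<n′))) p-nilpotent
        leading : Leading 1#
        leading = cancel two (by₃ ε (ε * nat n′ * nat m′) (- (nat 2 * nat n′ * nat m′)) (gauss-pred m′) p^n ε²≈0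
          (solve 5 (λ e g n m y → con (+ 2) :* (e :* g) := con (+ 2) :* (:1 :* e) :+ e :* (con (+ 2) :* g :-
            (con (+ 2) :- n :* (m :* (:1 :- y))))
             :+ (e :* n :* m) :* (y :- (:1 :- con (+ 2) :* e)) :+ (:- (con (+ 2) :* n :* m)) :* (e :* e :- :0)) refl
            ε (gauss p N n′) (nat n′) (nat m′) (p ^ n)))
        top : Top 1#
        top = cancel two (by₂ 1# (nat m * (nat m - 1#) * nat n) (gauss-full m′ (exact-p n′ m′)) p^n
          (solve 5 (λ e g n m y → con (+ 2) :* g := con (+ 2) :* (:1 :* (m :- n :* m :* (m :- :1) :* e))
             :+ :1 :* (con (+ 2) :* g :- (con (+ 2) :* m :- m :* (m :- :1) :* (n :* (:1 :- y))))
             :+ (m :* (m :- :1) :* n) :* (y :- (:1 :- con (+ 2) :* e))) refl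
            ε (gauss p (m ℕ.* n) n) (nat n) (nat m) (p ^ n)))

      -- Now p^s = q^n for s = n/2, so the period of p is s and the lower index n - 1 = 2s - 1 lies
      -- beyond one period. This is what `gauss-double` is for; its factor [2m - 1] at p^s is the
      -- source of C.
      even : ∀ s′ → n ≡ 2 ℕ.* suc s′ → Leading (nat 2 * nat m - 1#) × Top (nat 2 * nat m - 1#)
      even s′ n≡2s = leading , top
        where
        s b : ℕ
        s = suc s′
        b = 2 ℕ.* m′
        pˢ : p ^ s ≈ q ^ n
        pˢ = trans (p^ s) (^≡ q (≡.sym n≡2s))
        δ≈ε : 1# - p ^ s ≈ ε
        δ≈ε = +-congˡ (-‿cong pˢ)
        open Periodic two p s′ (λ i i<s′ → reg-p (suc i) (small∤ (s≤s z≤n) (≡.subst (2 ℕ.* suc i <_) (≡.sym n≡2s) (ℕ.*-monoʳ-< 2 (s≤s i<s′)))))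
          (trans (*-cong δ≈ε δ≈ε) ε²≈0) using (gauss-double; []≈; δ)
        n′≡ : s ℕ.+ s′ ≡ n′
        n′≡ = ℕ.suc-injective (≡.sym (≡.trans n≡2s (expand s′)))
          where
          expand : ∀ s → 2 ℕ.* suc s ≡ suc (suc s ℕ.+ s)
          expand = ℕ-Solver.solve-∀
        N≡ : s′ ℕ.+ suc b ℕ.* s ≡ N
        N≡ = ≡.trans (expand s′ m′) (cong₂ (λ x y → x ℕ.+ m′ ℕ.* y) n′≡ (≡.sym n≡2s))
          where
          expand : ∀ s m → s ℕ.+ suc (2 ℕ.* m) ℕ.* suc s ≡ (suc s ℕ.+ s) ℕ.+ m ℕ.* (2 ℕ.* suc s)
          expand = ℕ-Solver.solve-∀
        μ σ S H G Q : A
        μ = nat m′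
        σ = nat s′
        S = [ suc b ]⟨ p ^ s ⟩
        H = gauss p N n′
        G = gauss p (m ℕ.* n) n
        Q = [ m ]⟨ p ^ n ⟩
        nat-b : nat (suc b) ≈ 1# + nat 2 * μ
        nat-b = trans (nat-suc b) (+-congˡ (nat-* 2 m′))
        H≈ : H ≈ S * (1# - σ * ((nat 2 * μ) * ε))
        H≈ = trans (reflexive (≡.sym (cong₂ (gauss p) N≡ n′≡))) (trans (gauss-double b (next-p s′ (suc b)))
          (*-congˡ (+-congˡ (-‿cong (*-congˡ (*-cong (nat-* 2 m′) δ≈ε))))))
        2S : nat 2 * S ≈ nat 2 * (1# + nat 2 * μ) - (1# + nat 2 * μ) * ((1# + nat 2 * μ) - 1#) * ε
        2S = trans ([]≈ (suc b)) (+-cong (*-congˡ nat-b) (-‿cong (*-cong (*-cong nat-b (+-congʳ nat-b)) δ≈ε)))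
        2Q : nat 2 * Q ≈ nat 2 * (1# + μ) - (1# + μ) * ((1# + μ) - 1#) * (nat 2 * ε)
        2Q = trans (*-congˡ (∑-cong m (λ i _ → ^-cong i p^n))) (trans ([]-nilpotent (by₁ (nat 2 * nat 2) ε²≈0
            (solve 1 (λ e → (con (+ 2) :* e) :* (con (+ 2) :* e) := :0 :+ (con (+ 2) :* con (+ 2)) :* (e :* e :- :0))
              refl ε)) m)
          (+-cong (*-congˡ (nat-suc m′)) (-‿cong (*-congʳ (*-cong (nat-suc m′) (+-congʳ (nat-suc m′)))))))
        nat-n : nat n ≈ nat 2 * (1# + σ)
        nat-n = trans (reflexive (cong nat n≡2s)) (trans (nat-* 2 s) (*-congˡ (nat-suc s′)))
        C≈ : 1# + nat 2 * μ ≈ nat 2 * nat m - 1#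
        C≈ = by₁ (- nat 2) (nat-suc m′) (solve 2 (λ m m′ → :1 :+ con (+ 2) :* m′ := con (+ 2) :* m :- :1 :+
          (:- con (+ 2)) :* (m :- (:1 :+ m′))) refl (nat m) μ)
        leading : Leading (nat 2 * nat m - 1#)
        leading = trans (by₃ ε (- (S * σ * (nat 2 * μ))) 1# H≈ ε²≈0 (ε[] (suc b) (trans (*-congˡ pˢ) εqⁿ))
          (solve 6 (λ e H S z y c → e :* H := c :* e :+ e :* (H :- S :* (:1 :- z :* (y :* e))) :+ (:- (S :* z :* y))
            :* (e :* e :- :0) :+ :1 :* (e :* S :- c :* e)) refl
            ε H S σ (nat 2 * μ) (nat (suc b)))) (*-congʳ (trans nat-b C≈))
        G≈ : G ≈ Q * (S * (1# - σ * ((nat 2 * μ) * ε)))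
        G≈ = trans (exact-p n′ m′) (*-congˡ H≈)
        -- Relative to the constant term, [m] at p^n loses (m-1) ε, [2m-1] at p^s loses (m-1) ε, and
        -- the last factor loses 2(s-1)(m-1) ε; the total is 2s(m-1) ε = n(m-1) ε.
        core : G ≈ (1# + nat 2 * μ) * ((1# + μ) - nat 2 * (1# + σ) * (1# + μ) * ((1# + μ) - 1#) * ε)
        core = cancel two (cancel two (by₃ (nat 2 * nat 2) (nat 2 * S * u) 1# G≈ 2Q
            (by₂ (w * u) (nat 2 * nat 2 * (1# + μ) * (1# + nat 2 * μ) * (μ * μ + nat 2 * nat 2 * σ * (μ * μ) - nat 2
              * σ * (μ * μ) * μ * ε)) 2S ε²≈0
              (solve 4 (λ e m s S → (con (+ 2) :* S) :* ((con (+ 2) :* (:1 :+ m) :- (:1 :+ m) :* (:1 :+ m :- :1) :*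
                (con (+ 2) :* e)) :* (:1 :- s :* ((con (+ 2) :* m) :* e))) :=
                 con (+ 2) :* (con (+ 2) :* ((:1 :+ con (+ 2) :* m) :* ((:1 :+ m) :- con (+ 2) :* (:1 :+ s) :*
                   (:1 :+ m) :* ((:1 :+ m) :- :1) :* e)))
                 :+ ((con (+ 2) :* (:1 :+ m) :- (:1 :+ m) :* (:1 :+ m :- :1) :* (con (+ 2) :* e)) :*
                   (:1 :- s :* ((con (+ 2) :* m) :* e)))
                    :* (con (+ 2) :* S :- (con (+ 2) :* (:1 :+ con (+ 2) :* m) :- (:1 :+ con (+ 2) :* m) :*
                      ((:1 :+ con (+ 2) :* m) :- :1) :* e))
                 :+ (con (+ 2) :* con (+ 2) :* (:1 :+ m) :* (:1 :+ con (+ 2) :* m) :* (m :* m :+ con (+ 2) :* con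
                   (+ 2) :* s :* (m :* m) :- con (+ 2) :* s :* (m :* m) :* m :* e)) :* (e :* e :- :0)) refl
                ε μ σ S))
            (solve 6 (λ G Q S u w r → con (+ 2) :* (con (+ 2) :* G) := r :+ (con (+ 2) :* con (+ 2)) :*
              (G :- Q :* (S :* u))
                :+ (con (+ 2) :* S :* u) :* (con (+ 2) :* Q :- w) :+ :1 :* ((con (+ 2) :* S) :* (w :* u) :- r)) refl
              G Q S u w (nat 2 * (nat 2 * ((1# + nat 2 * μ) * ((1# + μ) - nat 2 * (1# + σ) * (1# + μ) *
                ((1# + μ) - 1#) * ε)))))))
          where
          u w : A
          u = 1# - σ * ((nat 2 * μ) * ε)
          w = nat 2 * (1# + μ) - (1# + μ) * ((1# + μ) - 1#) * (nat 2 * ε)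
        top : Top (nat 2 * nat m - 1#)
        top = trans core (*-cong C≈ (+-cong (sym (nat-suc m′))
          (-‿cong (*-congʳ (*-cong (*-cong (sym nat-n) (sym (nat-suc m′))) (+-congʳ (sym (nat-suc m′))))))))

      total : ∀ C → Leading C → Top C → (∀ k → n ≡ k ℕ.+ k → C ≈ nat 2 * nat m - 1#) →
              q * ∑ (suc n) tTerm ≈ q * (nat 2 * nat m - nat n * nat m * (nat 2 * nat m - 1#) * ε)
                + ι (sgn n) * C * (q * (nat m * q ^ n - nat n * nat m * (nat m - 1#) * ε) + nat 2 * nat m * ∑ n′
                  (βTerm (n′ ∸ 1)))
      total C leading top hC = trans (*-congˡ (+-cong first (trans (∑-last n′ (λ i → tTerm (suc i)))
        (+-congˡ (last C top)))))
        (by₁ 1# middles (solve 8 (λ q t₀ x s C y t B → q :* (t₀ :+ (x :+ s :* C :* y)) := q :* t₀ :+ s :* C :*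
          (q :* y :+ t :* B) :+ :1 :* (q :* x :- s :* (C :* t) :* B)) refl
          q _ (∑ n′ (λ i → tTerm (suc i))) (ι (sgn n)) C _ (nat 2 * nat m) (∑ n′ (βTerm (n′ ∸ 1)))))
        where
        middles : q * ∑ n′ (λ i → tTerm (suc i)) ≈ ι (sgn n) * (C * (nat 2 * nat m)) * ∑ n′ (βTerm (n′ ∸ 1))
        -- The sum over k is reversed because `βTerm` is indexed by j = n - k - 1.
        middles = trans (*-congˡ (∑-reverse n′ (λ i → tTerm (suc i))))
          (trans (sym (∑-*ˡ n′ q (λ j → tTerm (suc (n′ ∸ suc j)))))
          (trans (∑-cong n′ (λ j j<n′ → Index.middle (n′ ∸ suc j) j (n′≡ j<n′) C leading exact-p (diag j<n′)))
            (∑-*ˡ n′ _ (βTerm (n′ ∸ 1)))))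
          where
          n′≡ : ∀ {j} → j < n′ → n′ ≡ suc (n′ ∸ suc j ℕ.+ j)
          n′≡ {j} j<n′ = ≡.sym (≡.trans (≡.sym (ℕ.+-suc (n′ ∸ suc j) j)) (ℕ.m∸n+n≡m j<n′))
          diag : ∀ {j} → j < n′ → n′ ∸ suc j ≡ j → C ≈ nat 2 * nat m - 1#
          diag {j} j<n′ e = hC (suc j) (cong suc (≡.trans (n′≡ j<n′) (≡.trans (cong (λ z → suc (z ℕ.+ j)) e)
            (≡.sym (ℕ.+-suc j j)))))

-- The ring ℤ[q] of coefficient lists.

module Polynomials where
  open ≡ using (refl; sym; trans; module ≡-Reasoning)

  coeff : Poly → ℕ → ℤ
  coeff []      i       = 0ℤ
  coeff (a ∷ p) zero    = a
  coeff (a ∷ p) (suc i) = coeff p i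

  infix 4 _≋_
  -- Lists that differ by trailing zeros denote the same polynomial, so equality is taken
  -- coefficientwise. Being a record, it lets the two polynomials be inferred from a proof.
  record _≋_ (p q : Poly) : Set where
    constructor mk≋
    field at : ∀ i → coeff p i ≡ coeff q i
  open _≋_

  ≋-refl : ∀ {p} → p ≋ p
  ≋-refl = mk≋ λ _ → refl

  ≋-sym : ∀ {p q} → p ≋ q → q ≋ p
  ≋-sym e = mk≋ λ i → sym (at e i)

  ≋-trans : ∀ {p q r} → p ≋ q → q ≋ r → p ≋ r
  ≋-trans e f = mk≋ λ i → trans (at e i) (at f i)

  coeff-+ : ∀ p q i → coeff (p +ᴾ q) i ≡ coeff p i ℤ.+ coeff q i
  coeff-+ []      q       i       = sym (ℤ.+-identityˡ _)
  coeff-+ (a ∷ p) []      i       = sym (ℤ.+-identityʳ _)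
  coeff-+ (a ∷ p) (b ∷ q) zero    = refl
  coeff-+ (a ∷ p) (b ∷ q) (suc i) = coeff-+ p q i

  coeff-neg : ∀ p i → coeff (negᴾ p) i ≡ ℤ.- coeff p i
  coeff-neg []      i       = refl
  coeff-neg (a ∷ p) zero    = refl
  coeff-neg (a ∷ p) (suc i) = coeff-neg p i

  coeff-scale : ∀ c p i → coeff (scaleᴾ c p) i ≡ c ℤ.* coeff p i
  coeff-scale c []      i       = sym (ℤ.*-zeroʳ c)
  coeff-scale c (a ∷ p) zero    = refl
  coeff-scale c (a ∷ p) (suc i) = coeff-scale c p i

  zero⇒≋ : ∀ {p} → IsZeroᴾ p → p ≋ []
  zero⇒≋ []      = ≋-refl
  zero⇒≋ (e ∷ z) = mk≋ λ { zero → e ; (suc i) → at (zero⇒≋ z) i }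

  ≋⇒zero : ∀ p → p ≋ [] → IsZeroᴾ p
  ≋⇒zero []      e = []
  ≋⇒zero (a ∷ p) e = at e 0 ∷ ≋⇒zero p (mk≋ λ i → at e (suc i))

  ≈ᴾ⇒≋ : ∀ {p q} → p ≈ᴾ q → p ≋ q
  ≈ᴾ⇒≋ {p} {q} z = mk≋ λ i → ℤ.i-j≡0⇒i≡j (coeff p i) (coeff q i) (trans (sym (trans (coeff-+ p (negᴾ q) i)
    (cong (λ x → coeff p i ℤ.+ x) (coeff-neg q i)))) (at (zero⇒≋ z) i))

  ≋⇒≈ᴾ : ∀ {p q} → p ≋ q → p ≈ᴾ q
  ≋⇒≈ᴾ {p} {q} e = ≋⇒zero _ (mk≋ λ i → trans (coeff-+ p (negᴾ q) i) (trans (cong (λ x → coeff p i ℤ.+ x) (coeff-neg q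
    i)) (ℤ.i≡j⇒i-j≡0 (at e i))))

  ∷-cong : ∀ {a b p q} → a ≡ b → p ≋ q → (a ∷ p) ≋ (b ∷ q)
  ∷-cong e f = mk≋ λ { zero → e ; (suc i) → at f i }

  +ᴾ-cong : ∀ {p p′ q q′} → p ≋ p′ → q ≋ q′ → (p +ᴾ q) ≋ (p′ +ᴾ q′)
  +ᴾ-cong {p} {p′} {q} {q′} e f = mk≋ λ i → trans (coeff-+ p q i) (trans (cong₂ ℤ._+_ (at e i) (at f i))
    (sym (coeff-+ p′ q′ i)))

  negᴾ-cong : ∀ {p q} → p ≋ q → negᴾ p ≋ negᴾ q
  negᴾ-cong {p} {q} e = mk≋ λ i → trans (coeff-neg p i) (trans (cong ℤ.-_ (at e i)) (sym (coeff-neg q i)))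

  scaleᴾ-cong : ∀ c {p q} → p ≋ q → scaleᴾ c p ≋ scaleᴾ c q
  scaleᴾ-cong c {p} {q} e = mk≋ λ i → trans (coeff-scale c p i) (trans (cong (c ℤ.*_) (at e i))
    (sym (coeff-scale c q i)))

  +ᴾ-assoc : ∀ p q r → ((p +ᴾ q) +ᴾ r) ≋ (p +ᴾ (q +ᴾ r))
  +ᴾ-assoc p q r = mk≋ λ i → begin
    coeff ((p +ᴾ q) +ᴾ r) i                    ≡⟨ coeff-+ (p +ᴾ q) r i ⟩
    coeff (p +ᴾ q) i ℤ.+ coeff r i             ≡⟨ cong (ℤ._+ coeff r i) (coeff-+ p q i) ⟩
    coeff p i ℤ.+ coeff q i ℤ.+ coeff r i      ≡⟨ ℤ.+-assoc (coeff p i) (coeff q i) (coeff r i) ⟩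
    coeff p i ℤ.+ (coeff q i ℤ.+ coeff r i)    ≡⟨ cong (λ x → coeff p i ℤ.+ x) (coeff-+ q r i) ⟨
    coeff p i ℤ.+ coeff (q +ᴾ r) i             ≡⟨ coeff-+ p (q +ᴾ r) i ⟨
    coeff (p +ᴾ (q +ᴾ r)) i                    ∎
    where open ≡-Reasoning

  +ᴾ-comm : ∀ p q → (p +ᴾ q) ≋ (q +ᴾ p)
  +ᴾ-comm p q = mk≋ λ i → trans (coeff-+ p q i) (trans (ℤ.+-comm (coeff p i) (coeff q i)) (sym (coeff-+ q p i)))

  +ᴾ-identityʳ : ∀ p → (p +ᴾ []) ≋ p
  +ᴾ-identityʳ p = mk≋ λ i → trans (coeff-+ p [] i) (ℤ.+-identityʳ _)

  negᴾ-inverseʳ : ∀ p → (p +ᴾ negᴾ p) ≋ []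
  negᴾ-inverseʳ p = mk≋ λ i → trans (coeff-+ p (negᴾ p) i) (trans (cong (λ x → coeff p i ℤ.+ x) (coeff-neg p i))
    (ℤ.+-inverseʳ (coeff p i)))

  +ᴾ-interchange : ∀ p q r s → ((p +ᴾ q) +ᴾ (r +ᴾ s)) ≋ ((p +ᴾ r) +ᴾ (q +ᴾ s))
  +ᴾ-interchange p q r s = mk≋ λ i → trans (expand p q r s i) (trans (mid (coeff p i) (coeff q i) (coeff r i)
    (coeff s i)) (sym (expand p r q s i)))
    where
    expand : ∀ p q r s i → coeff ((p +ᴾ q) +ᴾ (r +ᴾ s)) i ≡ (coeff p i ℤ.+ coeff q i) ℤ.+ (coeff r i ℤ.+ coeff s i)
    expand p q r s i = trans (coeff-+ (p +ᴾ q) (r +ᴾ s) i) (cong₂ ℤ._+_ (coeff-+ p q i) (coeff-+ r s i))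
    mid : ∀ a b c d → (a ℤ.+ b) ℤ.+ (c ℤ.+ d) ≡ (a ℤ.+ c) ℤ.+ (b ℤ.+ d)
    mid = ℤ-Solver.solve-∀

  scaleᴾ-+ : ∀ c p q → scaleᴾ c (p +ᴾ q) ≋ (scaleᴾ c p +ᴾ scaleᴾ c q)
  scaleᴾ-+ c p q = mk≋ λ i → begin
    coeff (scaleᴾ c (p +ᴾ q)) i                           ≡⟨ coeff-scale c (p +ᴾ q) i ⟩
    c ℤ.* coeff (p +ᴾ q) i                                ≡⟨ cong (c ℤ.*_) (coeff-+ p q i) ⟩
    c ℤ.* (coeff p i ℤ.+ coeff q i)                       ≡⟨ ℤ.*-distribˡ-+ c (coeff p i) (coeff q i) ⟩
    c ℤ.* coeff p i ℤ.+ c ℤ.* coeff q i                   ≡⟨ cong₂ ℤ._+_ (coeff-scale c p i) (coeff-scale c q i) ⟨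
    coeff (scaleᴾ c p) i ℤ.+ coeff (scaleᴾ c q) i         ≡⟨ coeff-+ (scaleᴾ c p) (scaleᴾ c q) i ⟨
    coeff (scaleᴾ c p +ᴾ scaleᴾ c q) i                    ∎
    where open ≡-Reasoning

  scaleᴾ-* : ∀ c d p → scaleᴾ c (scaleᴾ d p) ≋ scaleᴾ (c ℤ.* d) p
  scaleᴾ-* c d p = mk≋ λ i → trans (coeff-scale c (scaleᴾ d p) i) (trans (cong (c ℤ.*_) (coeff-scale d p i))
    (trans (sym (ℤ.*-assoc c d (coeff p i))) (sym (coeff-scale (c ℤ.* d) p i))))

  shift-+ : ∀ p q → (0ℤ ∷ (p +ᴾ q)) ≋ ((0ℤ ∷ p) +ᴾ (0ℤ ∷ q))
  shift-+ p q = mk≋ λ { zero → refl ; (suc i) → refl }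

  *ᴾ-zeroʳ : ∀ p → (p *ᴾ []) ≋ []
  *ᴾ-zeroʳ []      = ≋-refl
  *ᴾ-zeroʳ (a ∷ p) = mk≋ λ { zero → refl ; (suc i) → at (*ᴾ-zeroʳ p) i }

  *ᴾ-congʳ : ∀ p {q r} → q ≋ r → (p *ᴾ q) ≋ (p *ᴾ r)
  *ᴾ-congʳ []      e = ≋-refl
  *ᴾ-congʳ (a ∷ p) e = +ᴾ-cong (scaleᴾ-cong a e) (∷-cong refl (*ᴾ-congʳ p e))

  *ᴾ-distribˡ : ∀ p q r → (p *ᴾ (q +ᴾ r)) ≋ (p *ᴾ q +ᴾ p *ᴾ r)
  *ᴾ-distribˡ []      q r = ≋-refl
  *ᴾ-distribˡ (a ∷ p) q r =
    ≋-trans (+ᴾ-cong (scaleᴾ-+ a q r) (≋-trans (∷-cong refl (*ᴾ-distribˡ p q r)) (shift-+ (p *ᴾ q) (p *ᴾ r))))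
            (+ᴾ-interchange (scaleᴾ a q) (scaleᴾ a r) (0ℤ ∷ p *ᴾ q) (0ℤ ∷ p *ᴾ r))

  *ᴾ-∷ʳ : ∀ p b q → (p *ᴾ (b ∷ q)) ≋ (scaleᴾ b p +ᴾ (0ℤ ∷ p *ᴾ q))
  *ᴾ-∷ʳ []      b q = mk≋ λ { zero → refl ; (suc i) → refl }
  *ᴾ-∷ʳ (a ∷ p) b q = ∷-cong (cong (ℤ._+ 0ℤ) (ℤ.*-comm a b))
    (≋-trans (+ᴾ-cong ≋-refl (*ᴾ-∷ʳ p b q))
    (≋-trans (≋-sym (+ᴾ-assoc (scaleᴾ a q) (scaleᴾ b p) (0ℤ ∷ p *ᴾ q)))
    (≋-trans (+ᴾ-cong (+ᴾ-comm (scaleᴾ a q) (scaleᴾ b p)) ≋-refl)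
             (+ᴾ-assoc (scaleᴾ b p) (scaleᴾ a q) (0ℤ ∷ p *ᴾ q)))))

  *ᴾ-comm : ∀ p q → (p *ᴾ q) ≋ (q *ᴾ p)
  *ᴾ-comm []      q = ≋-sym (*ᴾ-zeroʳ q)
  *ᴾ-comm (a ∷ p) q = ≋-trans (+ᴾ-cong ≋-refl (∷-cong refl (*ᴾ-comm p q))) (≋-sym (*ᴾ-∷ʳ q a p))

  *ᴾ-cong : ∀ {p p′ q q′} → p ≋ p′ → q ≋ q′ → (p *ᴾ q) ≋ (p′ *ᴾ q′)
  *ᴾ-cong {p} {p′} {q} {q′} e f =
    ≋-trans (*ᴾ-congʳ p f) (≋-trans (*ᴾ-comm p q′) (≋-trans (*ᴾ-congʳ q′ e) (*ᴾ-comm q′ p′)))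

  *ᴾ-distribʳ : ∀ p q r → ((q +ᴾ r) *ᴾ p) ≋ (q *ᴾ p +ᴾ r *ᴾ p)
  *ᴾ-distribʳ p q r = ≋-trans (*ᴾ-comm (q +ᴾ r) p) (≋-trans (*ᴾ-distribˡ p q r) (+ᴾ-cong (*ᴾ-comm p q) (*ᴾ-comm p r)))

  scaleᴾ-*ᴾ : ∀ c p q → (scaleᴾ c p *ᴾ q) ≋ scaleᴾ c (p *ᴾ q)
  scaleᴾ-*ᴾ c []      q = ≋-refl
  scaleᴾ-*ᴾ c (a ∷ p) q =
    ≋-trans (+ᴾ-cong (≋-sym (scaleᴾ-* c a q)) (∷-cong (sym (ℤ.*-zeroʳ c)) (scaleᴾ-*ᴾ c p q)))
            (≋-sym (scaleᴾ-+ c (scaleᴾ a q) (0ℤ ∷ p *ᴾ q)))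

  scaleᴾ-0 : ∀ q → scaleᴾ 0ℤ q ≋ []
  scaleᴾ-0 q = mk≋ λ i → trans (coeff-scale 0ℤ q i) (ℤ.*-zeroˡ (coeff q i))

  shift-*ᴾ : ∀ p q → ((0ℤ ∷ p) *ᴾ q) ≋ (0ℤ ∷ (p *ᴾ q))
  shift-*ᴾ p q = +ᴾ-cong (scaleᴾ-0 q) ≋-refl

  *ᴾ-assoc : ∀ p q r → ((p *ᴾ q) *ᴾ r) ≋ (p *ᴾ (q *ᴾ r))
  *ᴾ-assoc []      q r = ≋-refl
  *ᴾ-assoc (a ∷ p) q r =
    ≋-trans (*ᴾ-distribʳ r (scaleᴾ a q) (0ℤ ∷ p *ᴾ q))
            (+ᴾ-cong (scaleᴾ-*ᴾ a q r) (≋-trans (shift-*ᴾ (p *ᴾ q) r) (∷-cong refl (*ᴾ-assoc p q r))))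

  constᴾ-*ᴾ : ∀ c p → (constᴾ c *ᴾ p) ≋ scaleᴾ c p
  constᴾ-*ᴾ c p = ≋-trans (+ᴾ-cong {scaleᴾ c p} {scaleᴾ c p} {0ℤ ∷ []} {[]} ≋-refl (mk≋ λ { zero → refl ; (suc i) →
    refl })) (+ᴾ-identityʳ (scaleᴾ c p))

  *ᴾ-identityˡ : ∀ p → (oneᴾ *ᴾ p) ≋ p
  *ᴾ-identityˡ p = ≋-trans (constᴾ-*ᴾ 1ℤ p) (mk≋ λ i → trans (coeff-scale 1ℤ p i) (ℤ.*-identityˡ _))

  ≋-isEquivalence : IsEquivalence _≋_
  ≋-isEquivalence = record { refl = ≋-refl ; sym = ≋-sym ; trans = ≋-trans }

  const0 : constᴾ 0ℤ ≋ []
  const0 = mk≋ λ { zero → refl ; (suc i) → refl }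

  ≋-isCommutativeRing : IsCommutativeRing _≋_ _+ᴾ_ _*ᴾ_ negᴾ (constᴾ 0ℤ) (constᴾ 1ℤ)
  ≋-isCommutativeRing = record
    { isRing = record
      { +-isAbelianGroup = record
        { isGroup = record
          { isMonoid = record
            { isSemigroup = record
              { isMagma = record { isEquivalence = ≋-isEquivalence ; ∙-cong = +ᴾ-cong }
              ; assoc = +ᴾ-assoc }
            ; identity = (λ p → +ᴾ-cong const0 ≋-refl) , (λ p → ≋-trans (+ᴾ-cong (≋-refl {p}) const0) (+ᴾ-identityʳ
              p)) }
          ; inverse = (λ p → ≋-trans (+ᴾ-comm (negᴾ p) p) (inverseʳ p)) , inverseʳ
          ; ⁻¹-cong = negᴾ-cong }
        ; comm = +ᴾ-comm }
      ; *-cong = *ᴾ-cong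
      ; *-assoc = *ᴾ-assoc
      ; *-identity = *ᴾ-identityˡ , (λ p → ≋-trans (*ᴾ-comm p oneᴾ) (*ᴾ-identityˡ p))
      ; distrib = *ᴾ-distribˡ , *ᴾ-distribʳ }
    ; *-comm = *ᴾ-comm }
    where
    inverseʳ : ∀ p → (p +ᴾ negᴾ p) ≋ constᴾ 0ℤ
    inverseʳ p = ≋-trans (negᴾ-inverseʳ p) (≋-sym const0)

  polyOps : Ops
  polyOps = record { A = Poly ; _+_ = _+ᴾ_ ; _*_ = _*ᴾ_ ; -_ = negᴾ ; ι = constᴾ }

  polyLaws : Laws polyOps _≋_
  polyLaws = record
    { isCommutativeRing = ≋-isCommutativeRing
    ; ι-+   = λ a b → ≋-refl
    ; ι-*   = λ a b → ∷-cong (sym (ℤ.+-identityʳ (a ℤ.* b))) ≋-refl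
    ; ι-neg = λ a → ≋-refl
    }

  module 𝒫 = Ring polyOps _≋_ polyLaws

  -- Degrees and division by monic polynomials.

  Below : ℕ → Poly → Set
  Below k p = ∀ i → k ≤ i → coeff p i ≡ 0ℤ

  record Monic (d : ℕ) (p : Poly) : Set where
    constructor monic
    field
      coeff-lead  : coeff p d ≡ 1ℤ
      below-lead  : Below (suc d) p

  Below-cong : ∀ {k p q} → p ≋ q → Below k p → Below k q
  Below-cong e h i k≤i = trans (sym (at e i)) (h i k≤i)

  Monic-cong : ∀ {d p q} → p ≋ q → Monic d p → Monic d q
  Monic-cong {d} e (monic h b) = monic (trans (sym (at e d)) h) (Below-cong e b)

  Below-length : ∀ p → Below (length p) p
  Below-length []      i       _         = refl
  Below-length (x ∷ p) (suc i) (s≤s h)   = Below-length p i h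

  Below-0 : ∀ {p} → Below 0 p → p ≋ []
  Below-0 h = mk≋ λ i → h i z≤n

  Below-mono : ∀ {k l p} → k ≤ l → Below k p → Below l p
  Below-mono k≤l h i l≤i = h i (ℕ.≤-trans k≤l l≤i)

  Below-- : ∀ {k p q} → Below k p → Below k q → Below k (p -ᴾ q)
  Below-- {k} {p} {q} h g i k≤i = trans (coeff-+ p (negᴾ q) i) (cong₂ ℤ._+_ (h i k≤i) (trans (coeff-neg q i)
    (cong ℤ.-_ (g i k≤i))))

  coeff-*-cons : ∀ x p b i → coeff ((x ∷ p) *ᴾ b) i ≡ x ℤ.* coeff b i ℤ.+ coeff (0ℤ ∷ p *ᴾ b) i
  coeff-*-cons x p b i = trans (coeff-+ (scaleᴾ x b) (0ℤ ∷ p *ᴾ b) i) (cong (ℤ._+ coeff (0ℤ ∷ p *ᴾ b) i) (coeff-scale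
    x b i))

  Below-* : ∀ m d p b → Below m p → Below (suc d) b → Below (m ℕ.+ d) (p *ᴾ b)
  Below-* m       d []      b h g i       le       = refl
  Below-* zero    d (x ∷ p) b h g i       le       = at (*ᴾ-cong {x ∷ p} {[]} {b} {b} (Below-0 h) ≋-refl) i
  Below-* (suc m) d (x ∷ p) b h g (suc i) (s≤s le) = trans (coeff-*-cons x p b (suc i)) (cong₂ ℤ._+_
    (trans (cong (x ℤ.*_) (g (suc i) (s≤s (ℕ.≤-trans (ℕ.m≤n+m d m) le)))) (ℤ.*-zeroʳ x))
    (Below-* m d p b (λ j le′ → h (suc j) (s≤s le′)) g i le))

  coeff-top : ∀ j d p b → Below (suc j) p → Below (suc d) b → coeff (p *ᴾ b) (j ℕ.+ d) ≡ coeff p j ℤ.* coeff b d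
  coeff-top j       d []      b h g = sym (ℤ.*-zeroˡ (coeff b d))
  coeff-top zero    d (x ∷ p) b h g = trans (coeff-*-cons x p b d) (trans (cong (λ z → x ℤ.* coeff b d ℤ.+ z)
    (tail d)) (ℤ.+-identityʳ _))
    where
    tail : ∀ i → coeff (0ℤ ∷ p *ᴾ b) i ≡ 0ℤ
    tail zero    = refl
    tail (suc i) = at (*ᴾ-cong {p} {[]} {b} {b} (Below-0 (λ i _ → h (suc i) (s≤s z≤n))) ≋-refl) i
  coeff-top (suc j) d (x ∷ p) b h g = trans (coeff-*-cons x p b (suc (j ℕ.+ d))) (trans (cong₂ ℤ._+_
    (trans (cong (x ℤ.*_) (g (suc (j ℕ.+ d)) (s≤s (ℕ.m≤n+m d j)))) (ℤ.*-zeroʳ x))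
    (coeff-top j d p b (λ i le → h (suc i) (s≤s le)) g)) (ℤ.+-identityˡ _))

  Monic-* : ∀ {d e p b} → Monic d p → Monic e b → Monic (d ℕ.+ e) (p *ᴾ b)
  Monic-* {d} {e} {p} {b} (monic h below) (monic g below′) =
    monic (trans (coeff-top d e p b below below′) (cong₂ ℤ._*_ h g)) (Below-* (suc d) e p b below below′)

  -- The leading coefficient of p reappears unchanged in the product because b is monic, so a degree
  -- bound on p can be lowered again and again. Uniqueness of division and regularity of monic
  -- polynomials both rest on this.
  monic-Below-* : ∀ {d b} → Monic d b → ∀ p → Below d (p *ᴾ b) → p ≋ []
  monic-Below-* {d} {b} (monic h below) p z = descend (length p) (Below-length p)
    where
    descend : ∀ m → Below m p → p ≋ []
    descend zero    g = Below-0 g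
    descend (suc m) g = descend m lower
      where
      top : coeff p m ≡ 0ℤ
      top = trans (sym (ℤ.*-identityʳ _)) (trans (cong (coeff p m ℤ.*_) (sym h))
        (trans (sym (coeff-top m d p b g below)) (z (m ℕ.+ d) (ℕ.m≤n+m d m))))
      lower : Below m p
      lower i m≤i with ℕ.m≤n⇒m<n∨m≡n m≤i
      ... | inj₁ m<i = g i m<i
      ... | inj₂ refl = top

  degree : ∀ p → p ≋ [] ⊎ ∃ λ k → coeff p k ≢ 0ℤ × Below (suc k) p
  degree p = descend (length p) (Below-length p)
    where
    descend : ∀ m → Below m p → p ≋ [] ⊎ ∃ λ k → coeff p k ≢ 0ℤ × Below (suc k) p
    descend zero    g = inj₁ (Below-0 g)
    descend (suc m) g with coeff p m ℤ.≟ 0ℤ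
    ... | no  h = inj₂ (m , h , g)
    ... | yes h = descend m lower
      where
      lower : Below m p
      lower i m≤i with ℕ.m≤n⇒m<n∨m≡n m≤i
      ... | inj₁ m<i = g i m<i
      ... | inj₂ refl = h

  -- The product has the leading coefficient of p in degree k + d, which forces n = k + d. `Φ` is a
  -- computed quotient, so its being monic is read off from the exact factorisation.
  Monic-quotient : ∀ {d n p b f} → (p *ᴾ b) ≋ f → Monic d b → Monic n f → ∃ λ k → Monic k p
  Monic-quotient {d} {n} {p} {b} {f} e (monic h below) (monic g below′) with degree p
  ... | inj₁ z = contradiction (trans (sym g) (trans (sym (at e n)) (at (*ᴾ-cong {p} {[]} {b} {b} z ≋-refl) n))) λ ()
  ... | inj₂ (k , c , below″) = k , monic lead≡1 below″
    where
    top : coeff f (k ℕ.+ d) ≡ coeff p k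
    top = trans (sym (at e (k ℕ.+ d))) (trans (coeff-top k d p b below″ below) (trans (cong (coeff p k ℤ.*_) h)
      (ℤ.*-identityʳ _)))
    lead≡1 : coeff p k ≡ 1ℤ
    lead≡1 with ℕ.<-cmp n (k ℕ.+ d)
    ... | tri< lt _ _ = contradiction (trans (sym top) (below′ (k ℕ.+ d) lt)) c
    ... | tri≈ _ refl _ = trans (sym top) g
    ... | tri> _ _ gt = contradiction (trans (sym g) (trans (sym (at e n)) (Below-* (suc k) d p b below″ below n
            gt))) λ ()

  coeff-∷ʳ : ∀ p x → coeff (p ∷ʳ x) (length p) ≡ x
  coeff-∷ʳ []      x = refl
  coeff-∷ʳ (y ∷ p) x = coeff-∷ʳ p x

  ∷ʳ-0 : ∀ p → (p ∷ʳ 0ℤ) ≋ p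
  ∷ʳ-0 []      = mk≋ λ { zero → refl ; (suc i) → refl }
  ∷ʳ-0 (x ∷ p) = ∷-cong refl (∷ʳ-0 p)

  normᴾ-spec : ∀ p → normᴾ p ≋ p × (∀ k → Below k p → length (normᴾ p) ≤ k)
  normᴾ-spec p = go (reverseView p)
    where
    go : ∀ {p} → Reverse p → normᴾ p ≋ p × (∀ k → Below k p → length (normᴾ p) ≤ k)
    go [] = ≋-refl , λ _ _ → z≤n
    go (p ∶ v ∶ʳ x) rewrite List.reverse-++ p (x ∷ []) with x ℤ.≟ 0ℤ
    ... | yes refl = ≋-trans (proj₁ (go v)) (≋-sym (∷ʳ-0 p)) , λ k h → proj₂ (go v) k (Below-cong (∷ʳ-0 p) h)
    ... | no x≢0 rewrite List.unfold-reverse x (reverse p) | List.reverse-involutive p =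
            ≋-refl , λ k h → subst (_≤ k) (sym (trans (List.length-++ p) (ℕ.+-comm (length p) 1)))
              (ℕ.≰⇒> λ k≤ → x≢0 (trans (sym (coeff-∷ʳ p x)) (h (length p) k≤)))

  normᴾ-≋ : ∀ p → normᴾ p ≋ p
  normᴾ-≋ p = proj₁ (normᴾ-spec p)

  normᴾ-length : ∀ {k} p → Below k p → length (normᴾ p) ≤ k
  normᴾ-length p = proj₂ (normᴾ-spec p) _

  Below-normᴾ : ∀ p → Below (length (normᴾ p)) p
  Below-normᴾ p = Below-cong (normᴾ-≋ p) (Below-length (normᴾ p))

  Monic-length : ∀ {d} p → Monic d p → length (normᴾ p) ≡ suc d
  Monic-length {d} p (monic h below) = ℕ.≤-antisym (normᴾ-length p below)
    (ℕ.≰⇒> λ le → contradiction (trans (sym h) (Below-normᴾ p d le)) λ ())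

  lead-coeff : ∀ x p → lead (x ∷ p) ≡ coeff (x ∷ p) (length p)
  lead-coeff x []      = refl
  lead-coeff x (y ∷ p) = lead-coeff y p

  coeff-qpow : ∀ k → coeff (qpow k) k ≡ 1ℤ
  coeff-qpow zero    = refl
  coeff-qpow (suc k) = coeff-qpow k

  Below-qpow : ∀ k → Below (suc k) (qpow k)
  Below-qpow zero    (suc i) h       = refl
  Below-qpow (suc k) (suc i) (s≤s h) = Below-qpow k i h

  Below-scale : ∀ c {k p} → Below k p → Below k (scaleᴾ c p)
  Below-scale c {k} {p} h i k≤i = trans (coeff-scale c p i) (trans (cong (c ℤ.*_) (h i k≤i)) (ℤ.*-zeroʳ c))

  reduce-Below : ∀ {d b} → Monic d b → ∀ a → suc d ≤ length a →
    Below (length a ∸ 1) (a -ᴾ (scaleᴾ (lead a) (qpow (length a ∸ suc d)) *ᴾ b))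
  reduce-Below {d} {b} (monic h below) (x ∷ a) (s≤s d≤) i le with ℕ.m≤n⇒m<n∨m≡n le
  ... | inj₁ lt = Below-- {suc (length a)} {x ∷ a} {t *ᴾ b} (Below-length (x ∷ a)) tb i lt
    where
    e = length a ∸ d
    t = scaleᴾ (lead (x ∷ a)) (qpow e)
    tb : Below (suc (length a)) (t *ᴾ b)
    tb = subst (λ z → Below (suc z) (t *ᴾ b)) (ℕ.m∸n+n≡m d≤) (Below-* (suc e) d t b (Below-scale (lead (x ∷ a))
      {suc e} {qpow e} (Below-qpow e)) below)
  ... | inj₂ refl = trans (coeff-+ (x ∷ a) (negᴾ (t *ᴾ b)) (length a)) (trans (cong (λ z → coeff (x ∷ a) (length a)
          ℤ.+ z) (trans (coeff-neg (t *ᴾ b) (length a)) (cong ℤ.-_ top)))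
         (ℤ.+-inverseʳ (coeff (x ∷ a) (length a))))
    where
    open ≡.≡-Reasoning
    e = length a ∸ d
    t = scaleᴾ (lead (x ∷ a)) (qpow e)
    top : coeff (t *ᴾ b) (length a) ≡ coeff (x ∷ a) (length a)
    top = begin
      coeff (t *ᴾ b) (length a)                       ≡⟨ cong (coeff (t *ᴾ b)) (ℕ.m∸n+n≡m d≤) ⟨
      coeff (t *ᴾ b) (e ℕ.+ d)                        ≡⟨ coeff-top e d t b (Below-scale (lead (x ∷ a)) {suc e}
        {qpow e} (Below-qpow e)) below ⟩
      coeff t e ℤ.* coeff b d                         ≡⟨ cong₂ ℤ._*_ (trans (coeff-scale (lead (x ∷ a)) (qpow e) e)
        (cong (lead (x ∷ a) ℤ.*_) (coeff-qpow e))) h ⟩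
      lead (x ∷ a) ℤ.* 1ℤ ℤ.* 1ℤ                      ≡⟨ trans (ℤ.*-identityʳ _) (ℤ.*-identityʳ _) ⟩
      lead (x ∷ a)                                    ≡⟨ lead-coeff x a ⟩
      coeff (x ∷ a) (length a)                        ∎

  -- Each pass cancels the leading coefficient and so shortens the normalised dividend; fuel
  -- exceeding its length therefore never runs out.
  divMonicF-spec : ∀ {d b} → Monic d b → length b ≡ suc d → ∀ f a → length (normᴾ a) < f →
    ∃ λ r → Below d r × a ≋ (divMonicF f a b *ᴾ b +ᴾ r)
  divMonicF-spec {d} {b} mb lb (suc f) a (s≤s h) with normᴾ a | normᴾ-≋ a | h
  ... | a′ | ea | h′ with length a′ ℕ.<ᵇ length b in eq
  ...   | true = a , Below-cong ea (Below-mono {p = a′} (ℕ.≤-pred (subst (length a′ <_) lb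
          (ℕ.<ᵇ⇒< _ _ (subst T (sym eq) tt)))) (Below-length a′)) , ≋-refl
  ...   | false with divMonicF-spec mb lb f (a′ -ᴾ (scaleᴾ (lead a′) (qpow (length a′ ∸ length b)) *ᴾ b))
                       (ℕ.≤-<-trans (normᴾ-length (a′ -ᴾ (scaleᴾ (lead a′) (qpow (length a′ ∸ length b)) *ᴾ b)) low)
                         (pred< d<a h′))
    where
    d<a : suc d ≤ length a′
    d<a = subst (_≤ length a′) lb (ℕ.≮⇒≥ λ lt → subst T eq (ℕ.<⇒<ᵇ lt))
    low : Below (length a′ ∸ 1) (a′ -ᴾ (scaleᴾ (lead a′) (qpow (length a′ ∸ length b)) *ᴾ b))
    low = subst (λ z → Below (length a′ ∸ 1) (a′ -ᴾ (scaleᴾ (lead a′) (qpow (length a′ ∸ z)) *ᴾ b))) (sym lb)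
      (reduce-Below mb a′ d<a)
    pred< : ∀ {l} → suc d ≤ l → l ≤ f → l ∸ 1 < f
    pred< {suc l} _ l<f = l<f
  ...     | r , br , e = r , br , 𝒫.by₂ (- 1#) 1# ea e
              (solve 6 (λ a a′ t b D r → a := (t :+ D) :* b :+ r :+ (:- :1) :* (a′ :- a) :+ :1 :* (a′ :- t :* b :-
                (D :* b :+ r))) ≋-refl
                a a′ (scaleᴾ (lead a′) (qpow (length a′ ∸ length b))) b _ r)
    where open 𝒫

  division : ∀ {d b} → Monic d b → ∀ a → ∃ λ r → Below d r × a ≋ (divMonic a b *ᴾ b +ᴾ r)
  division {d} {b} mb a with divMonicF-spec {d} {normᴾ b} (Monic-cong (≋-sym (normᴾ-≋ b)) mb) (Monic-length b mb)
    (suc (length a)) a (s≤s (normᴾ-length a (Below-length a)))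
  ... | r , br , e = r , br , ≋-trans e (+ᴾ-cong (*ᴾ-congʳ (divMonic a b) (normᴾ-≋ b)) ≋-refl)

  -- The remainder is (c - quotient) times b and has degree below that of the monic b, so c and the
  -- computed quotient coincide.
  division-exact : ∀ {d b} → Monic d b → ∀ {a c} → (c *ᴾ b) ≋ a → (divMonic a b *ᴾ b) ≋ a
  division-exact {d} {b} mb {a} {c} e with division {d} {b} mb a
  ... | r , br , e′ = ≋-trans (by₁ (- b) c≋ (solve 3 (λ D b c → D :* b := c :* b :+ (:- b) :* (c :- D :- :0)) ≋-refl
          (divMonic a b) b c)) e
    where
    open 𝒫
    r≋ : ((c -ᴾ divMonic a b) *ᴾ b) ≋ r
    r≋ = by₂ 1# 1# e e′ (solve 5 (λ c D b r a → (c :- D) :* b := r :+ :1 :* (c :* b :- a) :+ :1 :*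
      (a :- (D :* b :+ r))) ≋-refl c (divMonic a b) b r a)
    c≋ : (c -ᴾ divMonic a b) ≋ constᴾ 0ℤ
    c≋ = ≋-trans (monic-Below-* {d} {b} mb _ (Below-cong (≋-sym r≋) br)) (≋-sym const0)

  monic-regular : ∀ {d b} → Monic d b → 𝒫.Regular b
  monic-regular {d} {b} mb y e = ≋-trans (monic-Below-* {d} {b} mb y (Below-cong {p = constᴾ 0ℤ}
    (≋-sym (≋-trans (*ᴾ-comm y b) e)) zeros)) (≋-sym const0)
    where
    zeros : Below d (constᴾ 0ℤ)
    zeros i _ = at const0 i

  scale-≋-0 : ∀ {c p} → c ≢ 0ℤ → (constᴾ c *ᴾ p) ≋ constᴾ 0ℤ → p ≋ constᴾ 0ℤ
  scale-≋-0 {c} {p} c≢0 e = ≋-trans (mk≋ pointwise) (≋-sym const0)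
    where
    pointwise : ∀ i → coeff p i ≡ 0ℤ
    pointwise i with ℤ.i*j≡0⇒i≡0∨j≡0 c (trans (sym (coeff-scale c p i)) (trans (sym (at (constᴾ-*ᴾ c p) i))
      (trans (at e i) (at const0 i))))
    ... | inj₁ z = contradiction z c≢0
    ... | inj₂ z = z

  infix 4 _∣_
  record _∣_ (p f : Poly) : Set where
    constructor divides
    field
      quotient : Poly
      equality : (p *ᴾ quotient) ≋ f

  division-∃ : ∀ {d b} → Monic d b → ∀ a → ∃ λ u → ∃ λ r → Below d r × a ≋ (u *ᴾ b +ᴾ r)
  division-∃ {d} {b} mb a = divMonic a b , division {d} {b} mb a

  -- If r is the remainder of f, then c r is a multiple of p of degree below d, hence zero, and so
  -- is r. This is how integers are cancelled, and why coprimality over ℚ suffices.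
  monic-∣-scale : ∀ {d p} → Monic d p → ∀ {c f} → c ≢ 0ℤ → p ∣ (constᴾ c *ᴾ f) → p ∣ f
  monic-∣-scale {d} {p} mp {c} {f} c≢0 (divides u e) with division-∃ {d} {p} mp f
  ... | D , r , br , e′ = divides D (≋-trans (by₁ (- 1#) (scale-≋-0 c≢0 cr≋0) (solve 3 (λ p D r → p :* D := D :* p :+
          r :+ (:- :1) :* (r :- :0)) ≋-refl p D r)) (≋-sym e′))
    where
    open 𝒫
    cr≋ : ((u -ᴾ constᴾ c *ᴾ D) *ᴾ p) ≋ (constᴾ c *ᴾ r)
    cr≋ = by₂ 1# (constᴾ c) e e′ (solve 6 (λ u c D p r f → (u :- c :* D) :* p := c :* r :+ :1 :* (p :* u :- c :* f)
      :+ c :* (f :- (D :* p :+ r))) ≋-refl u (constᴾ c) D p r f)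
    low : Below d (constᴾ c *ᴾ r)
    low = Below-cong (≋-sym (constᴾ-*ᴾ c r)) (Below-scale c {d} {r} br)
    cr≋0 : (constᴾ c *ᴾ r) ≋ constᴾ 0ℤ
    cr≋0 = by₂ (- 1#) p cr≋ (≋-trans (monic-Below-* {d} {p} mp _ (Below-cong (≋-sym cr≋) low)) (≋-sym const0))
      (solve 3 (λ x p z → z := :0 :+ (:- :1) :* (x :* p :- z) :+ p :* (x :- :0)) ≋-refl (u -ᴾ constᴾ c *ᴾ D) p
        (constᴾ c *ᴾ r))

open Polynomials

-- Quotient rings and cyclotomic polynomials.

module Cyclotomic where
  open 𝒫

  record Ideal (O : Ops) (Eq : Ops.A O → Ops.A O → Set) (L : Laws O Eq) (I : Ops.A O → Set) : Set where
    open Ring O Eq L using () renaming (_≈_ to _≈′_; _+_ to _+′_; _*_ to _*′_; 0# to 0′)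
    field
      I-cong : ∀ {x y} → x ≈′ y → I x → I y
      I-0    : I 0′
      I-+    : ∀ {x y} → I x → I y → I (x +′ y)
      I-*    : ∀ c {x} → I x → I (c *′ x)

  record _~[_]_ {O : Ops} (x : Ops.A O) (I : Ops.A O → Set) (y : Ops.A O) : Set where
    constructor mk~
    field in-ideal : I (Raw._-_ O x y)

  module Quotient (O : Ops) (Eq : Ops.A O → Ops.A O → Set) (L : Laws O Eq) (I : Ops.A O → Set) (isIdeal : Ideal O Eq L I) where
    private module R = Ring O Eq L
    open Ideal isIdeal

    _~_ : R.A → R.A → Set
    x ~ y = _~[_]_ {O} x I y

    ≈⇒~ : ∀ {x y} → x R.≈ y → x ~ y
    ≈⇒~ {x} {y} e = mk~ (I-cong (R.sym (R.by₁ R.1# e (R.solve 2 (λ x y → x R.:- y R.:= R.:0 R.:+ R.:1 R.:*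
      (x R.:- y)) R.refl x y))) I-0)

    laws : Laws O _~_
    laws = record
      { isCommutativeRing = record
        { isRing = record
          { +-isAbelianGroup = record
            { isGroup = record
              { isMonoid = record
                { isSemigroup = record
                  { isMagma = record { isEquivalence = record { refl = ≈⇒~ R.refl ; sym = ~-sym ; trans = ~-trans } ;
                    ∙-cong = ~-+ }
                  ; assoc = λ x y z → ≈⇒~ (R.+-assoc x y z) }
                ; identity = (λ x → ≈⇒~ (R.+-identityˡ x)) , (λ x → ≈⇒~ (R.+-identityʳ x)) }
              ; inverse = (λ x → ≈⇒~ (R.trans (R.+-comm _ _) (R.-‿inverseʳ x))) , (λ x → ≈⇒~ (R.-‿inverseʳ x))
              ; ⁻¹-cong = ~-neg }
            ; comm = λ x y → ≈⇒~ (R.+-comm x y) }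
          ; *-cong = ~-*
          ; *-assoc = λ x y z → ≈⇒~ (R.*-assoc x y z)
          ; *-identity = (λ x → ≈⇒~ (R.*-identityˡ x)) , (λ x → ≈⇒~ (R.*-identityʳ x))
          ; distrib = (λ x y z → ≈⇒~ (R.solve 3 (λ x y z → x R.:* (y R.:+ z) R.:= x R.:* y R.:+ x R.:* z) R.refl x y
            z))
                    , (λ x y z → ≈⇒~ (R.solve 3 (λ x y z → (y R.:+ z) R.:* x R.:= y R.:* x R.:+ z R.:* x) R.refl x y
                      z)) }
        ; *-comm = λ x y → ≈⇒~ (R.*-comm x y) }
      ; ι-+ = λ a b → ≈⇒~ (R.ι-+ a b)
      ; ι-* = λ a b → ≈⇒~ (R.ι-* a b)
      ; ι-neg = λ a → ≈⇒~ (R.ι-neg a)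
      }
      where
      ~-sym : ∀ {x y} → x ~ y → y ~ x
      ~-sym {x} {y} (mk~ h) = mk~ (I-cong (R.solve 2 (λ x y → (R.:- R.:1) R.:* (x R.:- y) R.:= y R.:- x) R.refl x y)
        (I-* (R.- R.1#) h))
      ~-trans : ∀ {x y z} → x ~ y → y ~ z → x ~ z
      ~-trans {x} {y} {z} (mk~ h) (mk~ g) = mk~ (I-cong (R.solve 3 (λ x y z → (x R.:- y) R.:+ (y R.:- z) R.:= x R.:-
        z) R.refl x y z) (I-+ h g))
      ~-+ : ∀ {x y u v} → x ~ y → u ~ v → (x R.+ u) ~ (y R.+ v)
      ~-+ {x} {y} {u} {v} (mk~ h) (mk~ g) = mk~ (I-cong (R.solve 4 (λ x y u v → (x R.:- y) R.:+ (u R.:- v) R.:=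
        (x R.:+ u) R.:- (y R.:+ v)) R.refl x y u v) (I-+ h g))
      ~-neg : ∀ {x y} → x ~ y → (R.- x) ~ (R.- y)
      ~-neg {x} {y} (mk~ h) = mk~ (I-cong (R.solve 2 (λ x y → (R.:- R.:1) R.:* (x R.:- y) R.:= (R.:- x) R.:-
        (R.:- y)) R.refl x y) (I-* (R.- R.1#) h))
      ~-* : ∀ {x y u v} → x ~ y → u ~ v → (x R.* u) ~ (y R.* v)
      ~-* {x} {y} {u} {v} (mk~ h) (mk~ g) = mk~ (I-cong (R.solve 4 (λ x y u v → u R.:* (x R.:- y) R.:+ y R.:*
        (u R.:- v) R.:= x R.:* u R.:- y R.:* v) R.refl x y u v) (I-+ (I-* u h) (I-* y g)))

  X : Poly
  X = qpow 1

  qpow≋ : ∀ k → qpow k ≋ X ^ k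
  qpow≋ zero    = ≋-refl
  qpow≋ (suc k) = ≋-trans (∷-cong ≡.refl (≋-trans (qpow≋ k) (≋-sym (*ᴾ-identityˡ (X ^ k)))))
    (≋-sym (shift-*ᴾ oneᴾ (X ^ k)))

  Monic-X^-1 : ∀ n → Monic (suc n) (X ^ suc n - 1#)
  Monic-X^-1 n = Monic-cong (+ᴾ-cong (qpow≋ (suc n)) ≋-refl) (monic top below)
    where
    below : Below (suc (suc n)) (qpow (suc n) -ᴾ oneᴾ)
    below = Below-- {suc (suc n)} {qpow (suc n)} {oneᴾ} (Below-qpow (suc n)) λ { (suc i) _ → ≡.refl }
    top : coeff (qpow (suc n) -ᴾ oneᴾ) (suc n) ≡ 1ℤ
    top = ≡.trans (coeff-+ (qpow (suc n)) (negᴾ oneᴾ) (suc n)) (≡.cong (ℤ._+ 0ℤ) (coeff-qpow (suc n)))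

  Monic-one : Monic 0 oneᴾ
  Monic-one = monic ≡.refl λ { (suc i) _ → ≡.refl }

  ∣-refl : ∀ {p} → p ∣ p
  ∣-refl {p} = divides 1# (*-identityʳ p)

  ∣-cong : ∀ {p f g} → f ≋ g → p ∣ f → p ∣ g
  ∣-cong e (divides u h) = divides u (≋-trans h e)

  ∣-trans : ∀ {p r f} → p ∣ r → r ∣ f → p ∣ f
  ∣-trans {p} (divides u h) (divides v g) = divides (u *ᴾ v) (≋-trans (≋-sym (*-assoc p u v))
    (≋-trans (*ᴾ-cong h (≋-refl {v})) g))

  ∣-* : ∀ {p r f g} → p ∣ f → r ∣ g → (p *ᴾ r) ∣ (f *ᴾ g)
  ∣-* {p} {r} (divides u h) (divides v k) = divides (u *ᴾ v) (≋-trans (solve 4 (λ p r u v → (p :* r) :* (u :* v) :=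
    (p :* u) :* (r :* v)) ≋-refl p r u v) (*ᴾ-cong h k))

  ∣-*ʳ : ∀ {p f} g → p ∣ f → p ∣ (g *ᴾ f)
  ∣-*ʳ {p} {f} g (divides u h) = divides (g *ᴾ u) (≋-trans (solve 3 (λ p g u → p :* (g :* u) := g :* (p :* u)) ≋-refl
    p g u) (*ᴾ-congʳ g h))

  -- Equivalent to coprimality in ℚ[q].
  record Comax (a b : Poly) : Set where
    constructor comax
    field
      {c}  : ℤ
      c≢0  : c ≢ 0ℤ
      u v  : Poly
      bezout : a *ᴾ u +ᴾ b *ᴾ v ≋ constᴾ c

  Comax-∣ : ∀ {a b b′} → b′ ∣ b → Comax a b → Comax a b′
  Comax-∣ {a} {b} {b′} (divides w h) (comax {c} c≢0 u v e) = comax c≢0 u (w *ᴾ v) (by₂ 1# v e h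
    (solve 7 (λ a b b′ u v w c → a :* u :+ b′ :* (w :* v) := c :+ :1 :* (a :* u :+ b :* v :- c) :+ v :*
      (b′ :* w :- b)) ≋-refl a b b′ u v w (constᴾ c)))

  Comax-sym : ∀ {a b} → Comax a b → Comax b a
  Comax-sym {a} {b} (comax c≢0 u v e) = comax c≢0 v u (≋-trans (+-comm (b *ᴾ v) (a *ᴾ u)) e)

  Comax-∣-cancel : ∀ {d a b f} → Monic d b → Comax a b → b ∣ (a *ᴾ f) → b ∣ f
  Comax-∣-cancel {d} {a} {b} {f} mb (comax {c} c≢0 u v e) (divides w h) = monic-∣-scale mb c≢0
    (divides (w *ᴾ u +ᴾ v *ᴾ f) (by₂ u f h e (solve 7 (λ a b f u v w c → b :* (w :* u :+ v :* f) := c :* f :+ u :*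
      (b :* w :- a :* f) :+ f :* (a :* u :+ b :* v :- c)) ≋-refl a b f u v w (constᴾ c))))

  IsMonic : ℕ × Poly → Set
  IsMonic (_ , P) = ∃ λ d → Monic d P

  Comax₂ : ℕ × Poly → ℕ × Poly → Set
  Comax₂ (_ , P) (_ , Q) = Comax P Q

  prodDividing-Monic : ∀ N {xs} → All IsMonic xs → ∃ λ d → Monic d (prodDividing N xs)
  prodDividing-Monic N []                          = 0 , Monic-one
  prodDividing-Monic N {(d , P) ∷ xs} ((k , h) ∷ hs) with d ℕ.∣? N | prodDividing-Monic N hs
  ... | yes _ | e , g = k ℕ.+ e , Monic-* h g
  ... | no  _ | e , g = e , g

  -- Once P is split off as F = P G, the remaining factors, being comaximal with P and monic, divide
  -- G already.
  prodDividing-∣ : ∀ N {F xs} → All IsMonic xs → AllPairs Comax₂ xs → All (λ (d , P) → d ℕ.∣ N → P ∣ F) xs →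
    prodDividing N xs ∣ F
  prodDividing-∣ N {F} [] [] [] = divides F (*-identityˡ F)
  prodDividing-∣ N {F} {(d , P) ∷ xs} (_ ∷ ms) (cs ∷ css) (h ∷ hs) with d ℕ.∣? N
  ... | no  _   = prodDividing-∣ N ms css hs
  ... | yes d∣N with h d∣N
  ...   | divides G e = ∣-cong e (∣-* (∣-refl {P}) (prodDividing-∣ N ms css (pull ms cs hs)))
    where
    pull : ∀ {xs} → All IsMonic xs → All (Comax₂ (d , P)) xs → All (λ (d , P) → d ℕ.∣ N → P ∣ F) xs → All
      (λ (d , P) → d ℕ.∣ N → P ∣ G) xs
    pull []             []       []       = []
    pull ((_ , m) ∷ ms) (c ∷ cs) (h ∷ hs) = (λ d∣N → Comax-∣-cancel m c (∣-cong (≋-sym e) (h d∣N))) ∷ pull ms cs hs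

  prodDividing-++ : ∀ N xs ys → prodDividing N (xs ++ ys) ≋ prodDividing N xs *ᴾ prodDividing N ys
  prodDividing-++ N []             ys = ≋-sym (*-identityˡ _)
  prodDividing-++ N ((d , P) ∷ xs) ys with d ℕ.∣? N
  ... | yes _ = ≋-trans (*ᴾ-congʳ P (prodDividing-++ N xs ys)) (≋-sym (*-assoc P (prodDividing N xs) (prodDividing N
          ys)))
  ... | no  _ = prodDividing-++ N xs ys

  prodDividing-mono : ∀ {g e} → g ℕ.∣ e → ∀ xs → prodDividing g xs ∣ prodDividing e xs
  prodDividing-mono g∣e [] = ∣-refl
  prodDividing-mono {g} {e} g∣e ((d , P) ∷ xs) with d ℕ.∣? g | d ℕ.∣? e
  ... | yes _   | yes _   = ∣-* (∣-refl {P}) (prodDividing-mono g∣e xs)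
  ... | yes d∣g | no  d∤e = contradiction (ℕ.∣-trans d∣g g∣e) d∤e
  ... | no  _   | yes _   = ∣-*ʳ P (prodDividing-mono g∣e xs)
  ... | no  _   | no  _   = prodDividing-mono g∣e xs

  module Order (O : Ops) (Eq : Ops.A O → Ops.A O → Set) (L : Laws O Eq) where
    private module R = Ring O Eq L
    open R using () renaming (_≈_ to _≈′_; _^_ to _^′_; _*_ to _*′_)

    ^-multiple : ∀ {x a} → x ^′ a ≈′ R.1# → ∀ c → x ^′ (c ℕ.* a) ≈′ R.1#
    ^-multiple {x} {a} h zero    = R.refl
    ^-multiple {x} {a} h (suc c) = R.trans (R.^-+ x a (c ℕ.* a)) (R.trans (R.*-cong h (^-multiple {x} {a} h c))
      (R.*-identityˡ _))

    private
      reduce : ∀ x d {a b} → d ℕ.+ a ≡ b → x ^′ a ≈′ R.1# → x ^′ b ≈′ R.1# → x ^′ d ≈′ R.1#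
      reduce x d {a} {b} e h g = R.trans (R.sym (R.*-identityʳ _)) (R.trans (R.*-congˡ (R.sym h))
        (R.trans (R.sym (R.^-+ x d a)) (R.trans (R.^≡ x e) g)))

    -- Bézout's identity in ℕ reads g + v b = u a or its mirror image, so x^g times 1 equals 1 and
    -- no inverse of x is needed.
    ^-gcd : ∀ {x} a b → x ^′ a ≈′ R.1# → x ^′ b ≈′ R.1# → x ^′ ℕ.gcd a b ≈′ R.1#
    ^-gcd {x} a b h g with ℕ.Bézout.identity (ℕ.gcd-GCD a b)
    ... | ℕ.Bézout.+- u v e = reduce x (ℕ.gcd a b) e (^-multiple {x} {b} g v) (^-multiple {x} {a} h u)
    ... | ℕ.Bézout.-+ u v e = reduce x (ℕ.gcd a b) e (^-multiple {x} {a} h u) (^-multiple {x} {b} g v)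

    ∑-one : ∀ c → R.∑ c (λ _ → R.1#) ≈′ R.ι (+ c)
    ∑-one zero    = R.refl
    ∑-one (suc c) = R.trans (R.+-congˡ (∑-one c)) (R.sym (R.ι-+ 1ℤ (+ c)))

    []-one : ∀ {y} c → y ≈′ R.1# → R.[ c ]⟨ y ⟩ ≈′ R.ι (+ c)
    []-one c h = R.trans (R.∑-cong c (λ i _ → R.trans (R.^-cong i h) (one^ i))) (∑-one c)
      where
      one^ : ∀ i → R.1# ^′ i ≈′ R.1#
      one^ zero    = R.refl
      one^ (suc i) = R.trans (R.*-identityˡ _) (one^ i)

  X^-1-factor : ∀ e c → (X ^ e - 1#) *ᴾ [ c ]⟨ X ^ e ⟩ ≋ X ^ (c ℕ.* e) - 1#
  X^-1-factor e c = by₂ (- 1#) 1# (geometric c (X ^ e)) (^-^ X e c)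
    (solve 4 (λ y s z w → (y :- :1) :* s := w :- :1 :+ (:- :1) :* ((:1 :- y) :* s :- (:1 :- z)) :+ :1 :* (z :- w))
      ≋-refl
      (X ^ e) [ c ]⟨ X ^ e ⟩ ((X ^ e) ^ c) (X ^ (c ℕ.* e)))

  X^-1-∣ : ∀ {e n} → e ℕ.∣ n → (X ^ e - 1#) ∣ (X ^ n - 1#)
  X^-1-∣ {e} (ℕ.divides c ≡.refl) = divides [ c ]⟨ X ^ e ⟩ (X^-1-factor e c)

  record TwoGenerated (a b x : Poly) : Set where
    constructor combine
    field
      u v : Poly
      equality : a *ᴾ u +ᴾ b *ᴾ v ≋ x

  twoGenerated : ∀ a b → Ideal polyOps _≋_ polyLaws (TwoGenerated a b)
  twoGenerated a b = record
    { I-cong = λ { e (combine u v h) → combine u v (≋-trans h e) }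
    ; I-0 = combine 0# 0# (solve 2 (λ a b → a :* :0 :+ b :* :0 := :0) ≋-refl a b)
    ; I-+ = λ { (combine u v h) (combine u′ v′ h′) → combine (u +ᴾ u′) (v +ᴾ v′)
        (≋-trans (solve 6 (λ a b u v u′ v′ → a :* (u :+ u′) :+ b :* (v :+ v′) := (a :* u :+ b :* v) :+ (a :* u′ :+ b
          :* v′)) ≋-refl a b u v u′ v′) (+ᴾ-cong h h′)) }
    ; I-* = λ { c (combine u v h) → combine (c *ᴾ u) (c *ᴾ v)
        (≋-trans (solve 5 (λ a b c u v → a :* (c :* u) :+ b :* (c :* v) := c :* (a :* u :+ b :* v)) ≋-refl a b c u v)
          (*ᴾ-congʳ c h)) }
    }

  -- A statement about `Φ (suc e)`. The fields share one induction: the division defining a new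
  -- polynomial is exact because the earlier ones are comaximal, and comaximality of the new one
  -- uses its `factor`.
  record Cyclo (e : ℕ) : Set where
    field
      {deg}  : ℕ
      isMonic : Monic deg (Φ (suc e))
      factor : Φ (suc e) *ᴾ prodDividing (suc e) (cycs e) ≋ X ^ suc e - 1#
      comaximal : ∀ j → suc e ℕ.∤ j → Comax (Φ (suc e)) (1# - X ^ j)

  cycs-All : ∀ {Q : ℕ × Poly → Set} n → (∀ e → e < n → Q (suc e , Φ (suc e))) → All Q (cycs n)
  cycs-All zero    h = []
  cycs-All (suc n) h = All.++⁺ (cycs-All n (λ e e<n → h e (ℕ.m<n⇒m<1+n e<n))) (h n (ℕ.n<1+n n) ∷ [])

  cycs-AllPairs : ∀ {R : ℕ × Poly → ℕ × Poly → Set} n → (∀ a b → a < b → b < n → R (suc a , Φ (suc a))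
    (suc b , Φ (suc b))) → AllPairs R (cycs n)
  cycs-AllPairs zero    h = []
  cycs-AllPairs (suc n) h = AllPairs.++⁺ (cycs-AllPairs n (λ a b a<b b<n → h a b a<b (ℕ.m<n⇒m<1+n b<n))) ([] ∷ [])
    (cycs-All n (λ e e<n → h e n e<n (ℕ.n<1+n n) ∷ []))

  cycs-prefix : ∀ m k → ∃ λ ys → cycs (k ℕ.+ m) ≡ cycs m ++ ys
  cycs-prefix m zero    = [] , ≡.sym (List.++-identityʳ (cycs m))
  cycs-prefix m (suc k) with cycs-prefix m k
  ... | ys , e = ys ++ ((suc (k ℕ.+ m) , Φ (suc (k ℕ.+ m))) ∷ []) ,
    ≡.trans (≡.cong (_++ ((suc (k ℕ.+ m) , Φ (suc (k ℕ.+ m))) ∷ [])) e) (List.++-assoc (cycs m) ys _)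

  -- By induction X^(g+1) - 1 is itself the product of the Φ_d with d dividing g + 1, and all of
  -- these occur among the proper divisors of n + 1.
  X^g-1-∣-proper : ∀ {n} → (∀ e → e < n → Cyclo e) → ∀ g → suc g ℕ.∣ suc n → g < n → (X ^ suc g - 1#) ∣ prodDividing
    (suc n) (cycs n)
  X^g-1-∣-proper {n} ih g g∣n g<n with cycs-prefix (suc g) (n ∸ suc g)
  ... | ys , e = ≡.subst (λ l → (X ^ suc g - 1#) ∣ prodDividing (suc n) l) (≡.trans (≡.sym e) (≡.cong cycs
          (ℕ.m∸n+n≡m g<n)))
      (∣-trans below (∣-cong (≋-sym (prodDividing-++ (suc n) (cycs (suc g)) ys)) (divides (prodDividing (suc n) ys)
        ≋-refl)))
    where
    self : ∀ N P → prodDividing N ((N , P) ∷ []) ≋ P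
    self N P with N ℕ.∣? N
    ... | yes _ = *-identityʳ P
    ... | no N∤N = contradiction ℕ.∣-refl N∤N
    whole : X ^ suc g - 1# ≋ prodDividing (suc g) (cycs (suc g))
    whole = ≋-trans (≋-sym (Cyclo.factor (ih g g<n))) (≋-trans (*-comm (Φ (suc g)) (prodDividing (suc g) (cycs g)))
      (≋-sym (≋-trans (prodDividing-++ (suc g) (cycs g) _) (*ᴾ-congʳ (prodDividing (suc g) (cycs g)) (self (suc g)
        (Φ (suc g)))))))
    below : (X ^ suc g - 1#) ∣ prodDividing (suc n) (cycs (suc g))
    below = ∣-trans (divides 1# (≋-trans (*-identityʳ _) whole)) (prodDividing-mono g∣n (cycs (suc g)))

  private
    X^-1-neg : ∀ j → (X ^ j - 1#) ∣ (1# - X ^ j)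
    X^-1-neg j = divides (- 1#) (solve 1 (λ y → (y :- :1) :* (:- :1) := :1 :- y) ≋-refl (X ^ j))

  -- The exponent j is reduced to its gcd with n + 1 inside the quotient by (F, 1 - X^j): there X
  -- has trivial (n+1)-st and j-th powers, hence trivial gcd-th power, and the geometric sum becomes
  -- the integer h.
  Φ-comaximal : ∀ {n F} → (∀ g → suc g ℕ.∣ suc n → g < n → (X ^ suc g - 1#) ∣ prodDividing (suc n) (cycs n)) →
                F *ᴾ prodDividing (suc n) (cycs n) ≋ X ^ suc n - 1# →
                ∀ j → suc n ℕ.∤ j → Comax F (1# - X ^ j)
  Φ-comaximal {n} {F} proper factor j n∤j = go (ℕ.gcd (suc n) j) ≡.refl
    where
    P : Poly
    P = prodDividing (suc n) (cycs n)
    open Quotient polyOps _≋_ polyLaws (TwoGenerated F (1# - X ^ j)) (twoGenerated F (1# - X ^ j))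
    module Q = Ring polyOps _~_ laws
    open Order polyOps _~_ laws
    X^n≈1 : (X ^ suc n) ~ 1#
    X^n≈1 = mk~ (combine P 0# (≋-trans (solve 3 (λ F P y → F :* P :+ y :* :0 := F :* P) ≋-refl F P (1# - X ^ j))
      factor))
    X^j≈1 : (X ^ j) ~ 1#
    X^j≈1 = mk~ (combine 0# (- 1#) (solve 2 (λ F y → F :* :0 :+ (:1 :- y) :* (:- :1) := y :- :1) ≋-refl F (X ^ j)))
    go : ∀ g → ℕ.gcd (suc n) j ≡ g → Comax F (1# - X ^ j)
    go zero    e = contradiction e (ℕ.gcd[m,n]≢0 (suc n) j (inj₁ λ ()))
    go (suc g) e with ≡.subst (ℕ._∣ suc n) e (ℕ.gcd[m,n]∣m (suc n) j)
    ... | ℕ.divides h n≡h*g = comax h≢0 (TwoGenerated.u hIn) (TwoGenerated.v hIn) (≋-trans (TwoGenerated.equality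
            hIn) (solve 1 (λ x → x :- :0 := x) ≋-refl (constᴾ (+ h))))
      where
      g∣n : suc g ℕ.∣ suc n
      g∣n = ℕ.divides h n≡h*g
      g<n : g < n
      g<n = ℕ.≤-pred (ℕ.≤∧≢⇒< (ℕ.∣⇒≤ g∣n) λ { ≡.refl → n∤j (≡.subst (ℕ._∣ j) e (ℕ.gcd[m,n]∣n (suc n) j)) })
      h≢0 : + h ≢ 0ℤ
      h≢0 h≡0 with ≡.trans n≡h*g (≡.cong (ℕ._* suc g) (ℤ.+-injective h≡0))
      ... | ()
      open _∣_ (proper g g∣n g<n) renaming (quotient to Y; equality to P≋)
      -- With P = (X^(g+1) - 1) Y, both sides times X^(g+1) - 1 are equal to X^(n+1) - 1.
      [h]≋ : [ h ]⟨ X ^ suc g ⟩ ≋ F *ᴾ Y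
      [h]≋ = cancel {X ^ suc g - 1#} {[ h ]⟨ X ^ suc g ⟩} {F *ᴾ Y} (monic-regular (Monic-X^-1 g))
        (≋-trans (X^-1-factor (suc g) h) (≋-trans (reflexive (≡.cong (λ z → X ^ z - 1#) (≡.sym n≡h*g)))
        (by₂ (- 1#) (- F) factor P≋ (solve 5 (λ F P y Y n → n := y :* (F :* Y) :+ (:- :1) :* (F :* P :- n) :+ (:- F)
          :* (y :* Y :- P)) ≋-refl F P (X ^ suc g - 1#) Y (X ^ suc n - 1#)))))
      h≈0 : constᴾ (+ h) ~ 0#
      h≈0 = Q.trans (Q.sym ([]-one h (≡.subst (λ z → (X ^ z) ~ 1#) e (^-gcd {X} (suc n) j X^n≈1 X^j≈1))))
        (Q.trans (≈⇒~ [h]≋) (mk~ (combine Y 0# (solve 3 (λ F Y y → F :* Y :+ y :* :0 := F :* Y :- :0) ≋-refl F Y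
          (1# - X ^ j)))))
      hIn : TwoGenerated F (1# - X ^ j) (constᴾ (+ h) - 0#)
      hIn = _~[_]_.in-ideal h≈0

  cyclo-step : ∀ n → (∀ e → e < n → Cyclo e) → Cyclo n
  cyclo-step n ih = record
    { isMonic = proj₂ (Monic-quotient factor (proj₂ monicP) (Monic-X^-1 n))
    ; factor = factor
    ; comaximal = Φ-comaximal (X^g-1-∣-proper ih) factor
    }
    where
    P F : Poly
    P = prodDividing (suc n) (cycs n)
    F = X ^ suc n - 1#
    monics : All IsMonic (cycs n)
    monics = cycs-All n λ e e<n → _ , Cyclo.isMonic (ih e e<n)
    Φ-∣ : ∀ e → e < n → Φ (suc e) ∣ (X ^ suc e - 1#)
    Φ-∣ e e<n = divides (prodDividing (suc e) (cycs e)) (Cyclo.factor (ih e e<n))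
    pairs : AllPairs Comax₂ (cycs n)
    -- For a < b, Φ of index a + 1 divides 1 - X^(a+1), with which the later Φ is comaximal, since b
    -- + 1 exceeds a + 1 and cannot divide it.
    pairs = cycs-AllPairs n λ a b a<b b<n → Comax-sym (Comax-∣ (∣-trans (Φ-∣ a (ℕ.<-trans a<b b<n))
      (X^-1-neg (suc a)))
      (Cyclo.comaximal (ih b b<n) (suc a) (ℕ.>⇒∤ (s≤s a<b))))
    monicP : ∃ λ d → Monic d P
    monicP = prodDividing-Monic (suc n) monics
    P∣F : P ∣ F
    P∣F = prodDividing-∣ (suc n) monics pairs (cycs-All n λ e e<n e∣n → ∣-trans (Φ-∣ e e<n) (X^-1-∣ e∣n))
    qpow-1 : qpow (suc n) -ᴾ oneᴾ ≋ F
    qpow-1 = +ᴾ-cong (qpow≋ (suc n)) ≋-refl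
    factor : Φ (suc n) *ᴾ P ≋ F
    factor = ≋-trans (division-exact (proj₂ monicP) {qpow (suc n) -ᴾ oneᴾ} {_∣_.quotient P∣F}
      (≋-trans (*-comm _ P) (≋-trans (_∣_.equality P∣F) (≋-sym qpow-1)))) qpow-1

  cyclo : ∀ n → Cyclo n
  cyclo n = below (suc n) n (ℕ.n<1+n n)
    where
    below : ∀ n e → e < n → Cyclo e
    below (suc n) e (s≤s e≤n) = cyclo-step e (λ e′ e′<e → below n e′ (ℕ.<-≤-trans e′<e e≤n))

open Cyclotomic

-- Passing between fractions and polynomials.

module Fractions where
  open 𝒫

  -- f = p / u in ℚ(q)
  record Rep (u : Poly) (f : Frac) (p : Poly) : Set where
    constructor rep
    field cleared : u *ᴾ num f ≋ den f *ᴾ p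

  Rep-+ : ∀ {u f g p r} → Rep u f p → Rep u g r → Rep u (f +ᶠ g) (p +ᴾ r)
  Rep-+ {u} {a /ᶠ b} {c /ᶠ d} {p} {r} (rep h) (rep k) = rep (by₂ d b h k
    (solve 7 (λ u a b c d p r → u :* (a :* d :+ c :* b) := (b :* d) :* (p :+ r) :+ d :* (u :* a :- b :* p) :+ b :*
      (u :* c :- d :* r)) ≋-refl u a b c d p r))

  Rep-- : ∀ {u f g p r} → Rep u f p → Rep u g r → Rep u (f -ᶠ g) (p -ᴾ r)
  Rep-- {u} {a /ᶠ b} {c /ᶠ d} {p} {r} (rep h) (rep k) = rep (by₂ d (- b) h k
    (solve 7 (λ u a b c d p r → u :* (a :* d :- c :* b) := (b :* d) :* (p :- r) :+ d :* (u :* a :- b :* p) :+ (:- b)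
      :* (u :* c :- d :* r)) ≋-refl u a b c d p r))

  -- Only one of the two factors may carry the multiplier u, as otherwise the product would carry
  -- u².
  Rep-* : ∀ {u f g p r} → Rep 1# f p → Rep u g r → Rep u (f *ᶠ g) (p *ᴾ r)
  Rep-* {u} {a /ᶠ b} {c /ᶠ d} {p} {r} (rep h) (rep k) = rep (by₂ (u *ᴾ c) (b *ᴾ p) h k
    (solve 7 (λ u a b c d p r → u :* (a :* c) := (b :* d) :* (p :* r) :+ (u :* c) :* (:1 :* a :- b :* p) :+ (b :* p)
      :* (u :* c :- d :* r)) ≋-refl u a b c d p r))

  Rep-cong : ∀ {u f p r} → p ≋ r → Rep u f p → Rep u f r
  Rep-cong {u} {f} e (rep h) = rep (≋-trans h (*ᴾ-congʳ (den f) e))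

  Rep-lift : ∀ u {f p} → Rep 1# f p → Rep u f (u *ᴾ p)
  Rep-lift u {a /ᶠ b} {p} (rep h) = rep (by₁ u h (solve 4 (λ u a b p → u :* a := b :* (u :* p) :+ u :* (:1 :* a :- b
    :* p)) ≋-refl u a b p))

  Rep-poly : ∀ p → Rep 1# (polyᶠ p) p
  Rep-poly p = rep ≋-refl

  sumᴾ : List Poly → Poly
  sumᴾ = foldr _+ᴾ_ 0#

  Rep-sum : ∀ {f : ℕ → Frac} {t : ℕ → Poly} xs → All (λ k → Rep 1# (f k) (t k)) xs → Rep 1# (sumᶠ (map f xs))
    (sumᴾ (map t xs))
  Rep-sum []       []       = Rep-poly 0#
  Rep-sum (x ∷ xs) (h ∷ hs) = Rep-+ h (Rep-sum xs hs)

  sumᴾ-∷ʳ : ∀ ps p → sumᴾ (ps ++ p ∷ []) ≋ sumᴾ ps +ᴾ p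
  sumᴾ-∷ʳ []       p = +-comm p 0#
  sumᴾ-∷ʳ (r ∷ ps) p = ≋-trans (+ᴾ-cong (≋-refl {r}) (sumᴾ-∷ʳ ps p)) (≋-sym (+-assoc r (sumᴾ ps) p))

  sumᴾ-upTo : ∀ (t : ℕ → Poly) N → sumᴾ (map t (upTo N)) ≋ ∑ (suc N) t
  sumᴾ-upTo t zero    = ≋-refl
  sumᴾ-upTo t (suc N) = ≋-trans (reflexive (cong sumᴾ (List.map-++ t (upTo N) (suc N ∷ []))))
    (≋-trans (sumᴾ-∷ʳ (map t (upTo N)) (t (suc N))) (≋-trans (+ᴾ-cong (sumᴾ-upTo t N) (≋-refl {t (suc N)}))
      (≋-sym (∑-last (suc N) t))))

  upTo-≤ : ∀ N → All (_≤ N) (upTo N)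
  upTo-≤ zero    = z≤n ∷ []
  upTo-≤ (suc N) = All.++⁺ (All.map ℕ.m≤n⇒m≤1+n (upTo-≤ N)) (ℕ.≤-refl ∷ [])

  Rep-∑ : ∀ {f : ℕ → Frac} {t : ℕ → Poly} N → (∀ k → k ≤ N → Rep 1# (f k) (t k)) → Rep 1# (sumᶠ (map f (upTo N)))
    (∑ (suc N) t)
  Rep-∑ {f} {t} N h = Rep-cong (sumᴾ-upTo t N) (Rep-sum (upTo N) (All.map (h _) (upTo-≤ N)))

  module _ (d : ℕ) (y : Poly) (qpow-y : ∀ k → qpow (d ℕ.* k) ≋ y ^ k) where

    numProd≋ : ∀ a b → numProd d a b ≋ ∏ b (λ i → 1# - y ^ (a ∸ i))
    numProd≋ a zero    = ≋-refl
    numProd≋ a (suc b) = ≋-trans (*ᴾ-cong (numProd≋ a b) (+ᴾ-cong (≋-refl {oneᴾ}) (negᴾ-cong (qpow-y (a ∸ b)))))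
      (≋-sym (∏-last b (λ i → 1# - y ^ (a ∸ i))))

    denProd≋ : ∀ b → denProd d b ≋ ∏ b (λ i → 1# - y ^ suc i)
    denProd≋ zero    = ≋-refl
    denProd≋ (suc b) = ≋-trans (*ᴾ-cong (denProd≋ b) (+ᴾ-cong (≋-refl {oneᴾ}) (negᴾ-cong (qpow-y (suc b)))))
      (≋-sym (∏-last b (λ i → 1# - y ^ suc i)))

    Rep-qbin : ∀ a b → Rep 1# (qbin d (+ a) (+ b)) (gauss y a b)
    Rep-qbin a b with b ℕ.≤ᵇ a in eq
    ... | true  = rep (≋-trans (*-identityˡ (numProd d a b)) (≋-trans (numProd≋ a b) (≋-trans (≋-sym (gauss-∏ y a b))
            (*ᴾ-cong (≋-sym (denProd≋ b)) ≋-refl))))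
    ... | false = Rep-cong (≋-sym (gauss-zero y {a} {b} (ℕ.≰⇒> λ b≤a → ≡.subst T eq (ℕ.≤⇒≤ᵇ b≤a)))) (Rep-poly 0#)

  qpow-X : ∀ k → qpow (1 ℕ.* k) ≋ X ^ k
  qpow-X k = ≋-trans (qpow≋ (1 ℕ.* k)) (^≡ X (ℕ.*-identityˡ k))

  qpow-X² : ∀ k → qpow (2 ℕ.* k) ≋ (X ^ 2) ^ k
  qpow-X² k = ≋-trans (qpow≋ (2 ℕ.* k)) (≋-trans (^≡ X (ℕ.*-comm 2 k)) (≋-sym (^-^ X 2 k)))

  -- The exponents in 𝓑ₙ are at least -1, a value reached for n = 2 and n = 3; so they are written
  -- as e - 1 with e natural, and multiplying by X gives X^e.
  half-double : ∀ e {z} → z ≡ (+ e ℤ.- 1ℤ) ℤ.* + 2 → half z ≡ + e ℤ.- 1ℤ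
  half-double zero    ≡.refl = ≡.refl
  half-double (suc e) ≡.refl = ≡.trans (cong half (≡.sym (ℤ.pos-* e 2))) (≡.trans (ℤ.*-identityˡ (+ (e ℕ.* 2 ℕ./ 2)))
    (cong +_ (ℕ.m*n/n≡m e 2)))

  Rep-qpow : ∀ e {z} → z ≡ + e ℤ.- 1ℤ → Rep X (qpowᶠ z) (X ^ e)
  Rep-qpow zero    ≡.refl = rep ≋-refl
  Rep-qpow (suc e) ≡.refl = rep (≋-trans (*ᴾ-congʳ X (qpow≋ e)) (≋-sym (*-identityˡ (X ^ suc e))))

  open Pentagonal polyOps _≋_ polyLaws X

  2*pent₀ : ∀ r → + 2 ℤ.* + pent₀ r ≡ + r ℤ.* (+ 3 ℤ.* + r ℤ.- 1ℤ)
  2*pent₀ zero    = ≡.refl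
  2*pent₀ (suc r) = ≡.trans (cong (+ 2 ℤ.*_) (≡.trans (ℤ.pos-+ (1 ℕ.+ r ℕ.* 3) (pent₀ r)) (cong (λ z → + 1 ℤ.+ z ℤ.+
    + pent₀ r) (ℤ.pos-* r 3))))
    (≡.trans (split (+ r) (+ pent₀ r)) (≡.trans (cong (λ z → z ℤ.+ (+ 2 ℤ.+ + 6 ℤ.* + r)) (2*pent₀ r)) (merge (+ r))))
    where
    split : ∀ r p → + 2 ℤ.* (+ 1 ℤ.+ r ℤ.* + 3 ℤ.+ p) ≡ + 2 ℤ.* p ℤ.+ (+ 2 ℤ.+ + 6 ℤ.* r)
    split = ℤ-Solver.solve-∀
    merge : ∀ r → r ℤ.* (+ 3 ℤ.* r ℤ.- 1ℤ) ℤ.+ (+ 2 ℤ.+ + 6 ℤ.* r) ≡ (1ℤ ℤ.+ r) ℤ.* (+ 3 ℤ.* (1ℤ ℤ.+ r) ℤ.- 1ℤ)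
    merge = ℤ-Solver.solve-∀

  pent₁≡ : ∀ r → pent₁ r ≡ pent₀ r ℕ.+ r
  pent₁≡ zero    = ≡.refl
  pent₁≡ (suc r) = ≡.trans (cong ((2 ℕ.+ r ℕ.* 3) ℕ.+_) (pent₁≡ r)) (rearrange r (pent₀ r))
    where
    rearrange : ∀ r p → (2 ℕ.+ r ℕ.* 3) ℕ.+ (p ℕ.+ r) ≡ ((1 ℕ.+ r ℕ.* 3) ℕ.+ p) ℕ.+ suc r
    rearrange = ℕ-Solver.solve-∀

  +pent₁ : ∀ r → + pent₁ r ≡ + pent₀ r ℤ.+ + r
  +pent₁ r = cong +_ (pent₁≡ r)

  -- This is q 𝓑ₙ for n = n′ + 1. For n = 1 the truncated index `n′ ∸ 1` does no harm, as the sum is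
  -- empty.
  pent-sum : ℕ → Poly
  pent-sum n′ = X +ᴾ ∑ n′ (βTerm (n′ ∸ 1))

  private
    +3r : ∀ r → + (3 ℕ.* r) ≡ + 3 ℤ.* + r
    +3r = ℤ.pos-* 3

  -- In q α(n) - α(n-2) the values of α at indices congruent to 2 modulo 3 vanish. So one term
  -- survives for n = 3r + 1 and for n = 3r + 2, while for n = 3r both do, and their exponents
  -- differ by 2r, whence 1 + q^(2r).
  Rep-𝓑′ : ∀ (i : Fin 3) r n′ → suc n′ ≡ toℕ i ℕ.+ r ℕ.* 3 → Rep X (𝓑′ r i) (pent-sum n′)
  Rep-𝓑′ zero (suc r) n′ ≡.refl =
    Rep-cong eq (Rep-* (Rep-* (Rep-poly (constᴾ (sgn (suc r)))) (Rep-poly (oneᴾ +ᴾ qpow (2 ℕ.* suc r))))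
      (Rep-qpow (pent₁ r) (half-double (pent₁ r) index)))
    where
    index : + suc r ℤ.* (+ (3 ℕ.* suc r) ℤ.- + 5) ≡ (+ pent₁ r ℤ.- 1ℤ) ℤ.* + 2
    index = ≡.trans (cong (λ z → + suc r ℤ.* (z ℤ.- + 5)) (+3r (suc r)))
      (≡.trans (lhs (+ r)) (≡.trans (cong (λ z → z ℤ.+ (+ 2 ℤ.* + r ℤ.- + 2)) (≡.sym (2*pent₀ r)))
      (≡.trans (rhs (+ r) (+ pent₀ r)) (cong (λ z → (z ℤ.- 1ℤ) ℤ.* + 2) (≡.sym (+pent₁ r))))))
      where
      lhs : ∀ r → (1ℤ ℤ.+ r) ℤ.* (+ 3 ℤ.* (1ℤ ℤ.+ r) ℤ.- + 5) ≡ r ℤ.* (+ 3 ℤ.* r ℤ.- 1ℤ) ℤ.+ (+ 2 ℤ.* r ℤ.- + 2)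
      lhs = ℤ-Solver.solve-∀
      rhs : ∀ r p → + 2 ℤ.* p ℤ.+ (+ 2 ℤ.* r ℤ.- + 2) ≡ (p ℤ.+ r ℤ.- 1ℤ) ℤ.* + 2
      rhs = ℤ-Solver.solve-∀
    exponent : suc (pent₀ (suc r)) ≡ 2 ℕ.* suc r ℕ.+ pent₁ r
    exponent = ≡.trans (expand r (pent₀ r)) (cong (2 ℕ.* suc r ℕ.+_) (≡.sym (pent₁≡ r)))
      where
      expand : ∀ r p → suc ((1 ℕ.+ r ℕ.* 3) ℕ.+ p) ≡ 2 ℕ.* suc r ℕ.+ (p ℕ.+ r)
      expand = ℕ-Solver.solve-∀
    power : X *ᴾ X ^ pent₀ (suc r) ≋ qpow (2 ℕ.* suc r) *ᴾ X ^ pent₁ r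
    power = ≋-trans (^≡ X {suc (pent₀ (suc r))} exponent) (≋-trans (^-+ X (2 ℕ.* suc r) (pent₁ r))
      (*ᴾ-cong (≋-sym (qpow≋ (2 ℕ.* suc r))) ≋-refl))
    eq : constᴾ (sgn (suc r)) *ᴾ (oneᴾ +ᴾ qpow (2 ℕ.* suc r)) *ᴾ X ^ pent₁ r ≋ pent-sum (2 ℕ.+ r ℕ.* 3)
    eq = ≋-sym (≋-trans (∑-βTerm (1 ℕ.+ r ℕ.* 3)) (≋-trans (+ᴾ-cong (*ᴾ-congʳ X (α-3r (suc r)))
      (negᴾ-cong (α-3r+1 r)))
      (by₂ (ι (sgn (suc r))) (X ^ pent₁ r *ᴾ (- 1#)) power (ι-sgn r)
        (solve 6 (λ X a s t w z → X :* (s :* a) :- t :* z := s :* (:1 :+ w) :* z :+ s :* (X :* a :- w :* z) :+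
          (z :* (:- :1)) :* (s :- (:- t))) ≋-refl
          X (X ^ pent₀ (suc r)) (ι (sgn (suc r))) (ι (sgn r)) (qpow (2 ℕ.* suc r)) (X ^ pent₁ r)))))
  Rep-𝓑′ (suc zero) r n′ e =
    Rep-cong (eq r n′ e) (Rep-* (Rep-poly (constᴾ (sgn r))) (Rep-qpow (suc (pent₁ r)) (half-double (suc (pent₁ r))
      index)))
    where
    index : + r ℤ.* + (3 ℕ.* r ℕ.+ 1) ≡ + pent₁ r ℤ.* + 2
    index = ≡.trans (cong (λ z → + r ℤ.* (z ℤ.+ 1ℤ)) (+3r r)) (≡.trans (lhs (+ r))
      (≡.trans (cong (λ z → z ℤ.+ + 2 ℤ.* + r) (≡.sym (2*pent₀ r)))
      (≡.trans (rhs (+ r) (+ pent₀ r)) (cong (λ z → z ℤ.* + 2) (≡.sym (+pent₁ r))))))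
      where
      lhs : ∀ r → r ℤ.* (+ 3 ℤ.* r ℤ.+ 1ℤ) ≡ r ℤ.* (+ 3 ℤ.* r ℤ.- 1ℤ) ℤ.+ + 2 ℤ.* r
      lhs = ℤ-Solver.solve-∀
      rhs : ∀ r p → + 2 ℤ.* p ℤ.+ + 2 ℤ.* r ≡ (p ℤ.+ r) ℤ.* + 2
      rhs = ℤ-Solver.solve-∀
    eq : ∀ r n′ → suc n′ ≡ 1 ℕ.+ r ℕ.* 3 → constᴾ (sgn r) *ᴾ X ^ suc (pent₁ r) ≋ pent-sum n′
    -- For n = 1 there is no α(n-2), so `∑-βTerm` does not apply.
    eq zero    n′ ≡.refl = solve 1 (λ x → :1 :* (x :* :1) := x :+ :0) ≋-refl X
    eq (suc r) n′ ≡.refl = ≋-sym (≋-trans (∑-βTerm (2 ℕ.+ r ℕ.* 3)) (≋-trans (+ᴾ-cong (*ᴾ-congʳ X (α-3r+1 (suc r)))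
      (negᴾ-cong (α-3r+2 r)))
      (solve 3 (λ x s z → x :* (s :* z) :- :0 := s :* (x :* z)) ≋-refl X (ι (sgn (suc r))) (X ^ pent₁ (suc r)))))
  Rep-𝓑′ (suc (suc zero)) r n′ ≡.refl =
    Rep-cong eq (Rep-* (Rep-poly (constᴾ (sgn (suc r)))) (Rep-qpow (pent₀ r) (half-double (pent₀ r) index)))
    where
    index : (+ r ℤ.- + 1) ℤ.* + (3 ℕ.* r ℕ.+ 2) ≡ (+ pent₀ r ℤ.- 1ℤ) ℤ.* + 2
    index = ≡.trans (cong (λ z → (+ r ℤ.- + 1) ℤ.* (z ℤ.+ + 2)) (+3r r)) (≡.trans (lhs (+ r))
      (≡.trans (cong (ℤ._- + 2) (≡.sym (2*pent₀ r))) (rhs (+ pent₀ r))))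
      where
      lhs : ∀ r → (r ℤ.- + 1) ℤ.* (+ 3 ℤ.* r ℤ.+ + 2) ≡ r ℤ.* (+ 3 ℤ.* r ℤ.- 1ℤ) ℤ.- + 2
      lhs = ℤ-Solver.solve-∀
      rhs : ∀ p → + 2 ℤ.* p ℤ.- + 2 ≡ (p ℤ.- 1ℤ) ℤ.* + 2
      rhs = ℤ-Solver.solve-∀
    eq : constᴾ (sgn (suc r)) *ᴾ X ^ pent₀ r ≋ pent-sum (1 ℕ.+ r ℕ.* 3)
    eq = ≋-sym (≋-trans (∑-βTerm (r ℕ.* 3)) (≋-trans (+ᴾ-cong (*ᴾ-congʳ X (α-3r+2 r)) (negᴾ-cong (α-3r r)))
      (by₁ (- X ^ pent₀ r) (ι-sgn r) (solve 4 (λ x s t z → x :* :0 :- t :* z := s :* z :+ (:- z) :* (s :- (:- t)))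
        ≋-refl X (ι (sgn (suc r))) (ι (sgn r)) (X ^ pent₀ r)))))

  Rep-𝓑 : ∀ n′ → Rep X (𝓑 (suc n′)) (pent-sum n′)
  Rep-𝓑 n′ = Rep-𝓑′ (suc n′ ℕ.mod 3) (suc n′ ℕ./ 3) n′ (ℕ.DivMod.property (suc n′ ℕ.divMod 3))

open Fractions

-- The congruence modulo the square of Φₙ.

module Congruence where
  open 𝒫

  principal : ∀ p → Ideal polyOps _≋_ polyLaws (p ∣_)
  principal p = record
    { I-cong = ∣-cong
    ; I-0 = divides 0# (zeroʳ p)
    ; I-+ = λ { (divides u h) (divides v k) → divides (u +ᴾ v) (≋-trans (*ᴾ-distribˡ p u v) (+ᴾ-cong h k)) }
    ; I-* = λ c → ∣-*ʳ c
    }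

  gauss-exact : ∀ x → (∀ s → Regular (1# - x ^ suc s)) → ∀ s b →
    gauss x (suc b ℕ.* suc s) (suc s) ≋ [ suc b ]⟨ x ^ suc s ⟩ *ᴾ gauss x (s ℕ.+ b ℕ.* suc s) s
  gauss-exact x reg s b = cancel {1# - x ^ suc s} (reg s) (by₃ 1# (- g) g (gauss-suc-suc x (s ℕ.+ b ℕ.* suc s) s)
    (geometric (suc b) (x ^ suc s)) (^-^ x (suc s) (suc b))
    (solve 6 (λ r G g S y z → r :* G := r :* (S :* g) :+ :1 :* (r :* G :- (:1 :- z) :* g) :+ (:- g) :*
      (r :* S :- (:1 :- y)) :+ g :* (y :- z)) ≋-refl
      (1# - x ^ suc s) (gauss x (suc b ℕ.* suc s) (suc s)) g [ suc b ]⟨ x ^ suc s ⟩ ((x ^ suc s) ^ suc b)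
        (x ^ (suc b ℕ.* suc s))))
    where
    g : Poly
    g = gauss x (s ℕ.+ b ℕ.* suc s) s

  gauss-exact-next : ∀ x → (∀ s → Regular (1# - x ^ suc s)) → ∀ s b →
    gauss x (s ℕ.+ b ℕ.* suc s) (suc s) ≋ [ b ]⟨ x ^ suc s ⟩ *ᴾ gauss x (s ℕ.+ b ℕ.* suc s) s
  gauss-exact-next x reg s b = cancel {1# - x ^ suc s} (reg s) (by₃ 1# (- g) g
      (≡.subst (λ z → (1# - x ^ suc s) *ᴾ gauss x N (suc s) ≋ (1# - x ^ z) *ᴾ g) (ℕ.m+n∸m≡n s (b ℕ.* suc s))
        (gauss-sucʳ x N s))
      (geometric b (x ^ suc s)) (^-^ x (suc s) b)
    (solve 6 (λ r G g S y z → r :* G := r :* (S :* g) :+ :1 :* (r :* G :- (:1 :- z) :* g) :+ (:- g) :*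
      (r :* S :- (:1 :- y)) :+ g :* (y :- z)) ≋-refl
      (1# - x ^ suc s) (gauss x N (suc s)) g [ b ]⟨ x ^ suc s ⟩ ((x ^ suc s) ^ b) (x ^ (b ℕ.* suc s))))
    where
    N : ℕ
    N = s ℕ.+ b ℕ.* suc s
    g : Poly
    g = gauss x N s

  X-regular : ∀ s → Regular (1# - X ^ suc s)
  X-regular s y h = monic-regular (Monic-X^-1 s) y (by₁ (- 1#) h
    (solve 2 (λ x y → (x :- :1) :* y := :0 :+ (:- :1) :* ((:1 :- x) :* y :- :0)) ≋-refl (X ^ suc s) y))

  X²-regular : ∀ s → Regular (1# - (X ^ 2) ^ suc s)
  X²-regular s = Regular-cong (+ᴾ-cong (≋-refl {1#}) (negᴾ-cong (≋-sym (^-^ X 2 (suc s)))))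
    (X-regular (suc (s ℕ.* 2)))

  parity : ∀ n → (∃ λ h → n ≡ 2 ℕ.* h) ⊎ (∃ λ h → n ≡ suc (2 ℕ.* h))
  parity zero = inj₁ (0 , ≡.refl)
  parity (suc n) with parity n
  ... | inj₁ (h , e) = inj₂ (h , cong suc e)
  ... | inj₂ (h , e) = inj₁ (suc h , cong suc (≡.trans e (≡.sym (ℕ.+-suc h (h ℕ.+ 0)))))

  sgn-even : ∀ h → sgn (2 ℕ.* h) ≡ 1ℤ
  sgn-even zero    = ≡.refl
  sgn-even (suc h) = ≡.trans (cong (λ z → sgn (suc z)) (ℕ.+-suc h (h ℕ.+ 0))) (≡.trans (ℤ.neg-involutive
    (sgn (2 ℕ.* h))) (sgn-even h))

  module Theorem (m′ n′ : ℕ) where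
    F FF P : Poly
    F  = Φ (suc n′)
    FF = F *ᴾ F
    P  = prodDividing (suc n′) (cycs n′)

    factor : F *ᴾ P ≋ X ^ suc n′ - 1#
    factor = Cyclo.factor (cyclo n′)

    FF-monic : Monic _ FF
    FF-monic = Monic-* (Cyclo.isMonic (cyclo n′)) (Cyclo.isMonic (cyclo n′))

    open Quotient polyOps _≋_ polyLaws (FF ∣_) (principal FF)
    module 𝒬 = Ring polyOps _~_ laws
    open Middle polyOps _~_ laws X n′ m′
    open Nilpotent polyOps _~_ laws using (nat)
    open _~[_]_ using (in-ideal)

    ~0 : ∀ {x} → FF ∣ x → x ~ 0#
    ~0 {x} h = mk~ (∣-cong (solve 1 (λ x → x := x :- :0) ≋-refl x) h)

    0~ : ∀ {x} → x ~ 0# → FF ∣ x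
    0~ {x} (mk~ h) = ∣-cong (solve 1 (λ x → x :- :0 := x) ≋-refl x) h

    ε² : (ε *ᴾ ε) ~ 0#
    ε² = ~0 (divides (P *ᴾ P) (by₁ (F *ᴾ P +ᴾ (X ^ suc n′ - 1#)) factor
      (solve 3 (λ F P y → (F :* F) :* (P :* P) := (:1 :- y) :* (:1 :- y) :+ (F :* P :+ (y :- :1)) :*
        (F :* P :- (y :- :1))) ≋-refl F P (X ^ suc n′))))

    constant-regular : ∀ {c} → c ≢ 0ℤ → 𝒬.Regular (constᴾ c)
    constant-regular c≢0 y h = ~0 (monic-∣-scale FF-monic c≢0 (0~ h))

    reg : ∀ j → suc n′ ℕ.∤ j → 𝒬.Regular (1# - X ^ j)
    reg j n∤j y h = go (Cyclo.comaximal (cyclo n′) j n∤j) (0~ h)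
      where
      go : Comax F (1# - X ^ j) → FF ∣ ((1# - X ^ j) *ᴾ y) → y ~ 0#
      -- Comaximality with F is raised to F²: c² = (F u)² + (c - F u)(c + F u), and c - F u = (1 -
      -- X^j) v. As (1 - X^j) y is a multiple of F², so is c² y, and c is cancelled twice.
      go (comax {c} c≢0 u v e) (divides w k) = constant-regular c≢0 y (constant-regular c≢0 (constᴾ c *ᴾ y) (~0
        (divides (u *ᴾ u *ᴾ y +ᴾ w *ᴾ (v *ᴾ (constᴾ c +ᴾ F *ᴾ u))) (by₂ (v *ᴾ (constᴾ c +ᴾ F *ᴾ u))
          (y *ᴾ (constᴾ c +ᴾ F *ᴾ u)) k e
          (solve 7 (λ F u v w y c r → (F :* F) :* (u :* u :* y :+ w :* (v :* (c :+ F :* u))) := c :* (c :* y)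
              :+ (v :* (c :+ F :* u)) :* ((F :* F) :* w :- r :* y) :+ (y :* (c :+ F :* u)) :* (F :* u :+ r :* v :-
                c)) ≋-refl
            F u v w y (constᴾ c) (1# - X ^ j))))))

    open Hyp ε² reg

    two : 𝒬.Regular (nat 2)
    two = constant-regular {+ 2} λ ()

    exact-q : Exact X
    exact-q s b = ≈⇒~ (gauss-exact X X-regular s b)

    exact-p : Exact p
    exact-p s b = ≈⇒~ (gauss-exact p X²-regular s b)

    next-p : ExactNext p
    next-p s b = ≈⇒~ (gauss-exact-next p X²-regular s b)

    open Total two exact-q exact-p next-p

    c : ℤ
    c = (1ℤ ℤ.+ sgn n) ℤ.* (+ m ℤ.- 1ℤ) ℤ.+ 1ℤ

    ∑β : Poly
    ∑β = ∑ n′ (Pentagonal.βTerm polyOps _~_ laws X (n′ ∸ 1))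

    congruence : (X *ᴾ ∑ (suc n) tTerm) ~ (X *ᴾ (nat 2 *ᴾ nat m - nat n *ᴾ nat m *ᴾ (nat 2 *ᴾ nat m - 1#) *ᴾ ε)
                  +ᴾ ι (sgn n) *ᴾ ι c *ᴾ (X *ᴾ (nat m *ᴾ X ^ n - nat n *ᴾ nat m *ᴾ (nat m - 1#) *ᴾ ε) +ᴾ nat 2 *ᴾ nat
                    m *ᴾ ∑β))
    congruence with parity n
    ... | inj₂ (h , e) = total (ι c) (𝒬.trans (proj₁ facts) (𝒬.*-congʳ (𝒬.reflexive ι1≡))) (𝒬.trans (proj₂ facts)
            (𝒬.*-congʳ (𝒬.reflexive ι1≡)))
            (λ k e′ → contradiction (≡.trans (cong (k ℕ.+_) (ℕ.+-identityʳ k)) (≡.trans (≡.sym e′) e)) (ℕ.even≢odd k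
              h))
      where
      ι1≡ : 1# ≡ ι c
      ι1≡ = cong ι (≡.sym (≡.trans (cong (λ z → (1ℤ ℤ.+ z) ℤ.* (+ m ℤ.- 1ℤ) ℤ.+ 1ℤ) (≡.trans (cong sgn e)
        (cong ℤ.-_ (sgn-even h))))
        (cong (ℤ._+ 1ℤ) (ℤ.*-zeroˡ (+ m ℤ.- 1ℤ)))))
      n∤2k : ∀ k → 0 < k → k < n → n ℕ.∤ 2 ℕ.* k
      n∤2k (suc k) 0<k k<n (ℕ.divides zero ())
      n∤2k k 0<k k<n (ℕ.divides (suc zero) e′)    = ℕ.even≢odd k h (≡.trans e′ (≡.trans (ℕ.*-identityˡ n) e))
      n∤2k k 0<k k<n (ℕ.divides (suc (suc x)) e′) = ℕ.<⇒≱ (ℕ.*-monoʳ-< 2 k<n) (≡.subst (2 ℕ.* n ≤_) (≡.sym e′)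
        (ℕ.*-monoˡ-≤ n {2} {suc (suc x)} (s≤s (s≤s z≤n))))
      facts = odd n∤2k
    ... | inj₁ (zero , ())
    ... | inj₁ (suc h , e) = total (ι c) (𝒬.trans (proj₁ facts) (𝒬.*-congʳ (𝒬.sym C≈))) (𝒬.trans (proj₂ facts)
            (𝒬.*-congʳ (𝒬.sym C≈))) (λ _ _ → C≈)
      where
      c≡ : c ≡ + 2 ℤ.* + m ℤ.- 1ℤ
      c≡ = ≡.trans (cong (λ z → (1ℤ ℤ.+ z) ℤ.* (+ m ℤ.- 1ℤ) ℤ.+ 1ℤ) (≡.trans (cong sgn e) (sgn-even (suc h))))
        (expand (+ m))
        where
        expand : ∀ m → + 2 ℤ.* (m ℤ.- 1ℤ) ℤ.+ 1ℤ ≡ + 2 ℤ.* m ℤ.- 1ℤ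
        expand = ℤ-Solver.solve-∀
      C≈ : ι c ~ (nat 2 *ᴾ nat m - 1#)
      C≈ = ≈⇒~ (≋-trans (reflexive (cong ι c≡)) (+ᴾ-cong (ι-* (+ 2) (+ m)) (≋-refl {negᴾ 1#})))
      facts = even h e

    -- For k > n the lower index n - k is negative and the term of T₁ is zero, whereas in `tTerm k`
    -- the index `n ∸ k` is 0 and the coefficient is 1.
    truncated : ℕ → Poly
    truncated k with k ℕ.≤? n
    ... | yes _ = tTerm k
    ... | no  _ = 0#

    ∑-truncated : ∑ (suc (m ℕ.* n)) truncated ≋ ∑ (suc n) tTerm
    ∑-truncated = ≋-trans (∑-split (suc n) (m′ ℕ.* n) truncated) (≋-trans (+ᴾ-cong (∑-cong (suc n) inside)
        (≋-trans (∑-cong (m′ ℕ.* n) (λ i _ → outside i)) (∑-zero (m′ ℕ.* n)))) (+-identityʳ (∑ (suc n) tTerm)))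
      where
      inside : ∀ k → k < suc n → truncated k ≋ tTerm k
      inside k k≤n with k ℕ.≤? n
      ... | yes _ = ≋-refl
      ... | no k≰n = contradiction (ℕ.≤-pred k≤n) k≰n
      outside : ∀ i → truncated (suc n ℕ.+ i) ≋ 0#
      outside i with suc n ℕ.+ i ℕ.≤? n
      ... | yes h = contradiction h (ℕ.<⇒≱ (ℕ.m≤m+n (suc n) i))
      ... | no _ = ≋-refl

    top-index : ∀ k → k ≤ m ℕ.* n → + (2 ℕ.* (m ℕ.* n)) ℤ.- + (2 ℕ.* k) ≡ + (2 ℕ.* (m ℕ.* n) ∸ 2 ℕ.* k)
    top-index k k≤N = ≡.trans (ℤ.m-n≡m⊖n (2 ℕ.* (m ℕ.* n)) (2 ℕ.* k)) (ℤ.⊖-≥ (ℕ.*-monoʳ-≤ 2 k≤N))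

    bottom-index : ∀ k → + (m ℕ.* n) ℤ.- (+ m ℤ.- + 1) ℤ.* + n ℤ.- + k ≡ n ℤ.⊖ k
    bottom-index k = ≡.trans (cong (λ z → z ℤ.- (+ m ℤ.- + 1) ℤ.* + n ℤ.- + k) (ℤ.pos-* m n))
      (≡.trans (simplify (+ m) (+ n) (+ k)) (ℤ.m-n≡m⊖n n k))
      where
      simplify : ∀ m n k → m ℤ.* n ℤ.- (m ℤ.- + 1) ℤ.* n ℤ.- k ≡ n ℤ.- k
      simplify = ℤ-Solver.solve-∀

    Rep-term : ∀ k → k ≤ m ℕ.* n → Rep 1# ((constᶠ (sgn k) *ᶠ qpowᶠ (+ k)) *ᶠ qbin 2 (+ (m ℕ.* n)) (+ k)
      *ᶠ qbin 1 (+ (2 ℕ.* (m ℕ.* n)) ℤ.- + (2 ℕ.* k)) (+ (m ℕ.* n) ℤ.- (+ m ℤ.- + 1) ℤ.* + n ℤ.- + k)) (truncated k)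
    Rep-term k k≤N with k ℕ.≤? n
    ... | yes k≤n = Rep-* prefix (≡.subst₂ (λ a b → Rep 1# (qbin 1 a b) (gauss X (2 ℕ.* (m ℕ.* n) ∸ 2 ℕ.* k) (n ∸ k)))
            (≡.sym (top-index k k≤N)) (≡.sym (≡.trans (bottom-index k) (ℤ.⊖-≥ k≤n))) (Rep-qbin 1 X qpow-X
              (2 ℕ.* (m ℕ.* n) ∸ 2 ℕ.* k) (n ∸ k)))
      where
      prefix = Rep-* (Rep-* (Rep-poly (constᴾ (sgn k))) (Rep-cong (qpow≋ k) (Rep-poly (qpow k)))) (Rep-qbin 2 (X ^ 2)
        qpow-X² (m ℕ.* n) k)
    ... | no k≰n = Rep-cong (zeroʳ (ι (sgn k) *ᴾ X ^ k *ᴾ gauss (X ^ 2) (m ℕ.* n) k)) (Rep-* prefix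
            (≡.subst₂ (λ a b → Rep 1# (qbin 1 a b) 0#)
            (≡.sym (top-index k k≤N)) (≡.sym (≡.trans (bottom-index k) (≡.trans (ℤ.⊖-< (ℕ.≰⇒> k≰n))
              (cong (λ z → ℤ.- + z) k∸n)))) (Rep-poly 0#)))
      where
      prefix = Rep-* (Rep-* (Rep-poly (constᴾ (sgn k))) (Rep-cong (qpow≋ k) (Rep-poly (qpow k)))) (Rep-qbin 2 (X ^ 2)
        qpow-X² (m ℕ.* n) k)
      k∸n : k ∸ n ≡ suc (k ∸ suc n)
      k∸n = ≡.sym (≡.trans (≡.sym (ℕ.+-∸-assoc 1 (ℕ.≰⇒> k≰n))) ≡.refl)

    Rep-T₁ : Rep X (T₁ (m ℕ.* n) ((+ m ℤ.- + 1) ℤ.* + n)) (X *ᴾ ∑ (suc n) tTerm)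
    Rep-T₁ = Rep-lift X (Rep-cong ∑-truncated (Rep-∑ (m ℕ.* n) Rep-term))

    rhs : Poly
    rhs = X *ᴾ ι (+ 2 ℤ.* + m) - X *ᴾ (ι (+ n ℤ.* + m ℤ.* (+ 2 ℤ.* + m ℤ.- 1ℤ)) *ᴾ (1# - qpow n))
      +ᴾ ι (sgn n ℤ.* c) *ᴾ (X *ᴾ (ι (+ m) *ᴾ qpow n) - X *ᴾ (ι (+ n ℤ.* + m ℤ.* (+ m ℤ.- 1ℤ)) *ᴾ (1# - qpow n))
        +ᴾ ι (+ 2 ℤ.* + m) *ᴾ (pent-sum n′ - X *ᴾ 1#))

    Rep-RHS : Rep X (RHS m n) rhs
    Rep-RHS = Rep-+ (Rep-- (const₁ (+ 2 ℤ.* + m)) (Rep-lift X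
      (Rep-* (Rep-poly (constᴾ (+ n ℤ.* + m ℤ.* (+ 2 ℤ.* + m ℤ.- 1ℤ)))) (Rep-poly (1# - qpow n)))))
      (Rep-* (Rep-poly (constᴾ (sgn n ℤ.* c))) (Rep-+ (Rep-- (Rep-lift X (Rep-* (Rep-poly (constᴾ (+ m)))
        (Rep-poly (qpow n))))
        (Rep-lift X (Rep-* (Rep-poly (constᴾ (+ n ℤ.* + m ℤ.* (+ m ℤ.- 1ℤ)))) (Rep-poly (1# - qpow n)))))
        (Rep-* (Rep-poly (constᴾ (+ 2 ℤ.* + m))) (Rep-- (Rep-𝓑 n′) (const₁ 1ℤ)))))
      where
      const₁ : ∀ c → Rep X (constᶠ c) (X *ᴾ constᴾ c)
      const₁ c = Rep-lift X (Rep-poly (constᴾ c))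

    rhs≋ : rhs ≋ X *ᴾ (nat 2 *ᴾ nat m - nat n *ᴾ nat m *ᴾ (nat 2 *ᴾ nat m - 1#) *ᴾ ε)
                  +ᴾ ι (sgn n) *ᴾ ι c *ᴾ (X *ᴾ (nat m *ᴾ X ^ n - nat n *ᴾ nat m *ᴾ (nat m - 1#) *ᴾ ε) +ᴾ nat 2 *ᴾ nat
                    m *ᴾ ∑β)
    rhs≋ = ≋-trans (+ᴾ-cong (+ᴾ-cong (*ᴾ-congʳ X 2m) (negᴾ-cong (*ᴾ-congʳ X (*ᴾ-cong nm[2m-1] 1-qⁿ))))
        (*ᴾ-cong (ι-* (sgn n) c) (+ᴾ-cong (+ᴾ-cong (*ᴾ-congʳ X (*ᴾ-congʳ (ι (+ m)) (qpow≋ n)))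
          (negᴾ-cong (*ᴾ-congʳ X (*ᴾ-cong nm[m-1] 1-qⁿ))))
          (*ᴾ-cong 2m (≋-refl {pent-sum n′ - X *ᴾ 1#})))))
      (solve 7 (λ x m n y s c b →
          x :* (con (+ 2) :* m) :- x :* (n :* m :* (con (+ 2) :* m :- :1) :* (:1 :- y))
            :+ s :* c :* (x :* (m :* y) :- x :* (n :* m :* (m :- :1) :* (:1 :- y)) :+ con (+ 2) :* m :* (x :+ b :- x
              :* :1))
        := x :* (con (+ 2) :* m :- n :* m :* (con (+ 2) :* m :- :1) :* (:1 :- y))
            :+ s :* c :* (x :* (m :* y :- n :* m :* (m :- :1) :* (:1 :- y)) :+ con (+ 2) :* m :* b)) ≋-refl
        X (nat m) (nat n) (X ^ n) (ι (sgn n)) (ι c) ∑β)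
      where
      2m : ι (+ 2 ℤ.* + m) ≋ nat 2 *ᴾ nat m
      2m = ι-* (+ 2) (+ m)
      nm : ι (+ n ℤ.* + m) ≋ nat n *ᴾ nat m
      nm = ι-* (+ n) (+ m)
      nm[2m-1] : ι (+ n ℤ.* + m ℤ.* (+ 2 ℤ.* + m ℤ.- 1ℤ)) ≋ nat n *ᴾ nat m *ᴾ (nat 2 *ᴾ nat m - 1#)
      nm[2m-1] = ≋-trans (ι-* (+ n ℤ.* + m) (+ 2 ℤ.* + m ℤ.- 1ℤ)) (*ᴾ-cong nm (+ᴾ-cong 2m (≋-refl {negᴾ 1#})))
      nm[m-1] : ι (+ n ℤ.* + m ℤ.* (+ m ℤ.- 1ℤ)) ≋ nat n *ᴾ nat m *ᴾ (nat m - 1#)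
      nm[m-1] = ≋-trans (ι-* (+ n ℤ.* + m) (+ m ℤ.- 1ℤ)) (*ᴾ-cong nm (≋-refl {nat m - 1#}))
      1-qⁿ : 1# - qpow n ≋ ε
      1-qⁿ = +ᴾ-cong (≋-refl {1#}) (negᴾ-cong (qpow≋ n))

    -- X a = 1 - (1 - X^n)² and (1 - X^n)² = F² P², so X a + F² P² = 1; a common divisor of X and F²
    -- thus divides 1.
    X-coprime : Coprimeᴾ X FF
    X-coprime D (u , hu) (v , hv) = u *ᴾ a +ᴾ v *ᴾ (P *ᴾ P) , ≋⇒≈ᴾ (by₃ a (P *ᴾ P) (F *ᴾ P +ᴾ (X ^ n - 1#))
      (≈ᴾ⇒≋ {D *ᴾ u} {X} hu) (≈ᴾ⇒≋ {D *ᴾ v} {FF} hv) factor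
      (solve 7 (λ D u v x y F P → D :* (u :* (y :* (:1 :+ :1 :- x :* y)) :+ v :* (P :* P)) := :1 :+
        (y :* (:1 :+ :1 :- x :* y)) :* (D :* u :- x)
          :+ (P :* P) :* (D :* v :- F :* F) :+ (F :* P :+ (x :* y :- :1)) :* (F :* P :- (x :* y :- :1))) ≋-refl D u v
            X (X ^ n′) F P))
      where
      a : Poly
      a = X ^ n′ *ᴾ (1# +ᴾ 1# - X ^ n)

    result : T₁ (m ℕ.* n) ((+ m ℤ.- + 1) ℤ.* + n) ≡ RHS m n [modᴾ (Φ n *ᴾ Φ n) ]
    -- The denominator A₂ is X: multiplying by it makes both sides polynomials, since 𝓑ₙ contains no
    -- power of q below q⁻¹.
    result = X *ᴾ ∑ (suc n) tTerm - rhs , X , (λ { (_ ∷ () ∷ _) }) , X-coprime , (_∣_.quotient FF∣ , ≋⇒≈ᴾ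
      (_∣_.equality FF∣)) ,
      ≋⇒≈ᴾ (≋-trans (*-comm (X *ᴾ ∑ (suc n) tTerm - rhs) (den (T₁ (m ℕ.* n) ((+ m ℤ.- + 1) ℤ.* + n) -ᶠ RHS m n)))
        (≋-sym (Rep.cleared (Rep-- Rep-T₁ Rep-RHS))))
      where
      FF∣ : FF ∣ (X *ᴾ ∑ (suc n) tTerm - rhs)
      FF∣ = in-ideal (𝒬.trans congruence (≈⇒~ (≋-sym rhs≋)))

open import Data.Nat using (ℕ; _≤_; _*_)
open import Data.Integer using (+_; _-_)

theorem1p3 : (m n : ℕ) → 1 ≤ m → 1 ≤ n →
    T₁ (m * n) (((+ m) - (+ 1)) Data.Integer.* (+ n)) ≡ RHS m n [modᴾ (Φ n *ᴾ Φ n) ]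
theorem1p3 (suc m) (suc n) _ _ = Congruence.Theorem.result m n
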